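{- Let $\pi\in S_\infty$. The map $\varphi$ (defined in the context) is a bijection from $\operatorname{BPD}(\pi)$ to $\operatorname{PD}(\pi)$, identified with the set of compatible sequences of $\pi$, and it is weight-preserving: for every $D\in\operatorname{BPD}(\pi)$, if $\varphi(D)=(\mathbf a,\mathbf r)$ with $\mathbf r=(r_1,\dots,r_\ell)$, then $\prod_{(i,j)\ \text{blank in } D}x_i=\prod_{k=1}^{\ell}x_{r_k}$.
   Context: Permutations and products: $S_\infty=\bigcup_{n\ge1}S_n$ is the group of bijections of $\mathbb{Z}_{>0}$ fixing all but finitely many points; $s_i=(i\ i{+}1)$; $\ell$ is Coxeter length. Grid cells are indexed in matrix notation $(\text{row},\text{column})$, rows numbered from top. Pipe dreams. A (reduced) pipe dream of $\pi$ is a tiling of $\mathbb{Z}_{>0}\times\mathbb{Z}_{>0}$ by cross tiles and elbow tiles (an elbow tile consists of two arcs, one joining its north and west edges and one joining its south and east edges), with finitely many crosses, forming pipes that enter from the north boundary and leave at the west boundary, such that the pipe entering at the top of column $i$ leaves at the west end of row $\pi(i)$, and no two pipes cross twice. $\operatorname{PD}(\pi)$ is the set of these. Totally order cells by $(i,j)<(i',j')$ iff $i<i'$, or $i=i'$ and $j>j'$. If the crosses of $D\in\operatorname{PD}(\pi)$, $\ell=\ell(\pi)$, are $(r_1,j_1)<\dots<(r_\ell,j_\ell)$, the associated pair is $(\mathbf a,\mathbf r)$ with $a_k=r_k+j_k-1$; this identifies $\operatorname{PD}(\pi)$ with the set of compatible sequences of $\pi$, i.e. pairs $\mathbf a=(a_1,\dots,a_\ell)$,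 $\mathbf r=(r_1,\dots,r_\ell)$ of integer sequences such that $\mathbf a$ is a reduced word of $\pi$, $r_1\le\dots\le r_\ell$, $r_j\le a_j$ for all $j$, and $r_j<r_{j+1}$ whenever $a_j<a_{j+1}$. The weight of $(\mathbf a,\mathbf r)$ is $\prod_k x_{r_k}$. Bumpless pipe dreams. A (reduced) bumpless pipe dream of $\pi$ is a tiling of $\mathbb{Z}_{>0}\times\mathbb{Z}_{>0}$ by six tiles: blank, cross, horizontal segment, vertical segment, r-tile (an elbow joining the south and east edges), and j-tile (an elbow joining the west and north edges), with finitely many crosses, forming pipes labeled by $\mathbb{Z}_{>0}$ such that pipe $i$ enters from the south in column $i$, moves only north and east, and exits to the east in row $\pi(i)$, and no two pipes cross twice. $\operatorname{BPD}(\pi)$ is the set of these; one draws $D$ in an $n\times n$ square when $\pi\in S_n$. A bump tile has the same two arcs as the pipe-dream elbow tile (its north–west arc is a j-turn, its south–east arc an r-turn). Droop: if a pipe $p$ has an r-turn at $(a,b)$ and $c>a$, $d>b$, drooping $p$ at $(a,b)$ into $(c,d)$ replaces the part of $p$ inside the rectangle with rows $a..c$ and columns $b..d$ that runs up column $b$ from row $c$ to row $a$ and then east along row $a$ to column $d$, by the path running east along row $c$ from column $b$ to column $d$ and then up column $d$ to row $a$, leaving the other pipes unchanged and updating tiles accordingly; undrooping is the inverse operation. The operator $\nabla$ on bumpless pipe dreams. Let $D\in\operatorname{BPD}(\pi)$, $\ell(\pi)>0$, drawn in an $n\times n$ grid. Let $r$ be the smallest row containing a blank tile; mark the rightmost blank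 tile of row $r$. Repeat: (1) if the marked blank tile is not the rightmost tile of the maximal horizontal block of contiguous blank tiles containing it, move the mark to the rightmost tile of that block; let the marked tile be $(x,y)$ and let $p$ be the pipe through $(x,y+1)$. (2) If $p\ne y+1$, let $(x',y+1)$, $x'>x$, be the j-tile of $p$ in column $y+1$. (a) For each pipe $q$ crossing $p$ at some $(z,y+1)$ with $x<z<x'$ and such that $(z,y)$ is an r-tile, let $(z',y)$ be the j-tile of $q$ in column $y$; ignoring $p$, droop $q$ at $(z,y)$ within the rectangle with corners $(x,y)$ and $(x',y+1)$, so that $(z,y+1)$ becomes an r-tile and $(z',y+1)$ a j-tile. (b) Undroop $p$ at $(x',y+1)$ into $(x,y)$, move the mark to $(x',y+1)$, and return to (1). (3) If $p=y+1$, then pipes $y$ and $y+1$ cross at some $(x',y+1)$ with $x'>x$; replace this cross by a bump tile, undroop the j-turn of this tile into $(x,y)$, and adjust the pipes between rows $x$ and $x'$ as in (2)(a); stop. Setting $a=y$ for this final step, the result $\nabla D$ lies in $\operatorname{BPD}(s_a\pi)$, and one writes $\operatorname{pop}(D)=(a,r)$. The map $\varphi$: for $D\in\operatorname{BPD}(\pi)$ with $\ell(\pi)=\ell$, $\varphi(D)=((a_1,\dots,a_\ell),(r_1,\dots,r_\ell))$ where $\operatorname{pop}(\nabla^{k-1}D)=(a_k,r_k)$ for $k=1,\dots,\ell$. -}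

module Defs where

-- Bumpless pipe dreams, compatible sequences, and the map φ (via ∇),
-- for permutations π ∈ S_n ⊂ S_∞ drawn in the n × n square.
-- All grid coordinates are 1-based (row, column), rows numbered from the top.

open import Data.Nat using (ℕ; zero; suc; _+_; _*_; _∸_; _≤_; _<_; _≤ᵇ_; _<ᵇ_; _≡ᵇ_; pred)
open import Data.Bool using (Bool; true; false; _∧_; _∨_; not; if_then_else_)
open import Data.Fin using (Fin; toℕ)
import Data.Fin as Fin
open import Data.Fin.Permutation using (Permutation′; _⟨$⟩ʳ_)
open import Data.Maybe using (Maybe; just; nothing; maybe)
import Data.Maybe as Maybe
open import Data.List using (List; []; _∷_; length; map; concatMap; filterᵇ; upTo; null; zip)
open import Data.Bool.ListAction using (any)
open import Data.List.Relation.Unary.All using (All)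
open import Data.List.Relation.Unary.Linked using (Linked)
open import Data.List.Relation.Binary.Pointwise using (Pointwise)
open import Data.Vec using (Vec; toList)
open import Data.Product using (_×_; _,_; proj₁; proj₂)
open import Relation.Binary.PropositionalEquality using (_≡_)

-- π ∈ S_n, viewed as an element of S_∞ (a bijection of ℤ_{>0} fixing all i > n);
-- the value at 0 is irrelevant and set to 0.
toFin : (n i : ℕ) → Maybe (Fin n)
toFin zero    _       = nothing
toFin (suc n) zero    = just Fin.zero
toFin (suc n) (suc i) = Maybe.map Fin.suc (toFin n i)

act : ∀ {n} → Permutation′ n → ℕ → ℕ
act π zero = zero
act {n} π (suc i) = maybe (λ j → suc (toℕ (π ⟨$⟩ʳ j))) (suc i) (toFin n i)

fromTo : ℕ → ℕ → List ℕ
fromTo a b = map (a +_) (upTo (suc b ∸ a))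

coxeterLength : ∀ n → Permutation′ n → ℕ
coxeterLength n π =
  length (filterᵇ (λ ij → act π (proj₂ ij) <ᵇ act π (proj₁ ij))
                  (concatMap (λ i → map (λ j → i , j) (fromTo (suc i) n)) (fromTo 1 n)))

swap : ℕ → ℕ → ℕ
swap a i = if i ≡ᵇ a then suc a else (if i ≡ᵇ suc a then a else i)

-- The word (a₁,…,a_ℓ) acts by applying s_{a₁} first, then s_{a₂}, …, i.e.
-- wordAct a = s_{a_ℓ} ∘ ⋯ ∘ s_{a₁}.  This is the product s_{a₁}⋯s_{a_ℓ} in the paper's
-- convention, under which ∇ maps BPD(π) to BPD(s_a π) with (s_a π)(i) = π(s_a(i)).
wordAct : List ℕ → ℕ → ℕ
wordAct []      i = i
wordAct (a ∷ w) i = wordAct w (swap a i)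

IsWordOf : ∀ {n} → Permutation′ n → List ℕ → Set
IsWordOf π a = All (1 ≤_) a × (∀ i → wordAct a i ≡ act π i)

IsReducedWord : ∀ {n} → Permutation′ n → List ℕ → Set
IsReducedWord π a = IsWordOf π a × (∀ b → IsWordOf π b → length a ≤ length b)

CompatStep : ℕ × ℕ → ℕ × ℕ → Set
CompatStep (a , r) (a′ , r′) = (r ≤ r′) × (a < a′ → r < r′)

IsCompatible : ∀ {n} → Permutation′ n → List ℕ × List ℕ → Set
IsCompatible π (a , r) =
  IsReducedWord π a
  × Pointwise _≤_ r a
  × All (1 ≤_) r
  × Linked CompatStep (zip a r)

data Tile : Set where
  blank cross hor ver rtile jtile : Tile
-- hor = horizontal segment, ver = vertical segment,
-- rtile = elbow joining south and east, jtile = elbow joining west and north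

hasN hasE hasS hasW : Tile → Bool
hasN cross = true
hasN ver   = true
hasN jtile = true
hasN _     = false
hasE cross = true
hasE hor   = true
hasE rtile = true
hasE _     = false
hasS cross = true
hasS ver   = true
hasS rtile = true
hasS _     = false
hasW cross = true
hasW hor   = true
hasW jtile = true
hasW _     = false

isBlank : Tile → Bool
isBlank blank = true
isBlank _     = false

-- an n × n tiling, given as its list of rows (top row first)
Grid : ℕ → Set
Grid n = Vec (Vec Tile n) n

nth : {A : Set} → A → List A → ℕ → A
nth d []       _       = d
nth d (x ∷ xs) zero    = x
nth d (x ∷ xs) (suc i) = nth d xs i

tileAt : ∀ {n} → Grid n → ℕ → ℕ → Tile
tileAt D zero    _       = blank
tileAt D (suc k) zero    = blank
tileAt D (suc k) (suc c) = nth blank (nth [] (map toList (toList D)) k) c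

record ValidTiling (n : ℕ) (D : Grid n) : Set where
  field
    westBoundary    : ∀ k → 1 ≤ k → k ≤ n → hasW (tileAt D k 1) ≡ false
    northBoundary   : ∀ c → 1 ≤ c → c ≤ n → hasN (tileAt D 1 c) ≡ false
    eastBoundary    : ∀ k → 1 ≤ k → k ≤ n → hasE (tileAt D k n) ≡ true
    southBoundary   : ∀ c → 1 ≤ c → c ≤ n → hasS (tileAt D n c) ≡ true
    horizontalMatch : ∀ k c → 1 ≤ k → k ≤ n → 1 ≤ c → c < n →
                      hasE (tileAt D k c) ≡ hasW (tileAt D k (suc c))
    verticalMatch   : ∀ k c → 1 ≤ k → k < n → 1 ≤ c → c ≤ n →
                      hasS (tileAt D k c) ≡ hasN (tileAt D (suc k) c)

data Dir : Set where
  fromS fromW : Dir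

exitsNorth : Tile → Dir → Bool
exitsNorth ver   fromS = true
exitsNorth cross fromS = true
exitsNorth jtile fromW = true
exitsNorth _     _     = false

-- trace (with fuel) a pipe entering cell (k , c) from direction d;
-- returns the list of visited cells and the row where it leaves the square to the east
-- (0 if it does not).
trace : ∀ {n} → Grid n → ℕ → ℕ → ℕ → Dir → List (ℕ × ℕ) × ℕ
trace D zero k c d = [] , 0
trace {n} D (suc f) k c d =
  if exitsNorth (tileAt D k c) d
  then visit (trace D f (pred k) c fromS)
  else (if n ≤ᵇ c then ((k , c) ∷ [] , k) else visit (trace D f k (suc c) fromW))
  where
    visit : List (ℕ × ℕ) × ℕ → List (ℕ × ℕ) × ℕ
    visit (cs , e) = (k , c) ∷ cs , e

pipeTrace : ∀ {n} → Grid n → ℕ → List (ℕ × ℕ) × ℕ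
pipeTrace {n} D i = trace D (2 * n) n i fromS

pipeCells : ∀ {n} → Grid n → ℕ → List (ℕ × ℕ)
pipeCells D i = proj₁ (pipeTrace D i)

exitRow : ∀ {n} → Grid n → ℕ → ℕ
exitRow D i = proj₂ (pipeTrace D i)

sameCell : ℕ × ℕ → ℕ × ℕ → Bool
sameCell (a , b) (c , d) = (a ≡ᵇ c) ∧ (b ≡ᵇ d)

-- number of cells shared by two pipes (= number of crossings between them)
commonCells : List (ℕ × ℕ) → List (ℕ × ℕ) → ℕ
commonCells xs ys = length (filterᵇ (λ p → any (sameCell p) ys) xs)

record IsBPD (n : ℕ) (π : Permutation′ n) (D : Grid n) : Set where
  field
    valid   : ValidTiling n D
    exits   : ∀ i → 1 ≤ i → i ≤ n → exitRow D i ≡ act π i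
    reduced : ∀ i j → 1 ≤ i → i < j → j ≤ n →
              commonCells (pipeCells D i) (pipeCells D j) ≤ 1

-- row indices of the blank tiles of D, with multiplicity (the monomial ∏ x_i)
blankRows : ∀ n → Grid n → List ℕ
blankRows n D =
  concatMap (λ k → map (λ _ → k) (filterᵇ (λ c → isBlank (tileAt D k c)) (fromTo 1 n)))
            (fromTo 1 n)

-- Pipe configurations used to run ∇.
-- A pipe is recorded by its exit row ex and, for each row k with ex ≤ k ≤ n,
-- the column col k at which it enters row k from below (col n = its label).
-- In row k it occupies the columns col k … hi k, where hi k = n if k = ex and
-- hi k = col (k-1) otherwise.  Drooping/undrooping only changes col on a range of rows.

record Pipe : Set where
  constructor mkPipe
  field
    ex  : ℕ
    col : ℕ → ℕ
open Pipe public

Conf : Set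
Conf = ℕ → Pipe

firstCol : ℕ → List (ℕ × ℕ) → ℕ
firstCol k []              = 0
firstCol k ((k′ , c) ∷ cs) = if k ≡ᵇ k′ then c else firstCol k cs

initConf : ∀ {n} → Grid n → Conf
initConf D i = mkPipe (exitRow D i) (λ k → firstCol k (pipeCells D i))

hiCol : ℕ → Pipe → ℕ → ℕ
hiCol n P k = if k ≡ᵇ ex P then n else col P (pred k)

inPipe : ℕ → Pipe → ℕ → ℕ → Bool
inPipe n P k c = (ex P ≤ᵇ k) ∧ (k ≤ᵇ n) ∧ (col P k ≤ᵇ c) ∧ (c ≤ᵇ hiCol n P k)

rAt : Pipe → ℕ → ℕ → Bool
rAt P k c = (c ≡ᵇ col P k) ∧ not ((ex P <ᵇ k) ∧ (col P (pred k) ≡ᵇ c))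

occ : ℕ → Conf → ℕ → ℕ → List ℕ
occ n σ k c = filterᵇ (λ q → inPipe n (σ q) k c) (fromTo 1 n)

blankAt : ℕ → Conf → ℕ → ℕ → Bool
blankAt n σ k c = null (occ n σ k c)

headD : ℕ → List ℕ → ℕ
headD d []      = d
headD d (x ∷ _) = x

lastD : ℕ → List ℕ → ℕ
lastD d []       = d
lastD d (x ∷ xs) = lastD x xs

firstWith : (ℕ → Bool) → List ℕ → ℕ
firstWith p xs = headD 0 (filterᵇ p xs)

setCol : Pipe → ℕ → ℕ → ℕ → Pipe
setCol P lo hi v = mkPipe (ex P) (λ m → if (lo ≤ᵇ m) ∧ (m <ᵇ hi) then v else col P m)

-- Step (2)(a): for the marked tile (x , y) and the lower row x′, droop every pipe q
-- (other than e₁, e₂) having an r-tile at (z , y), x < z < x′, and crossing column y+1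
-- at (z , y+1): with (z′ , y) the j-tile of q in column y, q gets r-tile (z , y+1)
-- and j-tile (z′ , y+1).
droops : ℕ → Conf → ℕ → ℕ → ℕ → ℕ → ℕ → Conf
droops n σ x x′ y e₁ e₂ q =
  if (q ≡ᵇ e₁) ∨ (q ≡ᵇ e₂) then σ q else go zs
  where
    Q = σ q
    zs = filterᵇ (λ z → inPipe n Q z y ∧ rAt Q z y ∧ inPipe n Q z (suc y))
                 (fromTo (suc x) (pred x′))
    go : List ℕ → Pipe
    go []      = Q
    go (z ∷ _) = setCol Q z (firstWith (λ k → (col Q k <ᵇ y) ∧ (col Q (pred k) ≡ᵇ y))
                                        (fromTo (suc z) n))
                        (suc y)

rightEnd : ℕ → Conf → ℕ → ℕ → ℕ → ℕ
rightEnd n σ zero    x y = y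
rightEnd n σ (suc f) x y =
  if (suc y ≤ᵇ n) ∧ blankAt n σ x (suc y) then rightEnd n σ f x (suc y) else y

-- the loop of ∇, with fuel; r is the starting row, (x , y) the marked tile.
-- Returns pop = (a , r) and the new configuration.
nablaLoop : ℕ → ℕ → ℕ → ℕ → ℕ → Conf → Maybe ((ℕ × ℕ) × Conf)
nablaLoop n r zero    x y₀ σ = nothing
nablaLoop n r (suc f) x y₀ σ =
  if p ≡ᵇ suc y then just ((y , r) , σ₃) else nablaLoop n r f x′ (suc y) σ₂
  where
    y  = rightEnd n σ n x y₀
    p  = headD 0 (occ n σ x (suc y))
    -- step (2): p ≠ y+1
    x′ = firstWith (λ k → (col (σ p) k ≤ᵇ y) ∧ (col (σ p) (pred k) ≡ᵇ suc y)) (fromTo (suc x) n)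
    σ₁ = droops n σ x x′ y p p
    σ₂ : Conf
    σ₂ q = if q ≡ᵇ p then setCol (σ p) x x′ y else σ₁ q     -- undroop p into (x , y)
    -- step (3): p = y+1; pipes y and y+1 cross at (x₃ , y+1)
    Py  = σ y
    Py₁ = σ (suc y)
    x₃ = firstWith (λ k → col Py k ≡ᵇ y) (fromTo (ex Py) n)
    σ₁′ = droops n σ x x₃ y y (suc y)
    -- after replacing the cross by a bump tile: pipe y continues as pipe y+1 did and
    -- vice versa; then the j-turn of pipe y at (x₃ , y+1) is undrooped into (x , y)
    A = setCol (mkPipe (ex Py₁) (λ k → if x₃ ≤ᵇ k then col Py k else col Py₁ k)) x x₃ y
    B = mkPipe (ex Py) (λ k → if x₃ ≤ᵇ k then col Py₁ k else col Py k)
    σ₃ : Conf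
    σ₃ q = if q ≡ᵇ y then A else (if q ≡ᵇ suc y then B else σ₁′ q)

nabla : ℕ → Conf → Maybe ((ℕ × ℕ) × Conf)
nabla n σ = start (filterᵇ (λ k → any (blankAt n σ k) (fromTo 1 n)) (fromTo 1 n))
  where
    start : List ℕ → Maybe ((ℕ × ℕ) × Conf)
    start []      = nothing
    start (r ∷ _) = nablaLoop n r (suc n) r (lastD 0 (filterᵇ (blankAt n σ r) (fromTo 1 n))) σ

pops : ℕ → ℕ → Conf → List ℕ × List ℕ
pops n zero    σ = [] , []
pops n (suc m) σ = go (nabla n σ)
  where
    go : Maybe ((ℕ × ℕ) × Conf) → List ℕ × List ℕ
    go nothing                = [] , []
    go (just ((a , r) , σ′)) = (a ∷ proj₁ (pops n m σ′)) , (r ∷ proj₂ (pops n m σ′))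

φ : ∀ n → Permutation′ n → Grid n → List ℕ × List ℕ
φ n π D = pops n (coxeterLength n π) (initConf D)

{-# OPTIONS --safe #-}
-- Label every edge of a bumpless pipe dream by the exit row of the pipe using it, and let
-- V k be the sequence of labels below row k.  The tiling is reduced iff in every crossing
-- the vertical label is smaller than the horizontal one, so reducedness is a local
-- condition.  In these terms ∇ is a transducer reading the rows from top to bottom: from
-- the first row r with a blank on, V k is replaced by V k ∘ s_{y k}, where y k is the
-- column of the mark.  In the next row either the pipe at column y k + 1 goes straight on
-- and the mark stays in its column, or that pipe turns left and the mark moves to the end
-- of the run of blanks created there.  At the bottom π becomes π ∘ s_a with a = y n.
--
-- The transducer can be run backwards from the bottom, which gives injectivity.  If the
-- marks y of D and y′ of ∇D start in the same row, then y′ k < y k in all rows; this is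
-- the compatibility condition, and conversely it keeps the backward run from getting
-- stuck to the left of the blanks, which gives surjectivity.
module Submission where

open import Defs
open import Data.Nat using (ℕ; zero; suc; _+_; _*_; _∸_; _≤_; _<_; _≤ᵇ_; _<ᵇ_; _≡ᵇ_; pred; z≤n; s≤s; z<s; _≟_; _≤?_; _<?_; >-nonZero)
open import Data.Nat.Properties
open import Data.Bool using (Bool; true; false; _∧_; not; if_then_else_; T)
open import Data.Bool.ListAction using (any)
open import Data.Bool.Properties using (T?)
open import Data.Empty using (⊥; ⊥-elim)
open import Data.Fin using (Fin; toℕ)
import Data.Fin as Fin
open import Data.Fin.Permutation using (Permutation′; _⟨$⟩ʳ_; _⟨$⟩ˡ_; inverseˡ)
open import Data.Fin.Properties using (toℕ-injective; toℕ<n)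
open import Data.List using (List; []; _∷_; _++_; map; filterᵇ; length; concatMap; zip; replicate; applyUpTo; null)
open import Data.List.Membership.Propositional using (_∈_)
open import Data.List.Properties using (length-++; filter-++)
open import Data.List.Relation.Binary.Permutation.Propositional using (_↭_; ↭-reflexive; ↭-trans; ↭-prep)
open import Data.List.Relation.Binary.Permutation.Propositional.Properties using (shift; ++⁺ˡ)
open import Data.List.Relation.Binary.Pointwise using (Pointwise; []; _∷_)
open import Data.List.Relation.Unary.All using (All; []; _∷_)
import Data.List.Relation.Unary.All as All
open import Data.List.Relation.Unary.AllPairs using (AllPairs; []; _∷_)
open import Data.List.Relation.Unary.Any using (here; there)
open import Data.List.Relation.Unary.Linked using (Linked; []; [-]; _∷_)
open import Data.Maybe using (just; nothing)
open import Data.Product using (Σ-syntax; ∃-syntax; _×_; _,_; proj₁; proj₂)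
open import Data.Sum using (_⊎_; inj₁; inj₂)
open import Data.Unit using (⊤; tt)
open import Data.Vec using (Vec; []; _∷_; toList)
open import Function using (_∘_; id; case_of_)
open import Relation.Binary.Definitions using (tri<; tri≈; tri>)
open import Relation.Binary.PropositionalEquality using (_≡_; _≢_; refl; sym; trans; cong; cong₂; subst; subst₂; ≢-sym; module ≡-Reasoning)
open import Relation.Nullary using (¬_; Dec; yes; no)

-- The given ∇ acts on the column functions of single pipes and treats many rows in one round,
-- whereas the transducer needs the labels on every horizontal line. `Rep` links the two. Between
-- rounds the object is the reduced bumpless pipe dream `hyb ξ`, with new states above and old ones
-- below, so that all facts about labels stay available in the middle of a run.
--
-- Why exit rows: read from the top, the pipe labelled `k` joins in row `k` from the east. Two pipes
-- change sides only at a crossing, and which of them is vertical there tells in which direction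
-- they change. But labels are read off a tiling by tracing, before anything is known about its
-- crossings. Cells are therefore parametrised by the relation demanded at a crossing: `All≺` for an
-- arbitrary tiling, `_<_` once reducedness has been used.
--
-- The backward run is never compared with φ as a program. Both are shown to satisfy the relation
-- `Out`, and determinism of `Out` identifies their results.

T⇒true : ∀ {b} → T b → b ≡ true
T⇒true {true} _ = refl

true⇒T : ∀ {b} → b ≡ true → T b
true⇒T refl = _

¬T⇒false : ∀ {b} → ¬ T b → b ≡ false
¬T⇒false {true}  f = ⊥-elim (f _)
¬T⇒false {false} _ = refl

≡ᵇ-yes : ∀ {m n} → m ≡ n → (m ≡ᵇ n) ≡ true
≡ᵇ-yes {m} {n} e = T⇒true (≡⇒≡ᵇ m n e)

≡ᵇ-no : ∀ {m n} → m ≢ n → (m ≡ᵇ n) ≡ false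
≡ᵇ-no {m} {n} e = ¬T⇒false (λ t → e (≡ᵇ⇒≡ m n t))

≡ᵇ-true : ∀ {m n} → (m ≡ᵇ n) ≡ true → m ≡ n
≡ᵇ-true {m} {n} e = ≡ᵇ⇒≡ m n (true⇒T e)

≤ᵇ-yes : ∀ {m n} → m ≤ n → (m ≤ᵇ n) ≡ true
≤ᵇ-yes e = T⇒true (≤⇒≤ᵇ e)

≤ᵇ-no : ∀ {m n} → n < m → (m ≤ᵇ n) ≡ false
≤ᵇ-no {m} {n} e = ¬T⇒false (λ t → <⇒≱ e (≤ᵇ⇒≤ m n t))

≤ᵇ-true : ∀ {m n} → (m ≤ᵇ n) ≡ true → m ≤ n
≤ᵇ-true {m} {n} e = ≤ᵇ⇒≤ m n (true⇒T e)

<ᵇ-yes : ∀ {m n} → m < n → (m <ᵇ n) ≡ true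
<ᵇ-yes e = T⇒true (<⇒<ᵇ e)

<ᵇ-no : ∀ {m n} → n ≤ m → (m <ᵇ n) ≡ false
<ᵇ-no {m} {n} e = ¬T⇒false (λ t → ≤⇒≯ e (<ᵇ⇒< m n t))

<ᵇ-true : ∀ {m n} → (m <ᵇ n) ≡ true → m < n
<ᵇ-true {m} {n} e = <ᵇ⇒< m n (true⇒T e)

∧-true : ∀ {a b} → (a ∧ b) ≡ true → a ≡ true × b ≡ true
∧-true {true} {true} _ = refl , refl

∧-yes : ∀ {a b} → a ≡ true → b ≡ true → (a ∧ b) ≡ true
∧-yes refl refl = refl

∧-noʳ : ∀ {a b} → b ≡ false → (a ∧ b) ≡ false
∧-noʳ {true}  refl = refl
∧-noʳ {false} refl = refl

true≢false : ∀ {b} → b ≡ true → b ≡ false → ⊥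
true≢false refl ()

≢true⇒false : ∀ {b} → b ≢ true → b ≡ false
≢true⇒false {true}  f = ⊥-elim (f refl)
≢true⇒false {false} _ = refl

if-yes : ∀ {A : Set} {b} {x y : A} → b ≡ true → (if b then x else y) ≡ x
if-yes refl = refl

if-no : ∀ {A : Set} {b} {x y : A} → b ≡ false → (if b then x else y) ≡ y
if-no refl = refl

-- Adjacent transpositions

swap-l : ∀ y → swap y y ≡ suc y
swap-l y = if-yes (≡ᵇ-yes {y} refl)

swap-r : ∀ y → swap y (suc y) ≡ y
swap-r y = trans (if-no (≡ᵇ-no {suc y} {y} 1+n≢n)) (if-yes (≡ᵇ-yes {y} refl))

swap-o : ∀ {y c} → c ≢ y → c ≢ suc y → swap y c ≡ c
swap-o {y} {c} p q = trans (if-no (≡ᵇ-no p)) (if-no (≡ᵇ-no q))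

data SwapView (y : ℕ) : ℕ → Set where
  left  : SwapView y y
  right : SwapView y (suc y)
  other : ∀ {c} → c ≢ y → c ≢ suc y → SwapView y c

swapView : ∀ y c → SwapView y c
swapView y c with c ≟ y
... | yes refl = left
... | no p with c ≟ suc y
...   | yes refl = right
...   | no q = other p q

swap-invol : ∀ y c → swap y (swap y c) ≡ c
swap-invol y c with swapView y c
... | left = trans (cong (swap y) (swap-l y)) (swap-r y)
... | right = trans (cong (swap y) (swap-r y)) (swap-l y)
... | other p q = trans (cong (swap y) (swap-o p q)) (swap-o p q)

-- Labelled cells and rows

State : Set
State = ℕ → ℕ

-- The labels N E S W on the four edges of a cell with a given tile, where 0 means that
-- no pipe uses the edge.  Labels are exit rows, so that a crossing is the first one of
-- its two pipes exactly if the vertical label is the smaller one: _≺_ is _<_ for reduced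
-- tilings.
data LCell (_≺_ : ℕ → ℕ → Set) : Tile → ℕ → ℕ → ℕ → ℕ → Set where
  cBlank : LCell _≺_ blank 0 0 0 0
  cCross : ∀ {u w} → u ≺ w → LCell _≺_ cross (suc u) (suc w) (suc u) (suc w)
  cHor   : ∀ {w} → LCell _≺_ hor 0 (suc w) 0 (suc w)
  cVer   : ∀ {u} → LCell _≺_ ver (suc u) 0 (suc u) 0
  cR     : ∀ {w} → LCell _≺_ rtile 0 (suc w) (suc w) 0
  cJ     : ∀ {u} → LCell _≺_ jtile (suc u) 0 0 (suc u)

Cell : Tile → ℕ → ℕ → ℕ → ℕ → Set
Cell = LCell _<_

private
  variable
    _≺_ : ℕ → ℕ → Set

-- The north, east and south edges determine the tile, so `tile` is computed from the two states and
-- is not extra data. Impossible combinations of edges get arbitrary values.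
shape : ℕ → ℕ → ℕ → Tile
shape zero    zero    _       = blank
shape zero    (suc _) zero    = hor
shape zero    (suc _) (suc _) = rtile
shape (suc _) zero    zero    = jtile
shape (suc _) zero    (suc _) = ver
shape (suc _) (suc _) _       = cross

cell-shape : ∀ {t N E S W} → LCell _≺_ t N E S W → shape N E S ≡ t
cell-shape cBlank     = refl
cell-shape (cCross _) = refl
cell-shape cHor       = refl
cell-shape cVer       = refl
cell-shape cR         = refl
cell-shape cJ         = refl

cell-east : ∀ {t N E S W} → LCell _≺_ t N E S W → (S + W) ∸ N ≡ E
cell-east cBlank             = refl
cell-east (cCross {u} {w} _) = m+n∸m≡n (suc u) (suc w)
cell-east cHor               = refl
cell-east (cVer {u})         = m+n∸m≡n (suc u) 0
cell-east (cR {w})           = +-identityʳ (suc w)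
cell-east (cJ {u})           = n∸n≡0 (suc u)

cell-perm : ∀ {t N E S W} → LCell _≺_ t N E S W → (N ≡ S × E ≡ W) ⊎ (N ≡ W × E ≡ S)
cell-perm cBlank     = inj₁ (refl , refl)
cell-perm (cCross _) = inj₁ (refl , refl)
cell-perm cHor       = inj₁ (refl , refl)
cell-perm cVer       = inj₁ (refl , refl)
cell-perm cR         = inj₂ (refl , refl)
cell-perm cJ         = inj₂ (refl , refl)

cell-subst : ∀ {t t′ N N′ E E′ S S′ W W′} → t′ ≡ t → N′ ≡ N → E′ ≡ E → S′ ≡ S → W′ ≡ W → LCell _≺_ t N E S W → LCell _≺_ t′ N′ E′ S′ W′
cell-subst refl refl refl refl refl x = x

-- Every cell satisfies `N + E = S + W` and nothing enters from the west, so the labels above and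
-- below force the horizontal ones. Truncated subtraction is harmless, since `LRow` asks that each
-- column really form a cell.
carrier : State → State → ℕ → ℕ
carrier u v zero    = 0
carrier u v (suc c) = (v (suc c) + carrier u v c) ∸ u (suc c)

tile : State → State → ℕ → Tile
tile u v c = shape (u c) (carrier u v c) (v c)

-- A row of width n with labels u above and v below, which the pipe k leaves to the east;
-- carrier u v c labels the edge to the right of column c.
record LRow (_≺_ : ℕ → ℕ → Set) (n k : ℕ) (u v : State) : Set where
  field
    cell : ∀ c → c < n → LCell _≺_ (tile u v (suc c)) (u (suc c)) (carrier u v (suc c)) (v (suc c)) (carrier u v c)
    exit : carrier u v n ≡ k

module Row = LRow

Row : (n k : ℕ) (u v : State) → Set
Row = LRow _<_

-- For rows that come with their own horizontal labels `h` and tiles `t`, as those of a given tiling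
-- do: conservation in each cell forces both to agree with the computed ones.
row-intro : ∀ {n k u v} (h : ℕ → ℕ) (t : ℕ → Tile) → h 0 ≡ 0 → h n ≡ k →
  (∀ c → c < n → LCell _≺_ (t (suc c)) (u (suc c)) (h (suc c)) (v (suc c)) (h c)) →
  LRow _≺_ n k u v × (∀ c → c < n → tile u v (suc c) ≡ t (suc c)) × (∀ c → c ≤ n → carrier u v c ≡ h c)
row-intro {n = n} {u = u} {v} h t h0 hn cells = record
    { cell = λ c l → cell-subst (tl c l) refl (same (suc c) l) refl (same c (<⇒≤ l)) (cells c l)
    ; exit = trans (same n ≤-refl) hn } , tl , same
  where
    same : ∀ c → c ≤ n → carrier u v c ≡ h c
    same zero    _ = sym h0
    same (suc c) l = trans (cong (λ x → (v (suc c) + x) ∸ u (suc c)) (same c (<⇒≤ l))) (cell-east (cells c l))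
    tl : ∀ c → c < n → tile u v (suc c) ≡ t (suc c)
    tl c l = trans (cong (λ x → shape (u (suc c)) x (v (suc c))) (same (suc c) l)) (cell-shape (cells c l))

Agree : ℕ → State → State → Set
Agree n u u′ = ∀ c → 1 ≤ c → c ≤ n → u′ c ≡ u c

carrier-cong : ∀ {n u u′ v v′} → Agree n u u′ → Agree n v v′ → ∀ c → c ≤ n → carrier u′ v′ c ≡ carrier u v c
carrier-cong eu ev zero    _ = refl
carrier-cong eu ev (suc c) l = cong₂ _∸_ (cong₂ _+_ (ev (suc c) z<s l) (carrier-cong eu ev c (<⇒≤ l))) (eu (suc c) z<s l)

shape-cong : ∀ {a b c a′ b′ c′} → a ≡ a′ → b ≡ b′ → c ≡ c′ → shape a b c ≡ shape a′ b′ c′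
shape-cong refl refl refl = refl

tile-cong : ∀ {n u u′ v v′} → Agree n u u′ → Agree n v v′ → ∀ c → 1 ≤ c → c ≤ n → tile u′ v′ c ≡ tile u v c
tile-cong eu ev c l m = shape-cong (eu c l m) (carrier-cong eu ev c m) (ev c l m)

row-cong : ∀ {n k u u′ v v′} → Agree n u u′ → Agree n v v′ → Row n k u v → Row n k u′ v′
row-cong {n} eu ev R = record
  { cell = λ c l → cell-subst (tile-cong eu ev (suc c) z<s l) (eu _ z<s l) (carrier-cong eu ev _ l)
                     (ev _ z<s l) (carrier-cong eu ev _ (<⇒≤ l)) (Row.cell R c l)
  ; exit = trans (carrier-cong eu ev n ≤-refl) (Row.exit R) }

bit : Tile → ℕ
bit t = if isBlank t then 1 else 0

blanks : State → State → ℕ → ℕ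
blanks u v zero    = 0
blanks u v (suc c) = bit (tile u v (suc c)) + blanks u v c

blanks-cong : ∀ {n u u′ v v′} → Agree n u u′ → Agree n v v′ → ∀ c → c ≤ n → blanks u′ v′ c ≡ blanks u v c
blanks-cong eu ev zero    _ = refl
blanks-cong eu ev (suc c) l = cong₂ _+_ (cong bit (tile-cong eu ev (suc c) z<s l)) (blanks-cong eu ev c (<⇒≤ l))

Off : ℕ → State → State → Set
Off b u u′ = ∀ c → c ≢ suc b → c ≢ suc (suc b) → u′ c ≡ u c

-- `balance` compares numbers of blanks without subtraction: if the compensations `e` and `e′` even
-- out the two altered columns, they even out the whole row.
record Rewired (n k b : ℕ) (u v u′ v′ : State) (t₁ t₂ : Tile) : Set where
  field
    row     : Row n k u′ v′
    tile₁   : tile u′ v′ (suc b) ≡ t₁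
    tile₂   : tile u′ v′ (suc (suc b)) ≡ t₂
    tileO   : ∀ c → c ≢ suc b → c ≢ suc (suc b) → tile u′ v′ c ≡ tile u v c
    balance : ∀ e e′ → e′ + (bit t₂ + bit t₁) ≡ e + (bit (tile u v (suc (suc b))) + bit (tile u v (suc b))) →
              e′ + blanks u′ v′ n ≡ e + blanks u v n

module _ {n k u v} (R : Row n k u v) {b} (b< : suc b < n) {u′ v′} (eu : Off b u u′) (ev : Off b v v′)
         {t₁ t₂ g} (c₁ : Cell t₁ (u′ (suc b)) g (v′ (suc b)) (carrier u v b))
         (c₂ : Cell t₂ (u′ (suc (suc b))) (carrier u v (suc (suc b))) (v′ (suc (suc b))) g) where

  private
    step : ∀ c → suc c ≢ suc b → suc c ≢ suc (suc b) → carrier u′ v′ c ≡ carrier u v c → carrier u′ v′ (suc c) ≡ carrier u v (suc c)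
    step c p q e = cong₂ _∸_ (cong₂ _+_ (ev _ p q) e) (eu _ p q)

    pre : ∀ c → c ≤ b → carrier u′ v′ c ≡ carrier u v c
    pre zero    _ = refl
    pre (suc c) l = step c (λ e → <⇒≢ (s≤s l) e) (λ e → <⇒≢ (m<n⇒m<1+n (s≤s l)) e) (pre c (<⇒≤ l))

    mid : carrier u′ v′ (suc b) ≡ g
    mid = trans (cong (λ h → (v′ (suc b) + h) ∸ u′ (suc b)) (pre b ≤-refl)) (cell-east c₁)

    mid₂ : carrier u′ v′ (suc (suc b)) ≡ carrier u v (suc (suc b))
    mid₂ = trans (cong (λ h → (v′ (suc (suc b)) + h) ∸ u′ (suc (suc b))) mid) (cell-east c₂)

    off₁ : ∀ d → suc d + (suc (suc b)) ≢ suc b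
    off₁ d e = <⇒≢ (s≤s (≤-trans (n≤1+n _) (m≤n+m _ d))) (sym e)

    off₂ : ∀ d → suc d + (suc (suc b)) ≢ suc (suc b)
    off₂ d e = <⇒≢ (s≤s (m≤n+m _ d)) (sym e)

    post : ∀ d → carrier u′ v′ (d + suc (suc b)) ≡ carrier u v (d + suc (suc b))
    post zero    = mid₂
    post (suc d) = step (d + suc (suc b)) (off₁ d) (off₂ d) (post d)

    post′ : ∀ c → suc (suc b) ≤ c → carrier u′ v′ c ≡ carrier u v c
    post′ c l = subst (λ x → carrier u′ v′ x ≡ carrier u v x) (m∸n+n≡m l) (post (c ∸ suc (suc b)))

    away : ∀ c → c ≢ suc b → carrier u′ v′ c ≡ carrier u v c
    away c p with c ≤? b
    ... | yes l = pre c l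
    ... | no  l = post′ c (≤∧≢⇒< (≰⇒> l) (≢-sym p))

    t1 : tile u′ v′ (suc b) ≡ t₁
    t1 = trans (shape-cong refl mid refl) (cell-shape c₁)

    t2 : tile u′ v′ (suc (suc b)) ≡ t₂
    t2 = trans (shape-cong refl mid₂ refl) (cell-shape c₂)

    tO : ∀ c → c ≢ suc b → c ≢ suc (suc b) → tile u′ v′ c ≡ tile u v c
    tO c p q = shape-cong (eu c p q) (away c p) (ev c p q)

    cells : ∀ c → c < n → Cell (tile u′ v′ (suc c)) (u′ (suc c)) (carrier u′ v′ (suc c)) (v′ (suc c)) (carrier u′ v′ c)
    cells c l with c ≟ b
    ... | yes refl = cell-subst t1 refl mid refl (pre b ≤-refl) c₁
    ... | no p with c ≟ suc b
    ...   | yes refl = cell-subst t2 refl mid₂ refl mid c₂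
    ...   | no q = cell-subst (tO _ (p ∘ suc-injective) (q ∘ suc-injective)) (eu _ (p ∘ suc-injective) (q ∘ suc-injective))
                     (away (suc c) (p ∘ suc-injective)) (ev _ (p ∘ suc-injective) (q ∘ suc-injective)) (away c q) (Row.cell R c l)

    blPre : ∀ c → c ≤ b → blanks u′ v′ c ≡ blanks u v c
    blPre zero    _ = refl
    blPre (suc c) l = cong₂ _+_ (cong bit (tO (suc c) (λ e → <⇒≢ (s≤s l) e) (λ e → <⇒≢ (m<n⇒m<1+n (s≤s l)) e))) (blPre c (<⇒≤ l))

    shuffle : ∀ a x y z → a + (x + (y + z)) ≡ (a + (x + y)) + z
    shuffle a x y z = trans (cong (a +_) (sym (+-assoc x y z))) (sym (+-assoc a (x + y) z))

    blPost : ∀ e e′ → e′ + (bit t₂ + bit t₁) ≡ e + (bit (tile u v (suc (suc b))) + bit (tile u v (suc b))) →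
              ∀ d → e′ + blanks u′ v′ (d + suc (suc b)) ≡ e + blanks u v (d + suc (suc b))
    blPost e e′ h zero = begin
      e′ + (bit (tile u′ v′ (suc (suc b))) + (bit (tile u′ v′ (suc b)) + blanks u′ v′ b))
        ≡⟨ cong (e′ +_) (cong₂ _+_ (cong bit t2) (cong₂ _+_ (cong bit t1) (blPre b ≤-refl))) ⟩
      e′ + (bit t₂ + (bit t₁ + blanks u v b))
        ≡⟨ shuffle e′ (bit t₂) (bit t₁) (blanks u v b) ⟩
      (e′ + (bit t₂ + bit t₁)) + blanks u v b
        ≡⟨ cong (_+ blanks u v b) h ⟩
      (e + (bit (tile u v (suc (suc b))) + bit (tile u v (suc b)))) + blanks u v b
        ≡⟨ sym (shuffle e (bit (tile u v (suc (suc b)))) (bit (tile u v (suc b))) (blanks u v b)) ⟩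
      _ ∎
      where open ≡-Reasoning
    blPost e e′ h (suc d) = begin
      e′ + (bit (tile u′ v′ (suc d + suc (suc b))) + blanks u′ v′ (d + suc (suc b)))
        ≡⟨ cong (λ z → e′ + (bit z + blanks u′ v′ (d + suc (suc b)))) (tO _ (off₁ d) (off₂ d)) ⟩
      e′ + (B + blanks u′ v′ (d + suc (suc b))) ≡⟨ exch e′ B _ ⟩
      B + (e′ + blanks u′ v′ (d + suc (suc b))) ≡⟨ cong (B +_) (blPost e e′ h d) ⟩
      B + (e + blanks u v (d + suc (suc b)))    ≡⟨ sym (exch e B _) ⟩
      _ ∎
      where
        open ≡-Reasoning
        B = bit (tile u v (suc d + suc (suc b)))
        exch : ∀ x y z → x + (y + z) ≡ y + (x + z)
        exch x y z = trans (sym (+-assoc x y z)) (trans (cong (_+ z) (+-comm x y)) (+-assoc y x z))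

  -- The label entering the two columns from the west and the one leaving them to the east are kept.
  -- Only the label `g` between the two cells is new, so all other cells survive unchanged.
  rewire : Rewired n k b u v u′ v′ t₁ t₂
  rewire = record
    { row = record { cell = cells ; exit = trans (post′ n b<) (Row.exit R) }
    ; tile₁ = t1 ; tile₂ = t2 ; tileO = tO
    ; balance = λ e e′ h → subst (λ m → e′ + blanks u′ v′ m ≡ e + blanks u v m) (m∸n+n≡m b<) (blPost e e′ h (n ∸ suc (suc b))) }

-- Local moves of the mark

-- If p is the pipe to the right of the mark, a pipe a at the mark has already crossed p.
Clear : ℕ → ℕ → Set
Clear p a = a ≡ 0 ⊎ p < a

clear-cong : ∀ {p p′ a a′} → p ≡ p′ → a ≡ a′ → Clear p a → Clear p′ a′
clear-cong refl refl x = x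

-- The exchange carries the vertical pipe `p` one column to the left. A j-tile beside a vertical
-- segment turns into a new crossing, whose inequality comes from `Clear`; an r-tile beside a
-- crossing loses that crossing, whose inequality becomes `Clear` below the row. These two cases are
-- the two ends of a droop in step (2)(a).
pass-cells : ∀ {t₁ t₂ a a′ g h f p} → Cell t₁ a g a′ f → Cell t₂ p h p g → p ≢ 0 → Clear p a →
  ∃[ g′ ] ∃[ t₁′ ] ∃[ t₂′ ] Cell t₁′ p g′ p f × Cell t₂′ a h a′ g′ × Clear p a′ × bit t₂′ + bit t₁′ ≡ bit t₂ + bit t₁
pass-cells c₁ cBlank z _ = ⊥-elim (z refl)
pass-cells c₁ cHor z _ = ⊥-elim (z refl)
pass-cells cBlank cVer _ _ = _ , _ , _ , cVer , cBlank , inj₁ refl , refl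
pass-cells cVer cVer _ i = _ , _ , _ , cVer , cVer , i , refl
pass-cells cJ cVer _ (inj₂ (s≤s l)) = _ , _ , _ , cCross l , cJ , inj₁ refl , refl
pass-cells cHor (cCross l) _ _ = _ , _ , _ , cCross l , cHor , inj₁ refl , refl
pass-cells cR (cCross l) _ _ = _ , _ , _ , cVer , cR , inj₂ (s≤s l) , refl
pass-cells (cCross m) (cCross l) _ i = _ , _ , _ , cCross l , cCross m , i , refl

pass⁻-cells : ∀ {t₁ t₂ a a′ g h f p} → Cell t₁ p g p f → Cell t₂ a h a′ g → p ≢ 0 → Clear p a′ →
  ∃[ g′ ] ∃[ t₁′ ] ∃[ t₂′ ] Cell t₁′ a g′ a′ f × Cell t₂′ p h p g′ × Clear p a
pass⁻-cells cBlank c z _ = ⊥-elim (z refl)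
pass⁻-cells cHor c z _ = ⊥-elim (z refl)
pass⁻-cells cVer cBlank _ _ = _ , _ , _ , cBlank , cVer , inj₁ refl
pass⁻-cells cVer cVer _ i = _ , _ , _ , cVer , cVer , i
pass⁻-cells cVer cR _ (inj₂ (s≤s l)) = _ , _ , _ , cR , cCross l , inj₁ refl
pass⁻-cells (cCross l) cHor _ _ = _ , _ , _ , cHor , cCross l , inj₁ refl
pass⁻-cells (cCross l) (cCross m) _ i = _ , _ , _ , cCross m , cCross l , i
pass⁻-cells (cCross l) cJ _ _ = _ , _ , _ , cJ , cVer , inj₂ (s≤s l)

start-cells : ∀ {t₂ a a′ b b′ g h f} → Cell blank a g a′ f → Cell t₂ b h b′ g → t₂ ≢ blank →
  ∃[ g′ ] ∃[ t₂′ ] Cell rtile a g′ b′ f × Cell t₂′ b h a′ g′ × t₂′ ≢ blank × a′ ≡ 0 × b′ ≢ 0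
start-cells cBlank cBlank z = ⊥-elim (z refl)
start-cells cBlank cVer _ = _ , _ , cR , cJ , (λ ()) , refl , (λ ())
start-cells cBlank cR _ = _ , _ , cR , cHor , (λ ()) , refl , (λ ())

-- A crossing to the right of the r-turn would have the smaller label vertical, which `Clear`
-- forbids. In the remaining cases the right neighbour receives nothing from the south.
start⁻-cells : ∀ {t₂ a a′ b b′ g h f} → Cell rtile a g a′ f → Cell t₂ b h b′ g → Clear a′ b′ →
  ∃[ t₂′ ] Cell blank a 0 b′ f × Cell t₂′ b h a′ 0 × t₂′ ≢ blank × b′ ≡ 0
start⁻-cells cR cHor _ = _ , cBlank , cR , (λ ()) , refl
start⁻-cells cR (cCross l) (inj₂ (s≤s m)) = ⊥-elim (<-asym l m)
start⁻-cells cR cJ _ = _ , cBlank , cVer , (λ ()) , refl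

-- A crossing to the left of the j-tile would involve the turning pipe and a pipe that has already
-- crossed it, so `Clear` excludes it.
leave-cells : ∀ {t₁ a a′ b b′ g h f} → Cell t₁ a g a′ f → Cell jtile b h b′ g → Clear b a →
  ∃[ t₁′ ] Cell t₁′ b 0 a′ f × Cell blank a h b′ 0 × t₁ ≢ blank × t₁′ ≢ blank × a ≡ 0 × b′ ≡ 0
leave-cells cHor cJ _ = _ , cJ , cBlank , (λ ()) , (λ ()) , refl , refl
leave-cells cR cJ _ = _ , cVer , cBlank , (λ ()) , (λ ()) , refl , refl
leave-cells (cCross l) cJ (inj₂ (s≤s m)) = ⊥-elim (<-asym l m)

leave⁻-cells : ∀ {t₁ a a′ b b′ g h f} → Cell t₁ b g a′ f → Cell blank a h b′ g → t₁ ≢ blank →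
  ∃[ t₁′ ] Cell t₁′ a b a′ f × Cell jtile b h b′ b × b ≢ 0 × a ≡ 0
leave⁻-cells cBlank cBlank z = ⊥-elim (z refl)
leave⁻-cells cVer cBlank _ = _ , cR , cJ , (λ ()) , refl
leave⁻-cells cJ cBlank _ = _ , cHor , cJ , (λ ()) , refl

bit-nb : ∀ {t} → t ≢ blank → bit t ≡ 0
bit-nb {blank} z = ⊥-elim (z refl)
bit-nb {cross} _ = refl
bit-nb {hor} _ = refl
bit-nb {ver} _ = refl
bit-nb {rtile} _ = refl
bit-nb {jtile} _ = refl

bits-start : ∀ {t₂ s₁ s₂} → t₂ ≢ blank → s₂ ≢ blank → s₁ ≡ blank → 1 + (bit t₂ + 0) ≡ bit s₂ + bit s₁
bits-start a b refl rewrite bit-nb a | bit-nb b = refl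

bits-leave : ∀ {t₁ s₁ s₂} → s₁ ≢ blank → t₁ ≢ blank → s₂ ≡ jtile → 1 + bit t₁ ≡ 1 + (bit s₂ + bit s₁)
bits-leave a b refl rewrite bit-nb a | bit-nb b = refl

off-swap : ∀ {b} u → Off b u (u ∘ swap (suc b))
off-swap u c p q = cong u (swap-o p q)

off-id : ∀ {b} u → Off b u u
off-id u c p q = refl

at-l : ∀ (u : State) y → (u ∘ swap y) y ≡ u (suc y)
at-l u y = cong u (swap-l y)

at-r : ∀ (u : State) y → (u ∘ swap y) (suc y) ≡ u y
at-r u y = cong u (swap-r y)

cellAt : ∀ {n k u v} → Row n k u v → ∀ {b} → suc b ≤ n → Cell (tile u v (suc b)) (u (suc b)) (carrier u v (suc b)) (v (suc b)) (carrier u v b)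
cellAt R {b} l = Row.cell R b l

record Changed (n k y : ℕ) (u v u′ v′ : State) : Set where
  field
    row    : Row n k u′ v′
    others : ∀ c → c ≢ y → c ≢ suc y → tile u′ v′ c ≡ tile u v c

private
  changed : ∀ {n k b u v u′ v′ t₁ t₂} → Rewired n k b u v u′ v′ t₁ t₂ → Changed n k (suc b) u v u′ v′
  changed r = record { row = Rewired.row r ; others = Rewired.tileO r }

retile : ∀ {t t′ N E S W} → t ≡ t′ → Cell t N E S W → Cell t′ N E S W
retile refl x = x

cN : ∀ {t N N′ E S S′ W} → N′ ≡ N → S′ ≡ S → Cell t N E S W → Cell t N′ E S′ W
cN refl refl x = x

module _ {n k u v} (R : Row n k u v) where

  pass-row : ∀ {y} → 1 ≤ y → y < n → u (suc y) ≢ 0 → v (suc y) ≡ u (suc y) → Clear (u (suc y)) (u y) →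
    Changed n k y u v (u ∘ swap y) (v ∘ swap y) × Clear (v (suc y)) (v y) × blanks (u ∘ swap y) (v ∘ swap y) n ≡ blanks u v n
  pass-row {suc b} _ y< nz e cl
    with pass-cells (cellAt R (<⇒≤ y<)) (cN refl (sym e) (cellAt R y<)) nz cl
  ... | g , t₁ , t₂ , d₁ , d₂ , cl′ , bits = changed W , clear-cong (sym e) refl cl′ , Rewired.balance W 0 0 bits
    where W = rewire R y< (off-swap u) (off-swap v)
                (cN (at-l u (suc b)) (trans (at-l v (suc b)) e) d₁)
                (cN (at-r u (suc b)) (at-r v (suc b)) d₂)

  pass⁻-row : ∀ {y} → 1 ≤ y → y < n → u y ≢ 0 → v y ≡ u y → Clear (v y) (v (suc y)) →
    Changed n k y u v (u ∘ swap y) (v ∘ swap y) × Clear (u y) (u (suc y))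
  pass⁻-row {suc b} _ y< nz e cl
    with pass⁻-cells (cN refl (sym e) (cellAt R (<⇒≤ y<))) (cellAt R y<) nz (clear-cong e refl cl)
  ... | g , t₁ , t₂ , d₁ , d₂ , cl′ = changed W , cl′
    where W = rewire R y< (off-swap u) (off-swap v)
                (cN (at-l u (suc b)) (at-l v (suc b)) d₁)
                (cN (at-r u (suc b)) (trans (at-r v (suc b)) e) d₂)

  start-row : ∀ {y} → 1 ≤ y → y < n → tile u v y ≡ blank → tile u v (suc y) ≢ blank →
    Changed n k y u v u (v ∘ swap y) × tile u (v ∘ swap y) y ≡ rtile × tile u (v ∘ swap y) (suc y) ≢ blank
    × v y ≡ 0 × v (suc y) ≢ 0 × suc (blanks u (v ∘ swap y) n) ≡ blanks u v n
  start-row {suc b} _ y< tb tn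
    with start-cells (retile tb (cellAt R (<⇒≤ y<))) (cellAt R y<) tn
  ... | g , t₂ , d₁ , d₂ , nb , z , nz = changed W , Rewired.tile₁ W , (λ e → nb (trans (sym (Rewired.tile₂ W)) e)) , z , nz
        , Rewired.balance W 0 1 (bits-start nb tn tb)
    where W = rewire R y< (off-id u) (off-swap v) (cN refl (at-l v (suc b)) d₁) (cN refl (at-r v (suc b)) d₂)

  start⁻-row : ∀ {y} → 1 ≤ y → y < n → tile u v y ≡ rtile → Clear (v y) (v (suc y)) →
    Changed n k y u v u (v ∘ swap y) × tile u (v ∘ swap y) y ≡ blank × tile u (v ∘ swap y) (suc y) ≢ blank × v (suc y) ≡ 0
  start⁻-row {suc b} _ y< tr cl
    with start⁻-cells (retile tr (cellAt R (<⇒≤ y<))) (cellAt R y<) cl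
  ... | t₂ , d₁ , d₂ , nb , z = changed W , Rewired.tile₁ W , (λ e → nb (trans (sym (Rewired.tile₂ W)) e)) , z
    where W = rewire R y< (off-id u) (off-swap v) (cN refl (at-l v (suc b)) d₁) (cN refl (at-r v (suc b)) d₂)

  leave-row : ∀ {y} → 1 ≤ y → y < n → tile u v (suc y) ≡ jtile → Clear (u (suc y)) (u y) →
    Changed n k y u v (u ∘ swap y) v × tile (u ∘ swap y) v (suc y) ≡ blank × tile (u ∘ swap y) v y ≢ blank
    × blanks (u ∘ swap y) v n ≡ suc (blanks u v n)
  leave-row {suc b} _ y< tj cl
    with leave-cells (cellAt R (<⇒≤ y<)) (retile tj (cellAt R y<)) cl
  ... | t₁ , d₁ , d₂ , nb , nb′ , _ , _ = changed W , Rewired.tile₂ W , (λ e → nb′ (trans (sym (Rewired.tile₁ W)) e))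
        , Rewired.balance W 1 0 (bits-leave nb nb′ tj)
    where W = rewire R y< (off-swap u) (off-id v) (cN (at-l u (suc b)) refl d₁) (cN (at-r u (suc b)) refl d₂)

  leave⁻-row : ∀ {y} → 1 ≤ y → y < n → tile u v (suc y) ≡ blank → tile u v y ≢ blank →
    Changed n k y u v (u ∘ swap y) v × tile (u ∘ swap y) v (suc y) ≡ jtile × u y ≢ 0 × u (suc y) ≡ 0
  leave⁻-row {suc b} _ y< tb tn
    with leave⁻-cells (cellAt R (<⇒≤ y<)) (retile tb (cellAt R y<)) tn
  ... | t₁ , d₁ , d₂ , nz , z = changed W , Rewired.tile₂ W , nz , z
    where W = rewire R y< (off-swap u) (off-id v) (cN (at-l u (suc b)) refl d₁) (cN (at-r u (suc b)) refl d₂)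

cell-blank : ∀ {N E S W} → Cell blank N E S W → N ≡ 0 × S ≡ 0 × W ≡ 0
cell-blank cBlank = refl , refl , refl

cell-ver : ∀ {t N E S} → Cell t N E S 0 → N ≢ 0 → t ≡ ver × S ≡ N × E ≡ 0
cell-ver cBlank z = ⊥-elim (z refl)
cell-ver cVer _ = refl , refl , refl
cell-ver cR z = ⊥-elim (z refl)

cell-r : ∀ {t N E S W} → Cell t N E S W → N ≡ 0 → S ≢ 0 → t ≡ rtile
cell-r cBlank _ z = ⊥-elim (z refl)
cell-r cHor _ z = ⊥-elim (z refl)
cell-r cR _ _ = refl

cell-rtile : ∀ {N E S W} → Cell rtile N E S W → N ≡ 0 × S ≢ 0
cell-rtile cR = refl , λ ()

cell-jtile : ∀ {N E S W} → Cell jtile N E S W → N ≢ 0 × S ≡ 0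
cell-jtile cJ = (λ ()) , refl

cell-turn-j : ∀ {t N E S W} → Cell t N E S W → N ≢ 0 → S ≢ N → t ≡ jtile
cell-turn-j cBlank z _ = ⊥-elim (z refl)
cell-turn-j (cCross _) _ z = ⊥-elim (z refl)
cell-turn-j cHor z _ = ⊥-elim (z refl)
cell-turn-j cVer _ z = ⊥-elim (z refl)
cell-turn-j cR z _ = ⊥-elim (z refl)
cell-turn-j cJ _ _ = refl

cell-not-r : ∀ {t N E S W} → Cell t N E S W → S ≢ 0 → t ≢ rtile → S ≡ N
cell-not-r cBlank z _ = ⊥-elim (z refl)
cell-not-r (cCross _) _ _ = refl
cell-not-r cHor z _ = ⊥-elim (z refl)
cell-not-r cVer _ _ = refl
cell-not-r cR _ z = ⊥-elim (z refl)
cell-not-r cJ z _ = ⊥-elim (z refl)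

module _ {n k u v} (R : Row n k u v) where

  private
    at : ∀ {c} → 1 ≤ c → c ≤ n → ∃[ b ] c ≡ suc b × Cell (tile u v c) (u c) (carrier u v c) (v c) (carrier u v b)
    at {suc b} _ l = b , refl , cellAt R l

    conv : ∀ {c t} → 1 ≤ c → c ≤ n → tile u v c ≡ t → ∃[ W ] Cell t (u c) (carrier u v c) (v c) W
    conv l m e with at l m
    ... | b , _ , x = _ , retile e x

  blank-NS : ∀ {c} → 1 ≤ c → c ≤ n → tile u v c ≡ blank → u c ≡ 0 × v c ≡ 0
  blank-NS l m e with conv l m e
  ... | _ , x = proj₁ (cell-blank x) , proj₁ (proj₂ (cell-blank x))

  blank-W : ∀ {c} → suc c ≤ n → tile u v (suc c) ≡ blank → carrier u v c ≡ 0
  blank-W m e = proj₂ (proj₂ (cell-blank (retile e (cellAt R m))))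

  rtile-NS : ∀ {c} → 1 ≤ c → c ≤ n → tile u v c ≡ rtile → u c ≡ 0 × v c ≢ 0
  rtile-NS l m e = cell-rtile (proj₂ (conv l m e))

  jtile-NS : ∀ {c} → 1 ≤ c → c ≤ n → tile u v c ≡ jtile → u c ≢ 0 × v c ≡ 0
  jtile-NS l m e = cell-jtile (proj₂ (conv l m e))

  N≢0⇒nonblank : ∀ {c} → 1 ≤ c → c ≤ n → u c ≢ 0 → tile u v c ≢ blank
  N≢0⇒nonblank l m z e = z (proj₁ (blank-NS l m e))

  turn-j : ∀ {c} → 1 ≤ c → c ≤ n → u c ≢ 0 → v c ≢ u c → tile u v c ≡ jtile
  turn-j l m with at l m
  ... | _ , _ , x = cell-turn-j x

  turn-r : ∀ {c} → 1 ≤ c → c ≤ n → v c ≢ 0 → u c ≡ 0 → tile u v c ≡ rtile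
  turn-r l m z w with at l m
  ... | _ , _ , x = cell-r x w z

  not-r : ∀ {c} → 1 ≤ c → c ≤ n → v c ≢ 0 → tile u v c ≢ rtile → v c ≡ u c
  not-r l m with at l m
  ... | _ , _ , x = cell-not-r x

-- Bumpless pipe dreams as sequences of states

Rows : Set
Rows = ℕ → State

-- V k c labels the edge below cell (k , c); row suc k of the tiling lies between V k
-- and V (suc k).
record LBPD (_≺_ : ℕ → ℕ → Set) (n : ℕ) (V : Rows) : Set where
  field
    top : ∀ c → V 0 c ≡ 0
    row : ∀ k → k < n → LRow _≺_ n (suc k) (V k) (V (suc k))
    off : ∀ k → k ≤ n → ∀ c → c ≡ 0 ⊎ n < c → V k c ≡ 0

module BPD = LBPD

BPD : ℕ → Rows → Set
BPD = LBPD _<_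

tileIn : Rows → ℕ → ℕ → Tile
tileIn V k = tile (V k) (V (suc k))

blank? : ∀ t → Dec (t ≡ blank)
blank? blank = yes refl
blank? cross = no λ ()
blank? hor   = no λ ()
blank? ver   = no λ ()
blank? rtile = no λ ()
blank? jtile = no λ ()

isR : Tile → Bool
isR rtile = true
isR _     = false

isR-false : ∀ {t} → t ≢ rtile → isR t ≡ false
isR-false {blank} _ = refl
isR-false {cross} _ = refl
isR-false {hor}   _ = refl
isR-false {ver}   _ = refl
isR-false {rtile} z = ⊥-elim (z refl)
isR-false {jtile} _ = refl

rtile? : ∀ t → Dec (t ≡ rtile)
rtile? blank = no λ ()
rtile? cross = no λ ()
rtile? hor   = no λ ()
rtile? ver   = no λ ()
rtile? rtile = yes refl
rtile? jtile = no λ ()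

isBlank-false : ∀ {t} → t ≢ blank → isBlank t ≡ false
isBlank-false {blank} z = ⊥-elim (z refl)
isBlank-false {cross} _ = refl
isBlank-false {hor}   _ = refl
isBlank-false {ver}   _ = refl
isBlank-false {rtile} _ = refl
isBlank-false {jtile} _ = refl

runʳ : (ℕ → Tile) → ℕ → ℕ → ℕ
runʳ t zero    c = c
runʳ t (suc f) c = if isBlank (t (suc c)) then runʳ t f (suc c) else c

-- The nonblank column `d` within reach of the fuel guarantees that the search stops at the end of
-- the run and not for lack of fuel.
runʳ-spec : ∀ t f c d → t d ≢ blank → c < d → d ≤ c + f →
  c ≤ runʳ t f c × runʳ t f c < d × (∀ e → c < e → e ≤ runʳ t f c → t e ≡ blank) × t (suc (runʳ t f c)) ≢ blank
runʳ-spec t zero c d nb l m = ⊥-elim (<⇒≱ l (subst (d ≤_) (+-identityʳ c) m))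
runʳ-spec t (suc f) c d nb l m with blank? (t (suc c))
... | no z rewrite isBlank-false z = ≤-refl , l , (λ e p q → ⊥-elim (<⇒≱ p q)) , z
... | yes z rewrite z with suc c ≟ d
...   | yes refl = ⊥-elim (nb z)
...   | no ne with runʳ-spec t f (suc c) d nb (≤∧≢⇒< l ne) (subst (d ≤_) (+-suc c f) m)
...     | p , q , s , w = <⇒≤ p , q , blanks′ , w
  where
    blanks′ : ∀ e → c < e → e ≤ runʳ t f (suc c) → t e ≡ blank
    blanks′ e g h with suc c ≟ e
    ... | yes refl = z
    ... | no ne′ = s e (≤∧≢⇒< g ne′) h

runˡ : (ℕ → Tile) → ℕ → ℕ
runˡ t zero    = zero
runˡ t (suc c) = if isBlank (t (suc c)) then runˡ t c else suc c

runˡ-spec : ∀ t m c → t c ≢ blank → 1 ≤ c → c ≤ m →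
  c ≤ runˡ t m × runˡ t m ≤ m × (∀ e → runˡ t m < e → e ≤ m → t e ≡ blank) × t (runˡ t m) ≢ blank
runˡ-spec t zero c nb l m = ⊥-elim (<⇒≱ l m)
runˡ-spec t (suc k) c nb l m with blank? (t (suc k))
... | no z rewrite isBlank-false z = m , ≤-refl , (λ e p q → ⊥-elim (<⇒≱ p q)) , z
... | yes z rewrite z with c ≟ suc k
...   | yes refl = ⊥-elim (nb z)
...   | no ne with runˡ-spec t k c nb l (≤-pred (≤∧≢⇒< m ne))
...     | p , q , s , w = p , m≤n⇒m≤1+n q , blanks′ , w
  where
    blanks′ : ∀ e → runˡ t k < e → e ≤ suc k → t e ≡ blank
    blanks′ e g h with e ≟ suc k
    ... | yes refl = z
    ... | no ne′ = s e g (≤-pred (≤∧≢⇒< h ne′))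

-- The row transducer

-- One row of ∇: u, v are the labels above and below the row, u′, v′ those after ∇;
-- y and z are the columns of the mark (the columns y and y+1 of u and z and z+1 of v
-- get exchanged).
data Step (u v u′ v′ : State) (y : ℕ) : ℕ → Set where
  pass : u (suc y) ≢ 0 → v (suc y) ≡ u (suc y) → u′ y ≢ 0 → v′ y ≡ u′ y → Step u v u′ v′ y y
  move : ∀ {z} → y < z → tile u v (suc y) ≡ jtile → (∀ c → suc y < c → c ≤ z → tile u v c ≡ blank) →
         tile u v (suc z) ≢ blank → tile u′ v′ z ≡ rtile → (∀ c → y < c → c < z → tile u′ v′ c ≡ blank) →
         tile u′ v′ y ≢ blank → Step u v u′ v′ y z

-- The invariant of the mark, read in a state before ∇: there is a pipe to its right, and it is
-- clear of the pipe at the mark. `Active′` is the same condition read after the exchange of the two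
-- columns.
Active : State → ℕ → Set
Active u y = u (suc y) ≢ 0 × Clear (u (suc y)) (u y)

Active′ : State → ℕ → Set
Active′ u y = u y ≢ 0 × Clear (u y) (u (suc y))

next : State → State → ℕ → ℕ → ℕ
next u v n y = if v (suc y) ≡ᵇ u (suc y) then y else runʳ (tile u v) n (suc y)

-- After ∇ there is an r-tile at the mark exactly if the mark arrived there by a move in this row.
-- The move then came from the nearest nonblank column to the left.
prev : State → State → ℕ → ℕ
prev u v y = if isR (tile u v y) then runˡ (tile u v) (pred y) else y

cell-E : ∀ {t N S W w} → Cell t N (suc w) S W → t ≢ blank × t ≢ jtile
cell-E (cCross _) = (λ ()) , λ ()
cell-E cHor = (λ ()) , λ ()
cell-E cR = (λ ()) , λ ()

cell-E≡ : ∀ {t N E S W w} → E ≡ suc w → Cell t N E S W → t ≢ blank × t ≢ jtile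
cell-E≡ refl = cell-E

-- The pipe leaving the row uses the east edge of the last column. Hence runs of blanks end before
-- it, a j-tile cannot lie in it, and the mark always has a column to its right.
last-tile : ∀ {n k u v} → Row n (suc k) u v → tile u v n ≢ blank × tile u v n ≢ jtile
last-tile {zero} R with () ← Row.exit R
last-tile {suc n} R = cell-E≡ (Row.exit R) (Row.cell R n ≤-refl)

<⇒≢ˢ : ∀ {y z} → y < z → y ≢ suc z
<⇒≢ˢ l = <⇒≢ (m<n⇒m<1+n l)

-- A move is the composite of `leave-row` and `start-row` through the intermediate row between
-- `u ∘ swap y` and `v`. The first creates a blank and the second consumes one, which keeps the
-- weight of the row.
advance : ∀ {n k u v y} → Row n (suc k) u v → 1 ≤ y → y < n → Active u y → ∀ {z} → z ≡ next u v n y →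
  Step u v (u ∘ swap y) (v ∘ swap z) y z × 1 ≤ z × z < n × Active v z × Row n (suc k) (u ∘ swap y) (v ∘ swap z)
  × blanks (u ∘ swap y) (v ∘ swap z) n ≡ blanks u v n
advance {n} {k} {u} {v} {y} R 1≤y y<n (nz , cl) refl with v (suc y) ≟ u (suc y)
... | yes e rewrite ≡ᵇ-yes e with pass-row R 1≤y y<n nz e cl
...   | ch , cl′ , bl = pass nz e (λ q → nz (trans (sym (at-l u y)) q)) (trans (at-l v y) (trans e (sym (at-l u y))))
                        , 1≤y , y<n , ((λ q → nz (trans (sym e) q)) , cl′) , Changed.row ch , bl
advance {n} {k} {u} {v} {y} R 1≤y y<n (nz , cl) refl | no ne rewrite ≡ᵇ-no ne
  = move y<z tj inner after (proj₁ (proj₂ st)) between nb-y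
  , ≤-trans z<s y<z , z<n , (proj₁ (proj₂ (proj₂ (proj₂ (proj₂ st)))) , inj₁ (proj₁ (proj₂ (proj₂ (proj₂ st)))))
  , Changed.row (proj₁ st) , suc-injective (trans (proj₂ (proj₂ (proj₂ (proj₂ (proj₂ st))))) (proj₂ (proj₂ (proj₂ lv))))
  where
    tj : tile u v (suc y) ≡ jtile
    tj = turn-j R z<s y<n nz ne
    sy<n : suc y < n
    sy<n = ≤∧≢⇒< y<n (λ e → proj₂ (last-tile R) (subst (λ c → tile u v c ≡ jtile) e tj))
    z = runʳ (tile u v) n (suc y)
    spec = runʳ-spec (tile u v) n (suc y) n (proj₁ (last-tile R)) sy<n (m≤n+m n (suc y))
    y<z : y < z
    y<z = proj₁ spec
    z<n : z < n
    z<n = proj₁ (proj₂ spec)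
    inner : ∀ c → suc y < c → c ≤ z → tile u v c ≡ blank
    inner = proj₁ (proj₂ (proj₂ spec))
    after : tile u v (suc z) ≢ blank
    after = proj₂ (proj₂ (proj₂ spec))
    lv = leave-row R 1≤y y<n tj cl
    u′ = u ∘ swap y
    lvO = Changed.others (proj₁ lv)
    blank₁ : ∀ c → y < c → c ≤ z → tile u′ v c ≡ blank
    blank₁ c p q with suc y ≟ c
    ... | yes refl = proj₁ (proj₂ lv)
    ... | no d = trans (lvO c (>⇒≢ p) (≢-sym d)) (inner c (≤∧≢⇒< p d) q)
    st = start-row (Changed.row (proj₁ lv)) (≤-trans z<s y<z) z<n (blank₁ z y<z ≤-refl)
           (λ q → after (trans (sym (lvO (suc z) (>⇒≢ (m<n⇒m<1+n y<z)) (>⇒≢ (s≤s y<z)))) q))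
    stO = Changed.others (proj₁ st)
    between : ∀ c → y < c → c < z → tile u′ (v ∘ swap z) c ≡ blank
    between c p q = trans (stO c (<⇒≢ q) (<⇒≢ˢ q)) (blank₁ c p (<⇒≤ q))
    nb-y : tile u′ (v ∘ swap z) y ≢ blank
    nb-y q = proj₁ (proj₂ (proj₂ lv)) (trans (sym (stO y (<⇒≢ y<z) (<⇒≢ˢ y<z))) q)

-- Going backwards, only the search to the left of an r-tile can fail, for want of a nonblank tile.
-- `bar` provides such a tile, and no further left than `b`.
retreat : ∀ {n k u v z b} → Row n (suc k) u v → 1 ≤ z → z < n → Active′ v z → 1 ≤ b → b ≤ z →
  (tile u v z ≡ rtile → ∃[ c ] b ≤ c × c < z × tile u v c ≢ blank) → ∀ {y} → y ≡ prev u v z →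
  Step (u ∘ swap y) (v ∘ swap z) u v y z × b ≤ y × y < n × Active′ u y × Row n (suc k) (u ∘ swap y) (v ∘ swap z)
retreat {n} {k} {u} {v} {z} R 1≤z z<n (nz , cl) 1≤b b≤z bar refl with rtile? (tile u v z)
... | no ne rewrite isR-false ne with not-r R 1≤z (<⇒≤ z<n) nz ne
...   | e with pass⁻-row R 1≤z z<n (λ q → nz (trans e q)) e cl
...     | ch , cl′ = pass (λ q → uz (trans (sym (at-r u z)) q)) (trans (at-r v z) (trans e (sym (at-r u z)))) uz e
                   , b≤z , z<n , (uz , cl′) , Changed.row ch
  where uz : u z ≢ 0
        uz q = nz (trans e q)
retreat {n} {k} {u} {v} {suc m} {b} R 1≤z z<n (nz , cl) 1≤b b≤z bar refl | yes tr rewrite tr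
  = move (s≤s y≤m) (proj₁ (proj₂ lv)) inner after tr between nb-y
  , ≤-trans (proj₁ (proj₂ (bar refl))) (proj₁ spec) , y<n , (proj₁ (proj₂ (proj₂ lv)) , inj₁ (proj₂ (proj₂ (proj₂ lv))))
  , Changed.row (proj₁ lv)
  where
    c₀ = proj₁ (bar refl)
    spec = runˡ-spec (tile u v) m c₀ (proj₂ (proj₂ (proj₂ (bar refl)))) (≤-trans 1≤b (proj₁ (proj₂ (bar refl))))
             (≤-pred (proj₁ (proj₂ (proj₂ (bar refl)))))
    y = runˡ (tile u v) m
    y≤m : y ≤ m
    y≤m = proj₁ (proj₂ spec)
    y<n : y < n
    y<n = <-trans (s≤s y≤m) z<n
    1≤y : 1 ≤ y
    1≤y = ≤-trans 1≤b (≤-trans (proj₁ (proj₂ (bar refl))) (proj₁ spec))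
    between : ∀ c → y < c → c < suc m → tile u v c ≡ blank
    between c p q = proj₁ (proj₂ (proj₂ spec)) c p (≤-pred q)
    nb-y : tile u v y ≢ blank
    nb-y = proj₂ (proj₂ (proj₂ spec))
    st = start⁻-row R 1≤z z<n tr cl
    stO = Changed.others (proj₁ st)
    v′ = v ∘ swap (suc m)
    blank₁ : ∀ c → y < c → c ≤ suc m → tile u v′ c ≡ blank
    blank₁ c p q with c ≟ suc m
    ... | yes refl = proj₁ (proj₂ st)
    ... | no d = trans (stO c d (λ e → 1+n≰n (subst (_≤ suc m) e q))) (between c p (≤∧≢⇒< q d))
    lv = leave⁻-row (Changed.row (proj₁ st)) 1≤y y<n (blank₁ (suc y) ≤-refl (s≤s y≤m))
           (λ q → nb-y (trans (sym (stO y (<⇒≢ (s≤s y≤m)) (<⇒≢ˢ (s≤s y≤m)))) q))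
    lvO = Changed.others (proj₁ lv)
    inner : ∀ c → suc y < c → c ≤ suc m → tile (u ∘ swap y) v′ c ≡ blank
    inner c p q = trans (lvO c (>⇒≢ (<-trans (n<1+n y) p)) (>⇒≢ p)) (blank₁ c (<-trans (n<1+n y) p) q)
    after : tile (u ∘ swap y) v′ (suc (suc m)) ≢ blank
    after q = proj₁ (proj₂ (proj₂ st)) (trans (sym (lvO _ (>⇒≢ (m<n⇒m<1+n (s≤s y≤m))) (>⇒≢ (s≤s (s≤s y≤m))))) q)

-- The first step leaves a nonblank tile at its mark: a pipe going straight on, or an r-tile. The
-- second step travels in the same row through blanks only, so it cannot overtake that tile.
step-order : ∀ {n k u v u′ v′ u″ v″ y z y′ z′} → Row n k u′ v′ → 1 ≤ y → y ≤ n →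
  Step u v u′ v′ y z → Step u′ v′ u″ v″ y′ z′ → y′ < y → z′ < z
step-order R 1≤y y≤n (pass _ _ _ _) (pass _ _ _ _) l = l
step-order {y = y} {y′ = y′} {z′ = z′} R 1≤y y≤n (pass _ _ nz e) (move m tj inner _ _ _ _) l with y ≤? z′
... | no g = ≰⇒> g
... | yes g with suc y′ ≟ y
...   | yes refl = ⊥-elim (nz (trans (sym e) (proj₂ (jtile-NS R 1≤y y≤n tj))))
...   | no d = ⊥-elim (nz (proj₁ (blank-NS R 1≤y y≤n (inner y (≤∧≢⇒< l d) g))))
step-order R 1≤y y≤n (move m _ _ _ _ _ _) (pass _ _ _ _) l = <-trans l m
step-order {z = z} {z′ = z′} R 1≤y y≤n (move m _ _ _ tr _ _) (move _ _ inner _ _ _ _) l with z ≤? z′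
... | no g = ≰⇒> g
... | yes g with () ← trans (sym tr) (inner z (≤-<-trans l m) g)

step-det : ∀ {n k u v u₁ v₁ u₂ v₂ y z₁ z₂} → Row n k u v → y < n → Step u v u₁ v₁ y z₁ → Step u v u₂ v₂ y z₂ → z₁ ≡ z₂
step-det R l (pass _ _ _ _) (pass _ _ _ _) = refl
step-det R l (pass nz e _ _) (move _ tj _ _ _ _ _) = ⊥-elim (nz (trans (sym e) (proj₂ (jtile-NS R z<s l tj))))
step-det R l (move _ tj _ _ _ _ _) (pass nz e _ _) = ⊥-elim (nz (trans (sym e) (proj₂ (jtile-NS R z<s l tj))))
step-det {z₁ = z₁} {z₂} R l (move p _ i a _ _ _) (move q _ i′ a′ _ _ _) with <-cmp z₁ z₂
... | tri< s _ _ = ⊥-elim (a (i′ (suc z₁) (s≤s p) s))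
... | tri≈ _ e _ = e
... | tri> _ _ s = ⊥-elim (a′ (i (suc z₂) (s≤s q) s))

-- The label above column `z` after ∇ tells the two kinds of step apart: it is zero over the r-tile
-- of a move and nonzero in a pass. A move starts at the nearest nonblank column to the left.
step-codet : ∀ {n k u v u₁ v₁ u₂ v₂ y₁ y₂ z} → Row n k u v → 1 ≤ z → z ≤ n → Step u₁ v₁ u v y₁ z → Step u₂ v₂ u v y₂ z → y₁ ≡ y₂
step-codet R l m (pass _ _ _ _) (pass _ _ _ _) = refl
step-codet R l m (pass _ _ nz _) (move _ _ _ _ tr _ _) = ⊥-elim (nz (proj₁ (rtile-NS R l m tr)))
step-codet R l m (move _ _ _ _ tr _ _) (pass _ _ nz _) = ⊥-elim (nz (proj₁ (rtile-NS R l m tr)))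
step-codet {y₁ = y₁} {y₂} R l m (move p _ _ _ _ i a) (move q _ _ _ _ i′ a′) with <-cmp y₁ y₂
... | tri< s _ _ = ⊥-elim (a′ (i y₂ s q))
... | tri≈ _ e _ = e
... | tri> _ _ s = ⊥-elim (a (i′ y₁ s p))

step-mono : ∀ {u v u′ v′ y z} → Step u v u′ v′ y z → y ≤ z
step-mono (pass _ _ _ _) = ≤-refl
step-mono (move l _ _ _ _ _ _) = <⇒≤ l

-- Rows without blanks

idle : ∀ {n k u v m} → Row n k u v → m ≤ n → (∀ c → 1 ≤ c → c ≤ m → u c ≢ 0) →
  ∀ c → c ≤ m → carrier u v c ≡ 0
idle R m≤n nz zero _ = refl
idle {u = u} {v} R m≤n nz (suc c) l =
  proj₂ (proj₂ (cell-ver (cell-subst refl refl refl refl (sym (idle R m≤n nz c (<⇒≤ l))) (Row.cell R c (≤-trans l m≤n))) (nz _ z<s l)))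

-- Where nothing arrives from the west, a column with a pipe above can only be vertical, and then
-- nothing is passed on to the east. So a block of occupied columns at the left border stays
-- straight.
idle-ver : ∀ {n k u v m} → Row n k u v → m ≤ n → (∀ c → 1 ≤ c → c ≤ m → u c ≢ 0) →
  ∀ c → 1 ≤ c → c ≤ m → tile u v c ≡ ver × v c ≡ u c
idle-ver R m≤n nz (suc c) p l
  with cell-ver (cell-subst refl refl refl refl (sym (idle R m≤n nz c (<⇒≤ l))) (Row.cell R c (≤-trans l m≤n))) (nz _ z<s l)
... | a , b , _ = a , b

cell-first : ∀ {t E S} → Cell t 0 E S 0 → t ≢ blank → E ≡ S × E ≢ 0
cell-first cBlank z = ⊥-elim (z refl)
cell-first cR _ = refl , λ ()

cell-beyond : ∀ {t E S W} → Cell t 0 E S W → W ≢ 0 → S ≡ 0 × E ≡ W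
cell-beyond cBlank z = ⊥-elim (z refl)
cell-beyond cHor _ = refl , refl
cell-beyond cR z = ⊥-elim (z refl)

NoBlank : ℕ → Rows → ℕ → Set
NoBlank n V k = ∀ c → 1 ≤ c → c ≤ n → tileIn V k c ≢ blank

IdTo : ℕ → ℕ → State → Set
IdTo n m u = (∀ c → 1 ≤ c → c ≤ m → u c ≡ c) × (∀ c → m < c → c ≤ n → u c ≡ 0)

idTo-nz : ∀ {n m u} → IdTo n m u → ∀ c → 1 ≤ c → c ≤ m → u c ≢ 0
idTo-nz (i , _) c l m e = <⇒≢ l (sym (trans (sym (i c l m)) e))

module _ {n m u v} (R : Row n (suc m) u v) (m<n : m < n) (I : IdTo n m u)
         (nb : ∀ c → 1 ≤ c → c ≤ n → tile u v c ≢ blank) where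
  private
    first : carrier u v (suc m) ≡ v (suc m) × carrier u v (suc m) ≢ 0
    first = cell-first (cell-subst refl (sym (proj₂ I (suc m) ≤-refl m<n)) refl refl
              (sym (idle R (<⇒≤ m<n) (idTo-nz I) m ≤-refl)) (Row.cell R m m<n)) (nb _ z<s m<n)

    beyond : ∀ d → suc d + m < n → v (suc (suc d + m)) ≡ 0 × carrier u v (suc (suc d + m)) ≡ carrier u v (suc m)
    prior : ∀ d → suc d + m < n → carrier u v (suc d + m) ≡ carrier u v (suc m)
    prior zero    l = refl
    prior (suc d) l = proj₂ (beyond d (<⇒≤ l))
    beyond d l with cell-beyond (cell-subst refl (sym (proj₂ I _ (m<n⇒m<1+n (s≤s (m≤n+m m d))) l)) refl refl refl (Row.cell R (suc d + m) l))
                                (λ e → proj₂ first (trans (sym (prior d l)) e))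
    ... | a , b = a , trans b (prior d l)

    whole : ∀ d → suc d + m ≤ n → carrier u v (suc d + m) ≡ carrier u v (suc m)
    whole zero    l = refl
    whole (suc d) l = proj₂ (beyond d l)

    end : carrier u v (suc m) ≡ suc m
    end = trans (sym (whole (n ∸ suc m) (≤-reflexive eq))) (trans (cong (carrier u v) eq) (Row.exit R))
      where eq : suc (n ∸ suc m) + m ≡ n
            eq = trans (sym (+-suc (n ∸ suc m) m)) (m∸n+n≡m m<n)

  -- The occupied columns are vertical. Column `suc m` has nothing above it or to its west, so being
  -- nonblank it is an r-tile; its label then has to run horizontally to the east border, where it
  -- is known to be `suc m`.
  full-row : IdTo n (suc m) v
  full-row = low , high
    where
      low : ∀ c → 1 ≤ c → c ≤ suc m → v c ≡ c
      low c p q with c ≟ suc m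
      ... | yes refl = trans (sym (proj₁ first)) end
      ... | no d = trans (proj₂ (idle-ver R (<⇒≤ m<n) (idTo-nz I) c p (≤-pred (≤∧≢⇒< q d)))) (proj₁ I c p (≤-pred (≤∧≢⇒< q d)))
      high : ∀ c → suc m < c → c ≤ n → v c ≡ 0
      high (suc c) (s≤s p) q = subst (λ x → v (suc x) ≡ 0) eq (proj₁ (beyond (c ∸ suc m) (subst (_< n) (sym eq) q)))
        where eq : suc (c ∸ suc m) + m ≡ c
              eq = trans (sym (+-suc (c ∸ suc m) m)) (m∸n+n≡m p)

full-top : ∀ {n V} → BPD n V → ∀ m → m ≤ n → (∀ k → k < m → NoBlank n V k) → IdTo n m (V m)
full-top B zero _ _ = (λ c p q → ⊥-elim (<⇒≱ p q)) , λ c _ _ → BPD.top B c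
full-top B (suc m) l nb = full-row (BPD.row B m l) l (full-top B m (<⇒≤ l) (λ k p → nb k (m<n⇒m<1+n p))) (nb m ≤-refl)

columns-stay : ∀ {n V m} → BPD n V → m ≤ n → IdTo n m (V m) → ∀ k → m ≤ k → k ≤ n → ∀ c → 1 ≤ c → c ≤ m → V k c ≡ c
columns-stay {n} {V} {m} B m≤n I zero l _ c p q = ⊥-elim (<⇒≱ p (≤-trans q l))
columns-stay {n} {V} {m} B m≤n I (suc k) l h c p q with m ≟ suc k
... | yes refl = proj₁ I c p q
... | no d = trans (proj₂ (idle-ver (BPD.row B k h) m≤n (λ c′ p′ q′ e → <⇒≢ p′ (sym (trans (sym (stay c′ p′ q′)) e))) c p q)) (stay c p q)
  where stay : ∀ c → 1 ≤ c → c ≤ m → V k c ≡ c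
        stay = columns-stay B m≤n I k (≤-pred (≤∧≢⇒< l d)) (<⇒≤ h)

-- Trajectories of the mark

-- The passage from a bumpless pipe dream V to V′ = ∇V: the first row with a blank is
-- suc ρ, and y k is the column of the mark at the bottom of row k (so pop = (y n , suc ρ)).
record Traj (n : ℕ) (V V′ : Rows) (ρ : ℕ) (y : ℕ → ℕ) : Set where
  field
    ρ<n      : ρ < n
    full     : ∀ k → k < ρ → NoBlank n V k
    same     : ∀ k → k ≤ ρ → ∀ c → V′ k c ≡ V k c
    swapped  : ∀ k → ρ < k → k ≤ n → ∀ c → V′ k c ≡ V k (swap (y k) c)
    range    : ∀ k → ρ < k → k ≤ n → 1 ≤ y k × y k < n
    active   : ∀ k → ρ < k → k ≤ n → Active (V k) (y k)
    start    : tileIn V ρ (y (suc ρ)) ≡ blank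
    startʳ   : ∀ c → y (suc ρ) < c → c ≤ n → tileIn V ρ c ≢ blank
    start′   : tileIn V′ ρ (y (suc ρ)) ≡ rtile
    start′ʳ  : ∀ c → y (suc ρ) < c → c ≤ n → tileIn V′ ρ c ≢ blank
    steps    : ∀ k → ρ < k → k < n → Step (V k) (V (suc k)) (V′ k) (V′ (suc k)) (y k) (y (suc k))
    bpd′     : BPD n V′

agree : ∀ {n} {u u′ : State} → (∀ c → u′ c ≡ u c) → Agree n u u′
agree e c _ _ = e c

step-cong : ∀ {n u v u₁ v₁ u′ v′ u₁′ v₁′ y z} → 1 ≤ y → y < n → z < n →
  (∀ c → u₁ c ≡ u c) → (∀ c → v₁ c ≡ v c) → (∀ c → u₁′ c ≡ u′ c) → (∀ c → v₁′ c ≡ v′ c) →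
  Step u v u′ v′ y z → Step u₁ v₁ u₁′ v₁′ y z
step-cong {y = y} 1≤y y<n z<n a b a′ b′ (pass p q r s) =
  pass (λ e → p (trans (sym (a (suc y))) e)) (trans (b (suc y)) (trans q (sym (a (suc y)))))
       (λ e → r (trans (sym (a′ y)) e)) (trans (b′ y) (trans s (sym (a′ y))))
step-cong {n} {u} {v} {u₁} {v₁} {u′} {v′} {u₁′} {v₁′} {y} {z} 1≤y y<n z<n a b a′ b′ (move l tj i nb tr i′ nb′) =
  move l (trans (t _ z<s y<n) tj) (λ c p q → trans (t c (≤-trans z<s p) (≤-trans q (<⇒≤ z<n))) (i c p q))
    (λ e → nb (trans (sym (t _ z<s z<n)) e)) (trans (t′ _ (≤-trans z<s l) (<⇒≤ z<n)) tr)
    (λ c p q → trans (t′ c (≤-trans z<s p) (≤-trans (<⇒≤ q) (<⇒≤ z<n))) (i′ c p q))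
    (λ e → nb′ (trans (sym (t′ _ 1≤y (<⇒≤ y<n))) e))
  where
    t : ∀ c → 1 ≤ c → c ≤ n → tile u₁ v₁ c ≡ tile u v c
    t = tile-cong (agree a) (agree b)
    t′ : ∀ c → 1 ≤ c → c ≤ n → tile u₁′ v₁′ c ≡ tile u′ v′ c
    t′ = tile-cong (agree a′) (agree b′)

_≈[_]_ : Rows → ℕ → Rows → Set
V ≈[ n ] W = ∀ k → k ≤ n → ∀ c → W k c ≡ V k c

bpd-cong : ∀ {n V W} → V ≈[ n ] W → BPD n V → BPD n W
bpd-cong e B = record
  { top = λ c → trans (e 0 z≤n c) (BPD.top B c)
  ; row = λ k l → row-cong (agree (e k (<⇒≤ l))) (agree (e (suc k) l)) (BPD.row B k l)
  ; off = λ k l c o → trans (e k l c) (BPD.off B k l c o) }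

active-cong : ∀ {u u′ : State} {y} → (∀ c → u′ c ≡ u c) → Active u y → Active u′ y
active-cong e (p , q) = (λ z → p (trans (sym (e _)) z)) , clear-cong (sym (e _)) (sym (e _)) q

traj-cong : ∀ {n V W V′ ρ y} → V ≈[ n ] W → Traj n V V′ ρ y → Traj n W V′ ρ y
traj-cong {n} {V} {W} {V′} {ρ} {y} e t = record
  { ρ<n = ρ<n
  ; full = λ k l c p q b → full k l c p q (trans (sym (tl k (<-trans l ρ<n) c p q)) b)
  ; same = λ k l c → trans (same k l c) (sym (e k (≤-trans l (<⇒≤ ρ<n)) c))
  ; swapped = λ k l m c → trans (swapped k l m c) (sym (e k m _))
  ; range = range
  ; active = λ k l m → active-cong (e k m) (active k l m)
  ; start = trans (tl ρ ρ<n _ (proj₁ (range (suc ρ) ≤-refl ρ<n)) (<⇒≤ (proj₂ (range (suc ρ) ≤-refl ρ<n)))) start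
  ; startʳ = λ c p q b → startʳ c p q (trans (sym (tl ρ ρ<n c (≤-trans z<s p) q)) b)
  ; start′ = start′
  ; start′ʳ = start′ʳ
  ; steps = λ k l m → step-cong (proj₁ (range k l (<⇒≤ m))) (proj₂ (range k l (<⇒≤ m))) (proj₂ (range (suc k) (m<n⇒m<1+n l) m))
                        (e k (<⇒≤ m)) (e (suc k) m) (λ _ → refl) (λ _ → refl) (steps k l m)
  ; bpd′ = bpd′ }
  where
    open Traj t
    tl : ∀ k → k < n → ∀ c → 1 ≤ c → c ≤ n → tileIn W k c ≡ tileIn V k c
    tl k l = tile-cong (agree (e k (<⇒≤ l))) (agree (e (suc k) l))

select : (ρ : ℕ) → (ℕ → ℕ) → Rows → Rows
select ρ y V k c = if k ≤ᵇ ρ then V k c else V k (swap (y k) c)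

swap-off : ∀ {n y} → 1 ≤ y → y < n → ∀ c → c ≡ 0 ⊎ n < c → swap y c ≡ c
swap-off (s≤s _) l c (inj₁ refl) = refl
swap-off p l c (inj₂ m) = swap-o (>⇒≢ (<-trans l m)) (>⇒≢ (≤-<-trans l m))

select-off : ∀ {n ρ y V} → BPD n V → (∀ k → ρ < k → k ≤ n → 1 ≤ y k × y k < n) →
  ∀ k → k ≤ n → ∀ c → c ≡ 0 ⊎ n < c → select ρ y V k c ≡ 0
select-off {ρ = ρ} {y} {V} B r k l c o with k ≤? ρ
... | yes p = trans (if-yes (≤ᵇ-yes p)) (BPD.off B k l c o)
... | no p = trans (if-no (≤ᵇ-no (≰⇒> p))) (trans (cong (V k) (swap-off (proj₁ (r k (≰⇒> p) l)) (proj₂ (r k (≰⇒> p) l)) c o)) (BPD.off B k l c o))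

select-≤ : ∀ {ρ y V k} → k ≤ ρ → ∀ c → select ρ y V k c ≡ V k c
select-≤ l c = if-yes (≤ᵇ-yes l)

select-> : ∀ {ρ y V k} → ρ < k → ∀ c → select ρ y V k c ≡ V k (swap (y k) c)
select-> l c = if-no (≤ᵇ-no l)

module Forward {n V} (B : BPD n V) {ρ y₀} (ρ<n : ρ < n) (full : ∀ k → k < ρ → NoBlank n V k)
               (1≤y₀ : 1 ≤ y₀) (y₀≤n : y₀ ≤ n) (bl : tileIn V ρ y₀ ≡ blank)
               (blʳ : ∀ c → y₀ < c → c ≤ n → tileIn V ρ c ≢ blank) where

  y : ℕ → ℕ
  y zero    = y₀
  -- Rows up to `ρ` get a dummy value, chosen so that `y (suc ρ)` is the column of the first mark.
  y (suc k) = if k ≤ᵇ ρ then y₀ else next (V k) (V (suc k)) n (y k)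

  V′ : Rows
  V′ = select ρ y V

  private
    yρ : y (suc ρ) ≡ y₀
    yρ = if-yes (≤ᵇ-yes {ρ} ≤-refl)

    y₀<n : y₀ < n
    y₀<n = ≤∧≢⇒< y₀≤n (λ e → proj₁ (last-tile (BPD.row B ρ ρ<n)) (subst (λ c → tileIn V ρ c ≡ blank) e bl))

    st = start-row (BPD.row B ρ ρ<n) 1≤y₀ y₀<n bl (blʳ (suc y₀) ≤-refl y₀<n)

    inv : ∀ k → ρ < k → k ≤ n → 1 ≤ y k × y k < n × Active (V k) (y k)
    inv (suc k) l m with k ≟ ρ
    ... | yes refl rewrite yρ = 1≤y₀ , y₀<n , proj₁ (proj₂ (proj₂ (proj₂ (proj₂ st)))) , inj₁ (proj₁ (proj₂ (proj₂ (proj₂ st))))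
    ... | no d with inv k (≤∧≢⇒< (≤-pred l) (≢-sym d)) (<⇒≤ m)
    ...   | p , q , a with advance (BPD.row B k m) p q a {y (suc k)} (if-no (≤ᵇ-no (≤∧≢⇒< (≤-pred l) (≢-sym d))))
    ...     | _ , s , t , w , _ = s , t , w

    adv : ∀ k → ρ < k → (m : k < n) → _
    adv k l m = advance (BPD.row B k m) (proj₁ (inv k l (<⇒≤ m))) (proj₁ (proj₂ (inv k l (<⇒≤ m)))) (proj₂ (proj₂ (inv k l (<⇒≤ m))))
                  {y (suc k)} (if-no (≤ᵇ-no l))

    sel≤ : ∀ {k} → k ≤ ρ → ∀ c → V′ k c ≡ V k c
    sel≤ {k} = select-≤ {ρ} {y} {V} {k}

    sel> : ∀ {k} → ρ < k → ∀ c → V′ k c ≡ V k (swap (y k) c)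
    sel> {k} = select-> {ρ} {y} {V} {k}

    selρ : ∀ c → V′ (suc ρ) c ≡ V (suc ρ) (swap y₀ c)
    selρ c = trans (sel> ≤-refl c) (cong (λ z → V (suc ρ) (swap z c)) yρ)

    row′ : ∀ k → k < n → Row n (suc k) (V′ k) (V′ (suc k)) × (k ≢ ρ → blanks (V′ k) (V′ (suc k)) n ≡ blanks (V k) (V (suc k)) n)
    row′ k m with <-cmp k ρ
    ... | tri< l _ _ = row-cong (agree (sel≤ (<⇒≤ l))) (agree (sel≤ l)) (BPD.row B k m)
                     , λ _ → blanks-cong (agree (sel≤ (<⇒≤ l))) (agree (sel≤ l)) n ≤-refl
    ... | tri≈ _ refl _ = row-cong (agree (sel≤ ≤-refl)) (agree selρ) (Changed.row (proj₁ st)) , λ d → ⊥-elim (d refl)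
    ... | tri> _ _ l with adv k l m
    ...   | _ , _ , _ , _ , R , b = row-cong (agree (sel> l)) (agree (sel> (m<n⇒m<1+n l))) R
                                  , λ _ → trans (blanks-cong (agree (sel> l)) (agree (sel> (m<n⇒m<1+n l))) n ≤-refl) b

    tl : ∀ c → 1 ≤ c → c ≤ n → tileIn V′ ρ c ≡ tile (V ρ) (V (suc ρ) ∘ swap y₀) c
    tl = tile-cong (agree (sel≤ ≤-refl)) (agree selρ)

    right′ : ∀ c → y₀ < c → c ≤ n → tileIn V′ ρ c ≢ blank
    right′ c p q e with c ≟ suc y₀
    ... | yes refl = proj₁ (proj₂ (proj₂ st)) (trans (sym (tl _ z<s q)) e)
    ... | no d = blʳ c p q (trans (sym (Changed.others (proj₁ st) c (>⇒≢ p) d)) (trans (sym (tl c (≤-trans z<s p) q)) e))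

  traj : Traj n V V′ ρ y
  traj = record
    { ρ<n = ρ<n ; full = full
    ; same = λ k l → sel≤ l
    ; swapped = λ k l m → sel> l
    ; range = λ k l m → proj₁ (inv k l m) , proj₁ (proj₂ (inv k l m))
    ; active = λ k l m → proj₂ (proj₂ (inv k l m))
    ; start = trans (cong (tileIn V ρ) yρ) bl
    ; startʳ = λ c p → blʳ c (subst (_< c) yρ p)
    ; start′ = trans (cong (tileIn V′ ρ) yρ) (trans (tl y₀ 1≤y₀ y₀≤n) (proj₁ (proj₂ st)))
    ; start′ʳ = λ c p → right′ c (subst (_< c) yρ p)
    ; steps = λ k l m → step-cong (proj₁ (inv k l (<⇒≤ m))) (proj₁ (proj₂ (inv k l (<⇒≤ m)))) (proj₁ (proj₂ (inv (suc k) (m<n⇒m<1+n l) m)))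
                          (λ _ → refl) (λ _ → refl) (sel> l) (sel> (m<n⇒m<1+n l)) (proj₁ (adv k l m))
    ; bpd′ = record { top = λ c → trans (sel≤ z≤n c) (BPD.top B c) ; row = λ k l → proj₁ (row′ k l)
                    ; off = select-off B (λ k l m → proj₁ (inv k l m) , proj₁ (proj₂ (inv k l m))) } }

  blanks-start : suc (blanks (V′ ρ) (V′ (suc ρ)) n) ≡ blanks (V ρ) (V (suc ρ)) n
  blanks-start = trans (cong suc (blanks-cong (agree (sel≤ ≤-refl)) (agree selρ) n ≤-refl)) (proj₂ (proj₂ (proj₂ (proj₂ (proj₂ st)))))

  blanks-else : ∀ k → k < n → k ≢ ρ → blanks (V′ k) (V′ (suc k)) n ≡ blanks (V k) (V (suc k)) n
  blanks-else k l = proj₂ (row′ k l)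

-- A lower bound for the mark that survives all moves to the left.
record Barrier (n : ℕ) (V′ : Rows) (ρ a : ℕ) (b : ℕ → ℕ) : Set where
  field
    bottom : b n ≤ a
    pos    : ∀ k → ρ < k → k ≤ n → 1 ≤ b k
    mono   : ∀ k → ρ < k → k < n → b k ≤ b (suc k)
    stop   : ∀ k → ρ < k → k < n → ∀ z → b (suc k) ≤ z → z < n → tileIn V′ k z ≡ rtile →
             ∃[ c ] b k ≤ c × c < z × tileIn V′ k c ≢ blank
    final  : ∀ z → b (suc ρ) ≤ z → z < n → V′ (suc ρ) z ≢ 0 →
             tileIn V′ ρ z ≡ rtile × (∀ c → z < c → c ≤ n → tileIn V′ ρ c ≢ blank)

module Backward {n V′} (B : BPD n V′) {ρ a b} (ρ<n : ρ < n) (full′ : ∀ k → k < ρ → NoBlank n V′ k)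
                (a<n : a < n) (act : Active′ (V′ n) a) (bar : Barrier n V′ ρ a b) where
  open Barrier bar

  private
    -- Indexed by the height above the bottom line, where the backward run begins.
    up : ℕ → ℕ
    up zero    = a
    up (suc j) = prev (V′ (n ∸ suc j)) (V′ (suc (n ∸ suc j))) (up j)

  y : ℕ → ℕ
  y k = up (n ∸ k)

  V : Rows
  V = select ρ y V′

  y-end : y n ≡ a
  y-end = cong up (n∸n≡0 n)

  private
    y-step : ∀ k → k < n → y k ≡ prev (V′ k) (V′ (suc k)) (y (suc k))
    y-step k l = trans (cong up (sym (size))) (cong (λ x → prev (V′ x) (V′ (suc x)) (y (suc k))) back)
      where
        size : suc (n ∸ suc k) ≡ n ∸ k
        size = sym (+-∸-assoc 1 l)
        back : n ∸ suc (n ∸ suc k) ≡ k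
        back = trans (cong (n ∸_) size) (m∸[m∸n]≡n (<⇒≤ l))

    Inv : ℕ → Set
    Inv k = b k ≤ y k × y k < n × Active′ (V′ k) (y k)

    ret : ∀ k → ρ < k → (m : k < n) → Inv (suc k) → _
    ret k l m (p , q , r) = retreat (BPD.row B k m) (≤-trans (pos (suc k) (m<n⇒m<1+n l) m) p) q r (pos k l (<⇒≤ m))
                              (≤-trans (mono k l m) p) (stop k l m (y (suc k)) p q) (y-step k m)

    inv : ∀ j k → k + j ≡ n → ρ < k → Inv k
    inv zero k e l rewrite trans (sym (+-identityʳ k)) e | y-end = bottom , a<n , act
    inv (suc j) k e l with ret k l (subst (k <_) e (m<m+n k z<s)) (inv j (suc k) (trans (sym (+-suc k j)) e) (m<n⇒m<1+n l))
    ... | _ , p , q , r , _ = p , q , r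

    inv′ : ∀ k → ρ < k → k ≤ n → Inv k
    inv′ k l m = inv (n ∸ k) k (m+[n∸m]≡n m) l

    yρ = y (suc ρ)
    invρ = inv′ (suc ρ) ≤-refl ρ<n
    fin = final yρ (proj₁ invρ) (proj₁ (proj₂ invρ)) (proj₁ (proj₂ (proj₂ invρ)))

    1≤y : ∀ k → ρ < k → k ≤ n → 1 ≤ y k
    1≤y k l m = ≤-trans (pos k l m) (proj₁ (inv′ k l m))

    st = start⁻-row (BPD.row B ρ ρ<n) (1≤y (suc ρ) ≤-refl ρ<n) (proj₁ (proj₂ invρ)) (proj₁ fin) (proj₂ (proj₂ (proj₂ invρ)))

    sel≤ : ∀ {k} → k ≤ ρ → ∀ c → V k c ≡ V′ k c
    sel≤ {k} = select-≤ {ρ} {y} {V′} {k}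

    sel> : ∀ {k} → ρ < k → ∀ c → V k c ≡ V′ k (swap (y k) c)
    sel> {k} = select-> {ρ} {y} {V′} {k}

    row′ : ∀ k → k < n → Row n (suc k) (V k) (V (suc k))
    row′ k m with <-cmp k ρ
    ... | tri< l _ _ = row-cong (agree (sel≤ (<⇒≤ l))) (agree (sel≤ l)) (BPD.row B k m)
    ... | tri≈ _ refl _ = row-cong (agree (sel≤ ≤-refl)) (agree (sel> ≤-refl)) (Changed.row (proj₁ st))
    ... | tri> _ _ l with ret k l m (inv′ (suc k) (m<n⇒m<1+n l) m)
    ...   | _ , _ , _ , _ , R = row-cong (agree (sel> l)) (agree (sel> (m<n⇒m<1+n l))) R

    tl : ∀ c → 1 ≤ c → c ≤ n → tileIn V ρ c ≡ tile (V′ ρ) (V′ (suc ρ) ∘ swap yρ) c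
    tl = tile-cong (agree (sel≤ ≤-refl)) (agree (sel> ≤-refl))

    beside : ∀ c → yρ < c → c ≤ n → tileIn V ρ c ≢ blank
    beside c p q e with c ≟ suc yρ
    ... | yes refl = proj₁ (proj₂ (proj₂ st)) (trans (sym (tl _ z<s q)) e)
    ... | no d = proj₂ fin c p q (trans (sym (Changed.others (proj₁ st) c (>⇒≢ p) d)) (trans (sym (tl c (≤-trans z<s p) q)) e))

    act′ : ∀ k → (l : ρ < k) → k ≤ n → Active (V k) (y k)
    act′ k l m = (λ e → proj₁ A (trans (sym eʳ) e)) , clear-cong (sym eʳ) (sym eˡ) (proj₂ A)
      where
        A = proj₂ (proj₂ (inv′ k l m))
        eʳ : V k (suc (y k)) ≡ V′ k (y k)
        eʳ = trans (sel> l _) (at-r (V′ k) (y k))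
        eˡ : V k (y k) ≡ V′ k (suc (y k))
        eˡ = trans (sel> l _) (at-l (V′ k) (y k))

  bpd : BPD n V
  bpd = record { top = λ c → trans (sel≤ z≤n c) (BPD.top B c) ; row = row′
               ; off = select-off B (λ k l m → 1≤y k l m , proj₁ (proj₂ (inv′ k l m))) }

  traj : Traj n V V′ ρ y
  traj = record
    { ρ<n = ρ<n
    ; full = λ k l c p q e → full′ k l c p q (trans (sym (tile-cong (agree (sel≤ (<⇒≤ l))) (agree (sel≤ l)) c p q)) e)
    ; same = λ k l c → sym (sel≤ l c)
    ; swapped = λ k l m c → trans (cong (V′ k) (sym (swap-invol (y k) c))) (sym (sel> l _))
    ; range = λ k l m → 1≤y k l m , proj₁ (proj₂ (inv′ k l m))
    ; active = act′
    ; start = trans (tl yρ (1≤y (suc ρ) ≤-refl ρ<n) (<⇒≤ (proj₁ (proj₂ invρ)))) (proj₁ (proj₂ st))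
    ; startʳ = beside
    ; start′ = proj₁ fin
    ; start′ʳ = proj₂ fin
    ; steps = λ k l m → step-cong (1≤y k l (<⇒≤ m)) (proj₁ (proj₂ (inv′ k l (<⇒≤ m)))) (proj₁ (proj₂ (inv′ (suc k) (m<n⇒m<1+n l) m)))
                          (sel> l) (sel> (m<n⇒m<1+n l)) (λ _ → refl) (λ _ → refl) (proj₁ (ret k l m (inv′ (suc k) (m<n⇒m<1+n l) m)))
    ; bpd′ = B }

-- Comparing trajectories

module _ {n V V′ V″ ρ ρ′ y y′} (t : Traj n V V′ ρ y) (t′ : Traj n V′ V″ ρ′ y′) where
  private
    module T = Traj t
    module T′ = Traj t′

  -- The rows above the first mark have no blanks and are left alone by ∇, so the next run finds no
  -- blank there either.
  traj-start : ρ ≤ ρ′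
  traj-start with ρ ≤? ρ′
  ... | yes l = l
  ... | no g = ⊥-elim (T.full ρ′ l _ (proj₁ r) (<⇒≤ (proj₂ r))
                (trans (sym (tile-cong (agree (T.same ρ′ (<⇒≤ l))) (agree (T.same (suc ρ′) l)) _ (proj₁ r) (<⇒≤ (proj₂ r)))) T′.start))
    where l = ≰⇒> g
          r = T′.range (suc ρ′) ≤-refl T′.ρ<n

-- In the first row the old mark has become an r-tile with no blanks to its right, so the new run
-- starts to its left; `step-order` carries this down.
traj-order : ∀ {n V V′ V″ ρ y y′} → Traj n V V′ ρ y → Traj n V′ V″ ρ y′ → ∀ k → ρ < k → k ≤ n → y′ k < y k
traj-order {V′ = V′} {ρ = ρ} {y} {y′} t t′ (suc k) l m with k ≟ ρ
... | no d = step-order (BPD.row T.bpd′ k m) (proj₁ (T.range k l′ (<⇒≤ m))) (<⇒≤ (proj₂ (T.range k l′ (<⇒≤ m))))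
               (T.steps k l′ m) (T′.steps k l′ m)
               (traj-order t t′ k l′ (<⇒≤ m))
  where module T = Traj t
        module T′ = Traj t′
        l′ = ≤∧≢⇒< (≤-pred l) (≢-sym d)
... | yes refl with <-cmp (y′ (suc ρ)) (y (suc ρ))
...   | tri< q _ _ = q
...   | tri≈ _ e _ with () ← trans (sym (Traj.start′ t)) (subst (λ c → tileIn V′ ρ c ≡ blank) e (Traj.start t′))
...   | tri> _ _ q = ⊥-elim (Traj.start′ʳ t _ q (<⇒≤ (proj₂ (Traj.range t′ (suc ρ) l m))) (Traj.start t′))

traj-cong′ : ∀ {n V V′ W′ ρ y} → V′ ≈[ n ] W′ → Traj n V V′ ρ y → Traj n V W′ ρ y
traj-cong′ {n} {V} {V′} {W′} {ρ} {y} e t = record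
  { ρ<n = ρ<n ; full = full
  ; same = λ k l c → trans (e k (≤-trans l (<⇒≤ ρ<n)) c) (same k l c)
  ; swapped = λ k l m c → trans (e k m c) (swapped k l m c)
  ; range = range ; active = active ; start = start ; startʳ = startʳ
  ; start′ = trans (tl _ (proj₁ r) (<⇒≤ (proj₂ r))) start′
  ; start′ʳ = λ c p q b → start′ʳ c p q (trans (sym (tl c (≤-trans z<s p) q)) b)
  ; steps = λ k l m → step-cong (proj₁ (range k l (<⇒≤ m))) (proj₂ (range k l (<⇒≤ m))) (proj₂ (range (suc k) (m<n⇒m<1+n l) m))
                        (λ _ → refl) (λ _ → refl) (e k (<⇒≤ m)) (e (suc k) m) (steps k l m)
  ; bpd′ = bpd-cong e bpd′ }
  where
    open Traj t
    r = range (suc ρ) ≤-refl ρ<n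
    tl : ∀ c → 1 ≤ c → c ≤ n → tileIn W′ ρ c ≡ tileIn V′ ρ c
    tl = tile-cong (agree (e ρ (<⇒≤ ρ<n))) (agree (e (suc ρ) ρ<n))

traj-inj : ∀ {n V₁ V₂ V′ ρ y₁ y₂} → Traj n V₁ V′ ρ y₁ → Traj n V₂ V′ ρ y₂ → y₁ n ≡ y₂ n → V₁ ≈[ n ] V₂
traj-inj {n} {V₁} {V₂} {V′} {ρ} {y₁} {y₂} t₁ t₂ e k m c with k ≤? ρ
... | yes l = trans (sym (Traj.same t₂ k l c)) (Traj.same t₁ k l c)
... | no g = begin
  V₂ k c                            ≡⟨ cong (V₂ k) (sym (swap-invol (y₂ k) c)) ⟩
  V₂ k (swap (y₂ k) (swap (y₂ k) c)) ≡⟨ sym (Traj.swapped t₂ k l m _) ⟩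
  V′ k (swap (y₂ k) c)              ≡⟨ cong (λ z → V′ k (swap z c)) (sym (ys (n ∸ k) k (m+[n∸m]≡n m) l)) ⟩
  V′ k (swap (y₁ k) c)              ≡⟨ Traj.swapped t₁ k l m _ ⟩
  V₁ k (swap (y₁ k) (swap (y₁ k) c)) ≡⟨ cong (V₁ k) (swap-invol (y₁ k) c) ⟩
  V₁ k c ∎
  where
    open ≡-Reasoning
    l = ≰⇒> g
    ys : ∀ j k → k + j ≡ n → ρ < k → y₁ k ≡ y₂ k
    ys zero k q _ = subst (λ x → y₁ x ≡ y₂ x) (trans (sym q) (+-identityʳ k)) e
    ys (suc j) k q l = step-codet (BPD.row (Traj.bpd′ t₁) k k<n) (proj₁ r) (<⇒≤ (proj₂ r)) (Traj.steps t₁ k l k<n)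
                         (subst (λ z → Step (V₂ k) (V₂ (suc k)) (V′ k) (V′ (suc k)) (y₂ k) z) (sym (ys j (suc k) (trans (sym (+-suc k j)) q) (m<n⇒m<1+n l))) (Traj.steps t₂ k l k<n))
      where k<n = subst (k <_) q (m<m+n k z<s)
            r = Traj.range t₁ (suc k) (m<n⇒m<1+n l) k<n

traj-first : ∀ {n V V₁ V₂ ρ₁ ρ₂ y₁ y₂} → Traj n V V₁ ρ₁ y₁ → Traj n V V₂ ρ₂ y₂ → ¬ (ρ₁ < ρ₂)
traj-first t₁ t₂ l = Traj.full t₂ _ l _ (proj₁ r) (<⇒≤ (proj₂ r)) (Traj.start t₁)
  where r = Traj.range t₁ _ ≤-refl (Traj.ρ<n t₁)

traj-det : ∀ {n V V₁ V₂ ρ₁ ρ₂ y₁ y₂} → BPD n V → Traj n V V₁ ρ₁ y₁ → Traj n V V₂ ρ₂ y₂ → ρ₁ ≡ ρ₂ × y₁ n ≡ y₂ n × V₁ ≈[ n ] V₂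
traj-det {ρ₁ = ρ₁} {ρ₂} B t₁ t₂ with <-cmp ρ₁ ρ₂
... | tri< l _ _ = ⊥-elim (traj-first t₁ t₂ l)
... | tri> _ _ l = ⊥-elim (traj-first t₂ t₁ l)
traj-det {n} {V} {V₁} {V₂} {ρ} {_} {y₁} {y₂} B t₁ t₂ | tri≈ _ refl _ = refl , ys n (Traj.ρ<n t₁) ≤-refl , eq
  where
    ys : ∀ k → ρ < k → k ≤ n → y₁ k ≡ y₂ k
    ys (suc k) l m with k ≟ ρ
    ... | no d = step-det (BPD.row B k m) (proj₂ (Traj.range t₁ k l′ (<⇒≤ m))) (Traj.steps t₁ k l′ m)
                   (subst (λ z → Step (V k) (V (suc k)) (V₂ k) (V₂ (suc k)) z (y₂ (suc k))) (sym (ys k l′ (<⇒≤ m))) (Traj.steps t₂ k l′ m))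
      where l′ = ≤∧≢⇒< (≤-pred l) (≢-sym d)
    ... | yes refl with <-cmp (y₁ (suc ρ)) (y₂ (suc ρ))
    ...   | tri< q _ _ = ⊥-elim (Traj.startʳ t₁ _ q (<⇒≤ (proj₂ (Traj.range t₂ (suc ρ) l m))) (Traj.start t₂))
    ...   | tri≈ _ e _ = e
    ...   | tri> _ _ q = ⊥-elim (Traj.startʳ t₂ _ q (<⇒≤ (proj₂ (Traj.range t₁ (suc ρ) l m))) (Traj.start t₁))
    eq : V₁ ≈[ n ] V₂
    eq k m c with k ≤? ρ
    ... | yes l = trans (Traj.same t₂ k l c) (sym (Traj.same t₁ k l c))
    ... | no g = trans (Traj.swapped t₂ k (≰⇒> g) m c) (trans (cong (λ z → V k (swap z c)) (sym (ys k (≰⇒> g) m))) (sym (Traj.swapped t₁ k (≰⇒> g) m c)))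

-- Since the rows above have no blanks, the first `ρ` columns carry pipes into row `suc ρ`; its
-- blanks lie beyond them, and the mark never moves left. In the last row this is the condition
-- `r ≤ a`.
traj-low : ∀ {n V V′ ρ y} → BPD n V → Traj n V V′ ρ y → ∀ k → ρ < k → k ≤ n → ρ < y k
traj-low {ρ = ρ} {y} B t (suc k) l m with k ≟ ρ
... | no d = ≤-trans (traj-low B t k l′ (<⇒≤ m)) (step-mono (Traj.steps t k l′ m))
  where l′ = ≤∧≢⇒< (≤-pred l) (≢-sym d)
... | yes refl with suc ρ ≤? y (suc ρ)
...   | yes p = p
...   | no g = ⊥-elim (idTo-nz (full-top B ρ (<⇒≤ m) (Traj.full t)) _ (proj₁ r) (≤-pred (≰⇒> g))
                 (proj₁ (blank-NS (BPD.row B ρ m) (proj₁ r) (<⇒≤ (proj₂ r)) (Traj.start t))))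
  where r = Traj.range t (suc ρ) l m

-- The first `suc ρ` rows agree with those of the identity, so pipe `suc ρ` runs straight down
-- column `suc ρ` in all later rows. Its vertical tiles stop every search.
barrier-full : ∀ {n V′ ρ a} → BPD n V′ → ρ < n → (∀ k → k ≤ ρ → NoBlank n V′ k) → ρ < a → Barrier n V′ ρ a (λ _ → suc ρ)
barrier-full {n} {V′} {ρ} B ρ<n nb l = record
  { bottom = l
  ; pos = λ _ _ _ → z<s
  ; mono = λ _ _ _ → ≤-refl
  ; stop = λ k p q z s t tr → suc ρ , ≤-refl , ≤∧≢⇒< s (λ e → ver≢r (trans (sym (isVer k p q)) (subst (λ c → tileIn V′ k c ≡ rtile) (sym e) tr)))
                            , λ b → ver≢b (trans (sym (isVer k p q)) b)
  ; final = fin }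
  where
    ver≢r : ver ≢ rtile
    ver≢r ()
    ver≢b : ver ≢ blank
    ver≢b ()
    I = full-top B (suc ρ) ρ<n (λ k p → nb k (≤-pred p))
    I₀ = full-top B ρ (<⇒≤ ρ<n) (λ k p → nb k (<⇒≤ p))
    isVer : ∀ k → ρ < k → k < n → tileIn V′ k (suc ρ) ≡ ver
    isVer k p q = proj₁ (idle-ver (BPD.row B k q) ρ<n
                    (λ c p′ q′ e → <⇒≢ p′ (sym (trans (sym (columns-stay B ρ<n I k p (<⇒≤ q) c p′ q′)) e))) (suc ρ) z<s ≤-refl)
    fin : ∀ z → suc ρ ≤ z → z < n → V′ (suc ρ) z ≢ 0 → tileIn V′ ρ z ≡ rtile × (∀ c → z < c → c ≤ n → tileIn V′ ρ c ≢ blank)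
    fin z p q nz = turn-r (BPD.row B ρ ρ<n) (≤-trans z<s p) (<⇒≤ q) nz (proj₂ I₀ z p (<⇒≤ q))
                 , λ c p′ q′ → nb ρ ≤-refl c (≤-trans z<s p′) q′

-- The barrier is the column just right of the marks of the following run: by `active` a pipe enters
-- it from above, so its tile is nonblank. An r-tile has nothing above it, which makes the
-- inequality `c < z` strict in the case of a pass.
barrier-traj : ∀ {n V′ V″ ρ a y} → BPD n V′ → Traj n V′ V″ ρ y → y n < a → Barrier n V′ ρ a (suc ∘ y)
barrier-traj {n} {V′} {V″} {ρ} {a} {y} B t l = record
  { bottom = l
  ; pos = λ _ _ _ → z<s
  ; mono = λ k p q → s≤s (step-mono (steps k p q))
  ; stop = λ k p q z s z<n tr → halt k p q z s z<n tr (steps k p q)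
  ; final = λ z p q nz → turn-r (BPD.row B ρ ρ<n) (≤-trans z<s p) (<⇒≤ q) nz
                           (proj₂ I₀ z (≤-trans (traj-low B t (suc ρ) ≤-refl ρ<n) (<⇒≤ p)) (<⇒≤ q))
                       , λ c p′ q′ → startʳ c (<-trans p p′) q′ }
  where
    open Traj t
    I₀ = full-top B ρ (<⇒≤ ρ<n) full
    halt : ∀ k → ρ < k → k < n → ∀ z → y (suc k) < z → z < n → tileIn V′ k z ≡ rtile →
           Step (V′ k) (V′ (suc k)) (V″ k) (V″ (suc k)) (y k) (y (suc k)) →
           ∃[ c ] y k < c × c < z × tileIn V′ k c ≢ blank
    halt k p q z s z<n tr st with y (suc k)
    halt k p q z s z<n tr (pass nz _ _ _) | _ = suc (y k) , ≤-refl
      , ≤∧≢⇒< s (λ e → nz (trans (cong (V′ k) e) (proj₁ (rtile-NS (BPD.row B k q) (≤-trans z<s s) (<⇒≤ z<n) tr))))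
      , N≢0⇒nonblank (BPD.row B k q) z<s (proj₂ (range k p (<⇒≤ q))) nz
    halt k p q z s z<n tr (move m tj _ _ _ _ _) | _ = suc (y k) , ≤-refl , ≤-<-trans m s
      , N≢0⇒nonblank (BPD.row B k q) z<s (proj₂ (range k p (<⇒≤ q))) (proj₁ (jtile-NS (BPD.row B k q) z<s (proj₂ (range k p (<⇒≤ q))) tj))

-- Iterated ∇ as a relation, free of fuel and of pipe configurations. A derivation carries the
-- intermediate pipe dreams, so determinism, injectivity and compatibility are inductions over it.
data Out (n : ℕ) : Rows → List ℕ → List ℕ → Set where
  nil  : ∀ {V} → (∀ k → k < n → NoBlank n V k) → Out n V [] []
  cons : ∀ {V V′ ρ y a as rs} → Traj n V V′ ρ y → y n ≡ a → Out n V′ as rs → Out n V (a ∷ as) (suc ρ ∷ rs)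

nb-traj : ∀ {n V V′ ρ y} → (∀ k → k < n → NoBlank n V k) → Traj n V V′ ρ y → ⊥
nb-traj {ρ = ρ} nb t = nb _ ρ<n _ (proj₁ r) (<⇒≤ (proj₂ r)) start
  where open Traj t
        r = range (suc ρ) ≤-refl ρ<n

out-cong : ∀ {n V W as rs} → V ≈[ n ] W → Out n V as rs → Out n W as rs
out-cong e (nil nb) = nil λ k l c p q b → nb k l c p q (trans (sym (tile-cong (agree (e k (<⇒≤ l))) (agree (e (suc k) l)) c p q)) b)
out-cong e (cons t q o) = cons (traj-cong e t) q o

out-det : ∀ {n V as rs as′ rs′} → BPD n V → Out n V as rs → Out n V as′ rs′ → as ≡ as′ × rs ≡ rs′
out-det B (nil _) (nil _) = refl , refl
out-det B (nil nb) (cons t _ _) = ⊥-elim (nb-traj nb t)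
out-det B (cons t _ _) (nil nb) = ⊥-elim (nb-traj nb t)
out-det B (cons t e o) (cons t′ e′ o′) with traj-det B t t′
... | refl , ey , eV with out-det (Traj.bpd′ t′) (out-cong eV o) o′
...   | p , q = cong₂ _∷_ (trans (sym e) (trans ey e′)) p , cong (_ ∷_) q

out-inj : ∀ {n V W as rs} → BPD n V → BPD n W → Out n V as rs → Out n W as rs → V ≈[ n ] W
out-inj {n} B C (nil nb) (nil nb′) k l c with c ≟ 0 | n <? c
... | yes e | _ = trans (BPD.off C k l c (inj₁ e)) (sym (BPD.off B k l c (inj₁ e)))
... | no _ | yes m = trans (BPD.off C k l c (inj₂ m)) (sym (BPD.off B k l c (inj₂ m)))
... | no z | no m with c ≤? k
...   | yes h = trans (proj₁ (full-top C k l (λ j p → nb′ j (<-≤-trans p l))) c (n≢0⇒n>0 z) h)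
                  (sym (proj₁ (full-top B k l (λ j p → nb j (<-≤-trans p l))) c (n≢0⇒n>0 z) h))
...   | no h = trans (proj₂ (full-top C k l (λ j p → nb′ j (<-≤-trans p l))) c (≰⇒> h) (≮⇒≥ m))
                  (sym (proj₂ (full-top B k l (λ j p → nb j (<-≤-trans p l))) c (≰⇒> h) (≮⇒≥ m)))
out-inj B C (cons t e o) (cons t′ e′ o′) =
  traj-inj (traj-cong′ (out-inj (Traj.bpd′ t) (Traj.bpd′ t′) o o′) t) t′ (trans e (sym e′))

-- Counting labels

δ : ℕ → ℕ → ℕ
δ e x = if x ≡ᵇ e then 1 else 0

num : ℕ → State → ℕ → ℕ
num e u zero    = 0
num e u (suc c) = δ e (u (suc c)) + num e u c

δ-hit : ∀ {e x} → x ≡ e → δ e x ≡ 1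
δ-hit p = if-yes (≡ᵇ-yes p)

δ-miss : ∀ {e x} → x ≢ e → δ e x ≡ 0
δ-miss p = if-no (≡ᵇ-no p)

cell-δ : ∀ {_≺_ t N E S W} e → LCell _≺_ t N E S W → δ e S + δ e W ≡ δ e N + δ e E
cell-δ {N = N} {E} e c with cell-perm c
... | inj₁ (refl , refl) = refl
... | inj₂ (refl , refl) = +-comm (δ e E) (δ e N)

-- A cell only permutes its labels, so the sum telescopes over the columns; at the west border the
-- horizontal label is 0, hence `e ≢ 0`.
row-balance : ∀ {_≺_ n k u v e} → LRow _≺_ n k u v → e ≢ 0 → ∀ c → c ≤ n → num e v c ≡ num e u c + δ e (carrier u v c)
row-balance {e = zero} R nz _ _ = ⊥-elim (nz refl)
row-balance {e = suc e} R nz zero l = refl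
row-balance {u = u} {v} {suc e} R nz (suc c) l = begin
  δ (suc e) (v (suc c)) + num (suc e) v c ≡⟨ cong (δ (suc e) (v (suc c)) +_) (row-balance R nz c (<⇒≤ l)) ⟩
  S + (M + W)  ≡⟨ cong (S +_) (+-comm M W) ⟩
  S + (W + M)  ≡⟨ sym (+-assoc S W M) ⟩
  (S + W) + M  ≡⟨ cong (_+ M) (cell-δ (suc e) (Row.cell R c l)) ⟩
  (N + E) + M  ≡⟨ +-assoc N E M ⟩
  N + (E + M)  ≡⟨ cong (N +_) (+-comm E M) ⟩
  N + (M + E)  ≡⟨ sym (+-assoc N M E) ⟩
  (N + M) + E ∎
  where
    open ≡-Reasoning
    S = δ (suc e) (v (suc c))
    W = δ (suc e) (carrier u v c)
    N = δ (suc e) (u (suc c))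
    E = δ (suc e) (carrier u v (suc c))
    M = num (suc e) u c

num-mono : ∀ e u {m m′} → m ≤ m′ → num e u m ≤ num e u m′
num-mono e u {m} {zero} z≤n = ≤-refl
num-mono e u {m} {suc m′} l with m ≟ suc m′
... | yes refl = ≤-refl
... | no d = ≤-trans (num-mono e u (≤-pred (≤∧≢⇒< l d))) (m≤n+m _ (δ e (u (suc m′))))

num-hit : ∀ {e u c m} → 1 ≤ c → c ≤ m → u c ≡ e → 1 ≤ num e u m
num-hit {e} {u} {suc c} {m} p l q = ≤-trans (≤-trans (≤-reflexive (sym (δ-hit q))) (m≤m+n _ (num e u c))) (num-mono e u l)

num-pos : ∀ {e u} m → 1 ≤ num e u m → ∃[ c ] 1 ≤ c × c ≤ m × u c ≡ e
num-pos {e} {u} (suc m) l with u (suc m) ≟ e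
... | yes q = suc m , z<s , ≤-refl , q
... | no q with num-pos m (subst (λ x → 1 ≤ x + num e u m) (δ-miss q) l)
...   | c , p , r , s = c , p , m≤n⇒m≤1+n r , s

num-two : ∀ {e u c c′ m} → 1 ≤ c → c < c′ → c′ ≤ m → u c ≡ e → u c′ ≡ e → 2 ≤ num e u m
num-two {e} {u} {c} {suc c′} p l m q q′ =
  ≤-trans (+-mono-≤ (≤-reflexive (sym (δ-hit q′))) (num-hit {u = u} p (≤-pred l) q)) (num-mono e u m)

module Labels {_≺_ n V} (B : LBPD _≺_ n V) where

  num-top : ∀ {e} → e ≢ 0 → ∀ m → num e (V 0) m ≡ 0
  num-top nz zero = refl
  num-top {e} nz (suc m) rewrite BPD.top B (suc m) | δ-miss {e} (≢-sym nz) = num-top nz m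

  -- Passing a row downwards adds exactly the label of the pipe that leaves it to the east. As the
  -- top state is empty, a nonzero `e` occurs once in `V k` if `e ≤ k` and not at all otherwise; all
  -- the facts about positions of labels below rest on this.
  num-step : ∀ {e} → e ≢ 0 → ∀ k → k < n → num e (V (suc k)) n ≡ num e (V k) n + δ e (suc k)
  num-step nz k l = trans (row-balance (BPD.row B k l) nz n ≤-refl) (cong (λ x → num _ (V k) n + δ _ x) (Row.exit (BPD.row B k l)))

  num-new : ∀ {e} → e ≢ 0 → ∀ k → k ≤ n → k < e → num e (V k) n ≡ 0
  num-new nz zero _ _ = num-top nz n
  num-new nz (suc k) l m = trans (num-step nz k l) (cong₂ _+_ (num-new nz k (<⇒≤ l) (<⇒≤ m)) (δ-miss (<⇒≢ m)))

  num-old : ∀ {e} → e ≢ 0 → ∀ k → k ≤ n → e ≤ k → num e (V k) n ≡ 1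
  num-old nz zero l m = ⊥-elim (nz (n≤0⇒n≡0 m))
  num-old {e} nz (suc k) l m with e ≟ suc k
  ... | yes refl = trans (num-step nz k l) (cong₂ _+_ (num-new nz k (<⇒≤ l) ≤-refl) (δ-hit {suc k} refl))
  ... | no d = trans (num-step nz k l) (cong₂ _+_ (num-old nz k (<⇒≤ l) (≤-pred (≤∧≢⇒< m d))) (δ-miss (≢-sym d)))

  num-≤1 : ∀ {e} → e ≢ 0 → ∀ k → k ≤ n → num e (V k) n ≤ 1
  num-≤1 {e} nz k l with e ≤? k
  ... | yes m = ≤-reflexive (num-old nz k l m)
  ... | no m = ≤-trans (≤-reflexive (num-new nz k l (≰⇒> m))) z≤n

  label-uniq : ∀ {k c c′ e} → k ≤ n → e ≢ 0 → 1 ≤ c → c ≤ n → 1 ≤ c′ → c′ ≤ n → V k c ≡ e → V k c′ ≡ e → c ≡ c′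
  label-uniq {k} {c} {c′} l nz p p′ q q′ h h′ with <-cmp c c′
  ... | tri< m _ _ = ⊥-elim (1+n≰n (≤-trans (num-two {u = V k} p m q′ h h′) (num-≤1 nz k l)))
  ... | tri≈ _ e _ = e
  ... | tri> _ _ m = ⊥-elim (1+n≰n (≤-trans (num-two {u = V k} q m p′ h′ h) (num-≤1 nz k l)))

  label-≤ : ∀ {k c e} → k ≤ n → e ≢ 0 → 1 ≤ c → c ≤ n → V k c ≡ e → e ≤ k
  label-≤ {k} {c} {e} l nz p q h with e ≤? k
  ... | yes m = m
  ... | no m = ⊥-elim (1+n≰n (≤-trans (num-hit {u = V k} p q h) (≤-reflexive (num-new nz k l (≰⇒> m)))))

  label-∃ : ∀ {k e} → k ≤ n → e ≢ 0 → e ≤ k → ∃[ c ] 1 ≤ c × c ≤ n × V k c ≡ e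
  label-∃ {k} l nz m = num-pos n (≤-reflexive (sym (num-old nz k l m)))

  label-down : ∀ {k c e} → k < n → e ≢ 0 → 1 ≤ c → c ≤ n → V k c ≡ e → ∃[ c′ ] 1 ≤ c′ × c′ ≤ c × V (suc k) c′ ≡ e
  label-down {k} {c} {e} l nz p q h =
    num-pos c (≤-trans (num-hit {u = V k} p ≤-refl h)
      (≤-trans (m≤m+n _ (δ e (carrier (V k) (V (suc k)) c))) (≤-reflexive (sym (row-balance (BPD.row B k l) nz c q)))))

  label-mono : ∀ {k c c′ e} → k < n → e ≢ 0 → 1 ≤ c → c ≤ n → 1 ≤ c′ → c′ ≤ n → V k c ≡ e → V (suc k) c′ ≡ e → c′ ≤ c
  label-mono l nz p q p′ q′ h h′ with label-down l nz p q h
  ... | c″ , r , s , h″ = subst (_≤ _) (label-uniq l nz r (≤-trans s q) p′ q′ h″ h′) s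

  -- With `carrier-from` this translates horizontal labels into positions: a pipe uses the edge to
  -- the right of column `m` if it lies at or left of `m` below the row and not so above it. Both
  -- follow from `row-balance`.
  carrier-at : ∀ {k c m e} → k < n → e ≢ 0 → 1 ≤ c → c ≤ m → m ≤ n → V (suc k) c ≡ e →
    (∀ c′ → 1 ≤ c′ → c′ ≤ n → V k c′ ≡ e → m < c′) → carrier (V k) (V (suc k)) m ≡ e
  carrier-at {k} {c} {m} {e} l nz p q r h away with carrier (V k) (V (suc k)) m ≟ e
  ... | yes z = z
  ... | no z with num-pos m (≤-trans (num-hit {u = V (suc k)} p q h) (≤-reflexive
                 (trans (row-balance (BPD.row B k l) nz m r) (trans (cong (num e (V k) m +_) (δ-miss z)) (+-identityʳ _)))))
  ...   | c′ , s , t , w = ⊥-elim (<⇒≱ (away c′ s (≤-trans t r) w) t)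

  carrier-from : ∀ {k m e} → k < n → e ≢ 0 → m ≤ n → carrier (V k) (V (suc k)) m ≡ e →
    (∃[ c ] 1 ≤ c × c ≤ m × V (suc k) c ≡ e) × (∀ c′ → 1 ≤ c′ → c′ ≤ n → V k c′ ≡ e → m < c′)
  carrier-from {k} {m} {e} l nz r h = num-pos m (≤-trans (m≤n+m 1 (num e (V k) m)) (≤-reflexive (sym bal))) , away
    where
      bal : num e (V (suc k)) m ≡ num e (V k) m + 1
      bal = trans (row-balance (BPD.row B k l) nz m r) (cong (num e (V k) m +_) (δ-hit h))
      away : ∀ c′ → 1 ≤ c′ → c′ ≤ n → V k c′ ≡ e → m < c′
      away c′ p q w with suc m ≤? c′
      ... | yes z = z
      ... | no z = ⊥-elim (1+n≰n (≤-trans (+-monoˡ-≤ 1 (num-hit {u = V k} p (≤-pred (≰⇒> z)) w))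
                     (≤-trans (≤-reflexive (sym bal)) (≤-trans (num-mono e (V (suc k)) r) (num-≤1 nz (suc k) l)))))

-- Searching in intervals

-- The interval in a form open to induction, which `fromTo` hides behind `map` and `upTo`.
seg : ℕ → ℕ → List ℕ
seg a zero    = []
seg a (suc m) = a ∷ seg (suc a) m

fromTo-seg : ∀ a b → fromTo a b ≡ seg a (suc b ∸ a)
fromTo-seg a b = go a (suc b ∸ a) id (λ i → refl)
  where
    go : ∀ a m (f : ℕ → ℕ) → (∀ i → f i ≡ i) → map (a +_) (applyUpTo f m) ≡ seg a m
    slide : ∀ a m (f g : ℕ → ℕ) → (∀ i → a + f i ≡ suc a + g i) → map (a +_) (applyUpTo f m) ≡ map (suc a +_) (applyUpTo g m)
    slide a zero f g h = refl
    slide a (suc m) f g h = cong₂ _∷_ (h 0) (slide a m (f ∘ suc) (g ∘ suc) (h ∘ suc))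
    go a zero f h = refl
    go a (suc m) f h = cong₂ _∷_ (trans (cong (a +_) (h 0)) (+-identityʳ a))
      (trans (slide a m (f ∘ suc) id (λ i → trans (cong (a +_) (h (suc i))) (+-suc a i))) (go (suc a) m id (λ _ → refl)))

seg-end : ∀ {a b j} → a ≤ j → j < a + (suc b ∸ a) → j ≤ b
seg-end {a} {b} {j} l m with a ≤? suc b
... | yes p = ≤-pred (subst (j <_) (m+[n∸m]≡n p) m)
... | no p = ⊥-elim (<⇒≱ (subst (λ x → j < a + x) (m≤n⇒m∸n≡0 (<⇒≤ (≰⇒> p))) m) (≤-trans (≤-reflexive (+-identityʳ a)) l))

seg-in : ∀ {a b j} → a ≤ j → j ≤ b → j < a + (suc b ∸ a)
seg-in {a} {b} {j} l m = subst (j <_) (sym (m+[n∸m]≡n (≤-trans l (m≤n⇒m≤1+n m)))) (s≤s m)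

seg-tail : ∀ {a m j} → suc a ≤ j → j < suc a + m → a ≤ j × j < a + suc m
seg-tail {a} {m} {j} p q = <⇒≤ p , subst (j <_) (sym (+-suc a m)) q

seg-drop : ∀ {a m j} → a ≢ j → a ≤ j → j < a + suc m → suc a ≤ j × j < suc a + m
seg-drop {a} {m} {j} d p q = ≤∧≢⇒< p d , subst (j <_) (+-suc a m) q

data SegSearch (p : ℕ → Bool) (a m : ℕ) : List ℕ → Set where
  none  : (∀ j → a ≤ j → j < a + m → p j ≡ false) → SegSearch p a m []
  found : ∀ {k ks} → a ≤ k → k < a + m → p k ≡ true → (∀ j → a ≤ j → j < k → p j ≡ false) → SegSearch p a m (k ∷ ks)

segSearch : ∀ p a m → SegSearch p a m (filterᵇ p (seg a m))
segSearch p a zero = none λ j l q → ⊥-elim (<⇒≱ q (≤-trans (≤-reflexive (+-identityʳ a)) l))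
segSearch p a (suc m) with p a in eq
... | true = found ≤-refl (m<m+n a z<s) eq (λ j l q → ⊥-elim (<⇒≱ q l))
... | false with filterᵇ p (seg (suc a) m) | segSearch p (suc a) m
...   | [] | none h = none go
  where go : ∀ j → a ≤ j → j < a + suc m → p j ≡ false
        go j l q with a ≟ j
        ... | yes refl = eq
        ... | no d = let (x , y) = seg-drop d l q in h j x y
...   | k ∷ _ | found l q e h = found (<⇒≤ l) (proj₂ (seg-tail l q)) e go
  where go : ∀ j → a ≤ j → j < k → p j ≡ false
        go j l′ q′ with a ≟ j
        ... | yes refl = eq
        ... | no d = h j (≤∧≢⇒< l′ d) q′

data Search (p : ℕ → Bool) (a b : ℕ) : List ℕ → Set where
  none  : (∀ j → a ≤ j → j ≤ b → p j ≡ false) → Search p a b []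
  found : ∀ {k ks} → a ≤ k → k ≤ b → p k ≡ true → (∀ j → a ≤ j → j < k → p j ≡ false) → Search p a b (k ∷ ks)

search : ∀ p a b → Search p a b (filterᵇ p (fromTo a b))
search p a b rewrite fromTo-seg a b with filterᵇ p (seg a (suc b ∸ a)) | segSearch p a (suc b ∸ a)
... | [] | none h = none λ j l m → h j l (seg-in l m)
... | _ ∷ _ | found l m e h = found l (seg-end l m) e h

firstWith-≡ : ∀ p a b k → a ≤ k → k ≤ b → p k ≡ true → (∀ j → a ≤ j → j < k → p j ≡ false) → firstWith p (fromTo a b) ≡ k
firstWith-≡ p a b k l m e h with filterᵇ p (fromTo a b) | search p a b
... | [] | none z = ⊥-elim (true≢false e (z k l m))
... | j ∷ _ | found l′ m′ e′ h′ with <-cmp j k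
...   | tri< q _ _ = ⊥-elim (true≢false e′ (h j l′ q))
...   | tri≈ _ q _ = q
...   | tri> _ _ q = ⊥-elim (true≢false e (h′ k l q))

firstWith-spec : ∀ p a b k → a ≤ k → k ≤ b → p k ≡ true →
  ∃[ z ] firstWith p (fromTo a b) ≡ z × a ≤ z × z ≤ b × p z ≡ true × (∀ j → a ≤ j → j < z → p j ≡ false)
firstWith-spec p a b k l m e with filterᵇ p (fromTo a b) | search p a b
... | [] | none z = ⊥-elim (true≢false e (z k l m))
... | j ∷ _ | found l′ m′ e′ h′ = j , refl , l′ , m′ , e′ , h′

null-true : ∀ p a b → (∀ j → a ≤ j → j ≤ b → p j ≡ false) → null (filterᵇ p (fromTo a b)) ≡ true
null-true p a b h with filterᵇ p (fromTo a b) | search p a b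
... | [] | none _ = refl
... | _ ∷ _ | found l m e _ = ⊥-elim (true≢false e (h _ l m))

null-false : ∀ p a b k → a ≤ k → k ≤ b → p k ≡ true → null (filterᵇ p (fromTo a b)) ≡ false
null-false p a b k l m e with filterᵇ p (fromTo a b) | search p a b
... | [] | none h = ⊥-elim (true≢false e (h _ l m))
... | _ ∷ _ | found _ _ _ _ = refl

any-seg-true : ∀ p a m k → a ≤ k → k < a + m → p k ≡ true → any p (seg a m) ≡ true
any-seg-true p a zero k l q e = ⊥-elim (<⇒≱ q (≤-trans (≤-reflexive (+-identityʳ a)) l))
any-seg-true p a (suc m) k l q e with p a in eq
... | true = refl
... | false = let (x , y) = seg-drop (λ { refl → true≢false e eq }) l q in any-seg-true p (suc a) m k x y e

any-seg-false : ∀ p a m → (∀ j → a ≤ j → j < a + m → p j ≡ false) → any p (seg a m) ≡ false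
any-seg-false p a zero h = refl
any-seg-false p a (suc m) h rewrite h a ≤-refl (m<m+n a z<s) = any-seg-false p (suc a) m (λ j l q → let (x , y) = seg-tail l q in h j x y)

any-true : ∀ p a b k → a ≤ k → k ≤ b → p k ≡ true → any p (fromTo a b) ≡ true
any-true p a b k l m e rewrite fromTo-seg a b = any-seg-true p a _ k l (seg-in l m) e

any-false : ∀ p a b → (∀ j → a ≤ j → j ≤ b → p j ≡ false) → any p (fromTo a b) ≡ false
any-false p a b h rewrite fromTo-seg a b = any-seg-false p a _ (λ j l q → h j l (seg-end l q))

last-seg : ∀ p a m k d → a ≤ k → k < a + m → p k ≡ true → (∀ j → k < j → j < a + m → p j ≡ false) → lastD d (filterᵇ p (seg a m)) ≡ k
last-seg p a zero k d l q e h = ⊥-elim (<⇒≱ q (≤-trans (≤-reflexive (+-identityʳ a)) l))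
last-seg p a (suc m) k d l q e h with a ≟ k
... | yes refl rewrite e = lastD-none (filterᵇ p (seg (suc a) m)) (segSearch p (suc a) m)
  where lastD-none : ∀ xs → SegSearch p (suc a) m xs → lastD a xs ≡ a
        lastD-none [] _ = refl
        lastD-none (j ∷ _) (found x y z _) = ⊥-elim (true≢false z (h j x (proj₂ (seg-tail x y))))
... | no ne with p a
...   | true = let (x , y) = seg-drop ne l q in last-seg p (suc a) m k a x y e (λ j s t → h j s (subst (j <_) (sym (+-suc a m)) t))
...   | false = let (x , y) = seg-drop ne l q in last-seg p (suc a) m k d x y e (λ j s t → h j s (subst (j <_) (sym (+-suc a m)) t))

lastD-≡ : ∀ p a b k → a ≤ k → k ≤ b → p k ≡ true → (∀ j → k < j → j ≤ b → p j ≡ false) → lastD 0 (filterᵇ p (fromTo a b)) ≡ k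
lastD-≡ p a b k l m e h rewrite fromTo-seg a b = last-seg p a _ k 0 l (seg-in l m) e (λ j s t → h j s (seg-end (≤-trans l (<⇒≤ s)) t))

-- Configurations of pipes

Saturated : ℕ → Rows → Set
Saturated n W = ∀ q → 1 ≤ q → q ≤ n → W n q ≢ 0

-- A configuration names a pipe by its bottom column `q`, a state by its exit row, which is `W n q`.
-- Values of `col` are constrained only in the rows that the pipe visits, since updates leave the
-- others arbitrary.
record Rep (n : ℕ) (σ : Conf) (W : Rows) : Set where
  field
    ex≡ : ∀ q → 1 ≤ q → q ≤ n → ex (σ q) ≡ W n q
    col≡ : ∀ q k → 1 ≤ q → q ≤ n → W n q ≤ k → k ≤ n → W k (col (σ q) k) ≡ W n q
    col-range : ∀ q k → 1 ≤ q → q ≤ n → W n q ≤ k → k ≤ n → 1 ≤ col (σ q) k × col (σ q) k ≤ n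

-- Pipe `e` passes through the cell in row `suc k` and column `suc c`; pipes enter cells only from
-- the south or the west.
On : Rows → ℕ → ℕ → ℕ → Set
On V k c e = V (suc k) (suc c) ≡ e ⊎ carrier (V k) (V (suc k)) c ≡ e

cell-SW : ∀ {t N E S W} → Cell t N E S W → t ≢ blank → S ≢ 0 ⊎ W ≢ 0
cell-SW cBlank z = ⊥-elim (z refl)
cell-SW (cCross _) _ = inj₁ λ ()
cell-SW cHor _ = inj₂ λ ()
cell-SW cVer _ = inj₁ λ ()
cell-SW cR _ = inj₁ λ ()
cell-SW cJ _ = inj₂ λ ()

setCol-in : ∀ P {lo hi v m} → lo ≤ m → m < hi → col (setCol P lo hi v) m ≡ v
setCol-in P p q = if-yes (∧-yes (≤ᵇ-yes p) (<ᵇ-yes q))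

setCol-out : ∀ P {lo hi v m} → ¬ (lo ≤ m × m < hi) → col (setCol P lo hi v) m ≡ col P m
setCol-out P h = if-no (≢true⇒false λ e → h (≤ᵇ-true (proj₁ (∧-true e)) , <ᵇ-true (proj₂ (∧-true e))))

module Reading {n W σ} (B : BPD n W) (F : Saturated n W) (R : Rep n σ W) where
  open Labels B
  open Rep R

  col-uniq : ∀ {q k c} → 1 ≤ q → q ≤ n → k ≤ n → 1 ≤ c → c ≤ n → W k c ≡ W n q → col (σ q) k ≡ c
  col-uniq {q} {k} p p′ l r r′ h = label-uniq l (F q p p′) (proj₁ cr) (proj₂ cr) r r′ (col≡ q k p p′ e≤ l) h
    where e≤ = label-≤ l (F q p p′) r r′ h
          cr = col-range q k p p′ e≤ l

  col-mono₁ : ∀ {q k} → 1 ≤ q → q ≤ n → W n q ≤ k → k < n → col (σ q) (suc k) ≤ col (σ q) k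
  col-mono₁ {q} {k} p p′ l m = label-mono m (F q p p′) (proj₁ a) (proj₂ a) (proj₁ b) (proj₂ b) (col≡ q k p p′ l (<⇒≤ m))
                                 (col≡ q (suc k) p p′ (m≤n⇒m≤1+n l) m)
    where a = col-range q k p p′ l (<⇒≤ m)
          b = col-range q (suc k) p p′ (m≤n⇒m≤1+n l) m

  col-mono : ∀ {q j} k → 1 ≤ q → q ≤ n → W n q ≤ j → j ≤ k → k ≤ n → col (σ q) k ≤ col (σ q) j
  col-mono {q} {zero} zero p p′ l h m = ≤-refl
  col-mono {q} {j} (suc k) p p′ l h m with j ≟ suc k
  ... | yes refl = ≤-refl
  ... | no d = ≤-trans (col-mono₁ p p′ (≤-trans l h′) m) (col-mono k p p′ l h′ (<⇒≤ m))
    where h′ = ≤-pred (≤∧≢⇒< h d)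

  col-bottom : ∀ {q} → 1 ≤ q → q ≤ n → col (σ q) n ≡ q
  col-bottom p p′ = col-uniq p p′ ≤-refl p p′ refl

  inPipe-intro : ∀ {q k c} → 1 ≤ q → q ≤ n → W n q ≤ suc k → suc k ≤ n → c ≤ n → col (σ q) (suc k) ≤ c →
    (W n q ≤ k → c ≤ col (σ q) k) → inPipe n (σ q) (suc k) c ≡ true
  inPipe-intro {q} {k} {c} p p′ l m c≤n h h′ rewrite ex≡ q p p′ =
    ∧-yes (≤ᵇ-yes l) (∧-yes (≤ᵇ-yes m) (∧-yes (≤ᵇ-yes h) (≤ᵇ-yes hi)))
    where
      hi : c ≤ (if suc k ≡ᵇ W n q then n else col (σ q) k)
      hi with suc k ≟ W n q
      ... | yes e rewrite ≡ᵇ-yes e = c≤n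
      ... | no e rewrite ≡ᵇ-no e = h′ (≤-pred (≤∧≢⇒< l (≢-sym e)))

  inPipe-elim : ∀ {q k c} → 1 ≤ q → q ≤ n → inPipe n (σ q) (suc k) c ≡ true →
    W n q ≤ suc k × col (σ q) (suc k) ≤ c × (W n q ≤ k → c ≤ col (σ q) k)
  inPipe-elim {q} {k} {c} p p′ e rewrite ex≡ q p p′ with ∧-true {W n q ≤ᵇ suc k} e
  ... | a , e₁ with ∧-true {suc k ≤ᵇ n} e₁
  ...   | _ , e₂ with ∧-true {col (σ q) (suc k) ≤ᵇ c} e₂
  ...     | b , d = ≤ᵇ-true a , ≤ᵇ-true b , λ l → hi l (≤ᵇ-true {c} d)
    where
      hi : W n q ≤ k → c ≤ (if suc k ≡ᵇ W n q then n else col (σ q) k) → c ≤ col (σ q) k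
      hi l h rewrite ≡ᵇ-no {suc k} {W n q} (>⇒≢ (s≤s l)) = h

  inPipe-true : ∀ {q k d} → 1 ≤ q → q ≤ n → k < n → d < n → On W k d (W n q) → inPipe n (σ q) (suc k) (suc d) ≡ true
  inPipe-true {q} {k} {d} p p′ l m (inj₁ h) = inPipe-intro p p′ e≤ l m (≤-reflexive (col-uniq p p′ l z<s m h))
      (λ g → subst (_≤ col (σ q) k) (col-uniq p p′ l z<s m h) (col-mono₁ p p′ g l))
    where e≤ = label-≤ l (F q p p′) z<s m h
  inPipe-true {q} {k} {d} p p′ l m (inj₂ h) with carrier-from l (F q p p′) (<⇒≤ m) h
  ... | (c , r , s , w) , away = inPipe-intro p p′ (label-≤ l (F q p p′) r (≤-trans s (<⇒≤ m)) w) l m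
      (subst (_≤ suc d) (sym (col-uniq p p′ l r (≤-trans s (<⇒≤ m)) w)) (m≤n⇒m≤1+n s))
      (λ g → away _ (proj₁ (col-range q k p p′ g (<⇒≤ l))) (proj₂ (col-range q k p p′ g (<⇒≤ l))) (col≡ q k p p′ g (<⇒≤ l)))

  inPipe-from : ∀ {q k d} → 1 ≤ q → q ≤ n → k < n → d < n → inPipe n (σ q) (suc k) (suc d) ≡ true → On W k d (W n q)
  inPipe-from {q} {k} {d} p p′ l m e with inPipe-elim {q} {k} {suc d} p p′ e
  ... | a , b , f with col (σ q) (suc k) ≟ suc d
  ...   | yes h = inj₁ (trans (cong (W (suc k)) (sym h)) (col≡ q (suc k) p p′ a l))
  ...   | no h = inj₂ (carrier-at l (F q p p′) (proj₁ (col-range q (suc k) p p′ a l)) (≤-pred (≤∧≢⇒< b h)) (<⇒≤ m) (col≡ q (suc k) p p′ a l) away)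
    where
      away : ∀ c′ → 1 ≤ c′ → c′ ≤ n → W k c′ ≡ W n q → d < c′
      away c′ r r′ w = subst (d <_) (col-uniq p p′ (<⇒≤ l) r r′ w) (f (label-≤ (<⇒≤ l) (F q p p′) r r′ w))

  blankAt-true : ∀ {k d} → k < n → d < n → tileIn W k (suc d) ≡ blank → blankAt n σ (suc k) (suc d) ≡ true
  blankAt-true {k} {d} l m t = null-true _ 1 n λ q p p′ → ≢true⇒false λ e → case inPipe-from p p′ l m e of λ where
      (inj₁ h) → F q p p′ (trans (sym h) (proj₂ (blank-NS (BPD.row B k l) z<s m t)))
      (inj₂ h) → F q p p′ (trans (sym h) (blank-W (BPD.row B k l) m t))

  blankAt-false : ∀ {k d} → k < n → d < n → tileIn W k (suc d) ≢ blank → blankAt n σ (suc k) (suc d) ≡ false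
  blankAt-false {k} {d} l m t with cell-SW (Row.cell (BPD.row B k l) d m) t
  ... | inj₁ nz with label-∃ ≤-refl nz (≤-trans (label-≤ l nz z<s m refl) l)
  ...   | q , p , p′ , h = null-false _ 1 n q p p′ (inPipe-true p p′ l m (inj₁ (sym h)))
  blankAt-false {k} {d} l m t | inj₂ nz with carrier-from l nz (<⇒≤ m) refl
  ... | (c , r , s , w) , _ with label-∃ ≤-refl nz (≤-trans (label-≤ l nz r (≤-trans s (<⇒≤ m)) w) l)
  ...   | q , p , p′ , h = null-false _ 1 n q p p′ (inPipe-true p p′ l m (inj₂ (sym h)))

  -- With nothing arriving from the west, a single pipe passes through the cell, so taking the head
  -- of the list of occupants involves no choice.
  head-occ : ∀ {k d q} → k < n → d < n → 1 ≤ q → q ≤ n → W (suc k) (suc d) ≡ W n q → carrier (W k) (W (suc k)) d ≡ 0 →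
    headD 0 (occ n σ (suc k) (suc d)) ≡ q
  head-occ {k} {d} {q} l m p p′ h z = firstWith-≡ _ 1 n q p p′ (inPipe-true p p′ l m (inj₁ h)) λ j r s → ≢true⇒false λ e →
    case inPipe-from r (≤-trans (<⇒≤ s) p′) l m e of λ where
      (inj₁ g) → <⇒≢ s (label-uniq ≤-refl (F q p p′) r (≤-trans (<⇒≤ s) p′) p p′ (trans (sym g) h) refl)
      (inj₂ g) → F j r (≤-trans (<⇒≤ s) p′) (trans (sym g) z)

  rightEnd-≡ : ∀ f {k y Y} → k < n → y ≤ Y → Y < n → Y ≤ y + f → (∀ c → y < c → c ≤ Y → tileIn W k c ≡ blank) →
    tileIn W k (suc Y) ≢ blank → rightEnd n σ f (suc k) y ≡ Y
  rightEnd-≡ zero {y = y} l p q r h nb = ≤-antisym p (subst (_ ≤_) (+-identityʳ y) r)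
  rightEnd-≡ (suc f) {k} {y} {Y} l p q r h nb with y ≟ Y
  ... | yes refl = if-no (∧-noʳ {suc y ≤ᵇ n} (blankAt-false l q nb))
  ... | no d = trans (if-yes (∧-yes (≤ᵇ-yes (≤-trans (≤∧≢⇒< p d) (<⇒≤ q))) (blankAt-true l (≤-<-trans p q) (h (suc y) ≤-refl (≤∧≢⇒< p d)))))
      (rightEnd-≡ f l (≤∧≢⇒< p d) q (subst (Y ≤_) (+-suc y f) r) (λ c a → h c (<⇒≤ a)) nb)

droopPipe : ℕ → Pipe → ℕ → List ℕ → Pipe
droopPipe n Q y []      = Q
droopPipe n Q y (z ∷ _) = setCol Q z (firstWith (λ k → (col Q k <ᵇ y) ∧ (col Q (pred k) ≡ᵇ y)) (fromTo (suc z) n)) (suc y)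

droops-≡ : ∀ n σ x X y e₁ e₂ q → q ≢ e₁ → q ≢ e₂ → droops n σ x X y e₁ e₂ q ≡
  droopPipe n (σ q) y (filterᵇ (λ z → inPipe n (σ q) z y ∧ rAt (σ q) z y ∧ inPipe n (σ q) z (suc y)) (fromTo (suc x) (pred X)))
droops-≡ n σ x X y e₁ e₂ q d₁ d₂ rewrite ≡ᵇ-no d₁ | ≡ᵇ-no d₂
  with filterᵇ (λ z → inPipe n (σ q) z y ∧ rAt (σ q) z y ∧ inPipe n (σ q) z (suc y)) (fromTo (suc x) (pred X))
... | []    = refl
... | _ ∷ _ = refl

module Droop {n W σ} (B : BPD n W) (F : Saturated n W) (R : Rep n σ W) {x X y e₁ e₂ q}
             (1≤q : 1 ≤ q) (q≤n : q ≤ n) (d₁ : q ≢ e₁) (d₂ : q ≢ e₂) (y<n : y < n) (x<X : x < X) (X≤n : X ≤ n)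
             (free : W x y ≢ W n q) (free′ : W X y ≢ W n q) where
  open Reading B F R
  open Rep R

  private
    Q = σ q
    Q′ = droops n σ x X y e₁ e₂ q
    e = W n q
    C = col Q

    Turn : ℕ → Bool
    Turn z = inPipe n Q z y ∧ rAt Q z y ∧ inPipe n Q z (suc y)

    at : ∀ {k} → e ≤ k → k ≤ n → C k ≡ y → W k y ≡ e
    at {k} l m h = trans (cong (W k) (sym h)) (col≡ q k 1≤q q≤n l m)

    turn-true : ∀ {k} → suc k ≤ n → e ≤ suc k → C (suc k) ≡ y → (e ≤ k → C k ≢ y) → Turn (suc k) ≡ true
    turn-true {k} m l h h′ = ∧-yes (inPipe-intro 1≤q q≤n l m (<⇒≤ y<n) (≤-reflexive h) (λ g → subst (_≤ C k) h (col-mono₁ 1≤q q≤n g m)))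
        (∧-yes r (inPipe-intro 1≤q q≤n l m y<n (≤-trans (≤-reflexive h) (n≤1+n y))
                   (λ g → ≤∧≢⇒< (subst (_≤ C k) h (col-mono₁ 1≤q q≤n g m)) (≢-sym (h′ g)))))
      where
        r : rAt Q (suc k) y ≡ true
        r rewrite ≡ᵇ-yes {y} (sym h) | ex≡ q 1≤q q≤n with e ≤? k
        ... | yes g rewrite <ᵇ-yes {e} {suc k} (s≤s g) | ≡ᵇ-no (h′ g) = refl
        ... | no g rewrite <ᵇ-no {e} {suc k} (≰⇒> g) = refl

    turn-from : ∀ {k} → Turn (suc k) ≡ true → e ≤ suc k × C (suc k) ≡ y × (e ≤ k → C k ≢ y)
    turn-from {k} t with ∧-true {inPipe n Q (suc k) y} t
    ... | a , t′ with ∧-true {rAt Q (suc k) y} t′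
    ...   | r , _ with ∧-true {y ≡ᵇ C (suc k)} r
    ...     | h , h′ = proj₁ (inPipe-elim {q} {k} {y} 1≤q q≤n a) , sym (≡ᵇ-true {y} h) , go h′
      where
        go : not ((ex Q <ᵇ suc k) ∧ (C k ≡ᵇ y)) ≡ true → e ≤ k → C k ≢ y
        go s l g rewrite ex≡ q 1≤q q≤n | <ᵇ-yes {e} {suc k} (s≤s l) | ≡ᵇ-yes g with () ← s

    none-in : (∀ j → suc x ≤ j → j ≤ pred X → Turn j ≡ false) → ∀ k → e ≤ k → x ≤ k → k < X → C k ≢ y
    none-in h k l m r g with x ≟ k
    ... | yes refl = free (at l (≤-trans (<⇒≤ r) X≤n) g)
    none-in h zero l m r g | no d = d (n≤0⇒n≡0 m)
    none-in h (suc k) l m r g | no d =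
      true≢false (turn-true (≤-trans (<⇒≤ r) X≤n) l g (λ l′ → none-in h k l′ (≤-pred (≤∧≢⇒< m d)) (<⇒≤ r))) (h (suc k) (≤∧≢⇒< m d) (≤-pred-X r))
      where ≤-pred-X : ∀ {j X} → j < X → j ≤ pred X
            ≤-pred-X (s≤s p) = p

    bottom : ∀ j z → j + z ≡ X → e ≤ z → C z ≡ y → ∃[ z′ ] z < z′ × z′ ≤ X × (∀ k → z ≤ k → k < z′ → C k ≡ y) × C z′ ≢ y
    bottom zero z refl l g = ⊥-elim (free′ (at l X≤n g))
    bottom (suc j) z s l g with C (suc z) ≟ y
    ... | no d = suc z , ≤-refl , subst (suc z ≤_) s (s≤s (m≤n+m z j))
               , (λ k p r → subst (λ t → C t ≡ y) (≤-antisym p (≤-pred r)) g) , d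
    ... | yes g′ with bottom j (suc z) (trans (+-suc j z) s) (m≤n⇒m≤1+n l) g′
    ...   | z′ , p , r , h , d = z′ , <⇒≤ p , r , h′ , d
      where h′ : ∀ k → z ≤ k → k < z′ → C k ≡ y
            h′ k a b with z ≟ k
            ... | yes refl = g
            ... | no c = h k (≤∧≢⇒< a c) b

    Spec : Pipe → Set
    Spec P = ex P ≡ ex Q × (∀ k → e ≤ k → x ≤ k → k < X → C k ≡ y → col P k ≡ suc y)
           × (∀ k → e ≤ k → k ≤ n → ¬ (x ≤ k × k < X × C k ≡ y) → col P k ≡ C k)

    First : ℕ → Bool
    First k = (C k <ᵇ y) ∧ (C (pred k) ≡ᵇ y)

    one : ∀ z z′ → suc x ≤ suc z → suc z < X → e ≤ suc z → C (suc z) ≡ y → (e ≤ z → C z ≢ y) →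
      suc z < suc z′ → suc z′ ≤ X → (∀ k → suc z ≤ k → k < suc z′ → C k ≡ y) → C (suc z′) ≢ y →
      Spec (setCol Q (suc z) (firstWith First (fromTo (suc (suc z)) n)) (suc y))
    one z z′ x<z z<X l g above p r h d = subst (λ f → Spec (setCol Q (suc z) f (suc y))) (sym first) (refl , inside , outside)
      where
        below : C (suc z′) < y
        below = ≤∧≢⇒< (subst (C (suc z′) ≤_) (h z′ (≤-pred p) ≤-refl)
                  (col-mono₁ 1≤q q≤n (≤-trans l (≤-pred p)) (≤-trans r X≤n))) d
        first : firstWith First (fromTo (suc (suc z)) n) ≡ suc z′
        first = firstWith-≡ First (suc (suc z)) n (suc z′) p (≤-trans r X≤n)
              (∧-yes (<ᵇ-yes below) (≡ᵇ-yes (h z′ (≤-pred p) ≤-refl)))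
              (λ j a b → ≢true⇒false λ c → <⇒≢ (<ᵇ-true (proj₁ (∧-true {C j <ᵇ y} c))) (h j (<⇒≤ a) b))
        P = setCol Q (suc z) (suc z′) (suc y)
        inside : ∀ k → e ≤ k → x ≤ k → k < X → C k ≡ y → col P k ≡ suc y
        inside k a b c w = setCol-in Q lo hi
          where
            lo : suc z ≤ k
            lo with suc z ≤? k
            ... | yes s = s
            ... | no s = ⊥-elim (above (≤-trans a k≤z) (≤-antisym (subst (C z ≤_) w (col-mono z 1≤q q≤n a k≤z (<⇒≤ (≤-trans (<⇒≤ z<X) X≤n))))
                                  (subst (_≤ C z) g (col-mono₁ 1≤q q≤n (≤-trans a k≤z) (≤-trans (<⇒≤ z<X) X≤n)))))
              where k≤z = ≤-pred (≰⇒> s)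
            hi : k < suc z′
            hi with suc k ≤? suc z′
            ... | yes s = s
            ... | no s = ⊥-elim (<⇒≱ below (subst (_≤ C (suc z′)) w
                           (col-mono k 1≤q q≤n (≤-trans l (<⇒≤ p)) (≤-pred (≰⇒> s)) (≤-trans (<⇒≤ c) X≤n))))
        outside : ∀ k → e ≤ k → k ≤ n → ¬ (x ≤ k × k < X × C k ≡ y) → col P k ≡ C k
        outside k a b c = setCol-out Q λ (s , s′) → c (≤-trans (<⇒≤ x<z) s , <-≤-trans s′ r , h k s s′)

    turned : ∀ z → suc x ≤ z → z < X → Turn z ≡ true → Spec (setCol Q z (firstWith First (fromTo (suc z) n)) (suc y))
    turned (suc z) x<z z<X t with turn-from t
    ... | l , g , above with bottom (X ∸ suc z) (suc z) (m∸n+n≡m (<⇒≤ z<X)) l g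
    ...   | zero , () , _
    ...   | suc z′ , p , r , h , d = one z z′ x<z z<X l g above p r h d

  -- Columns weakly decrease downwards, so `q` stays in column `y` during one interval of rows. By
  -- `free` and `free′` it avoids that column in rows `x` and `X`; an interval meeting the rows
  -- between them thus lies strictly inside, begins at an r-tile and ends at a j-tile. Hence the
  -- single droop at the first turn found moves the whole stay.
  droop-spec : Spec Q′
  droop-spec rewrite droops-≡ n σ x X y e₁ e₂ q d₁ d₂
    with filterᵇ Turn (fromTo (suc x) (pred X)) | search Turn (suc x) (pred X)
  ... | []    | none h = refl , (λ k a b c w → ⊥-elim (none-in h k a b c w)) , λ _ _ _ _ → refl
  ... | z ∷ _ | found p r t _ = turned z p (up X x<X r) t
    where up : ∀ X → x < X → z ≤ pred X → z < X
          up (suc X) _ s = s≤s s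

-- The loop of ∇

-- These functions restate the local definitions of `nablaLoop`, so that a single round can be
-- described by an equation.
moveConf : ℕ → Conf → ℕ → ℕ → ℕ → ℕ → Conf
moveConf n σ x X y p q = if q ≡ᵇ p then setCol (σ p) x X y else droops n σ x X y p p q

moveRow : ℕ → Conf → ℕ → ℕ → ℕ → ℕ
moveRow n σ x y p = firstWith (λ k → (col (σ p) k ≤ᵇ y) ∧ (col (σ p) (pred k) ≡ᵇ suc y)) (fromTo (suc x) n)

finalRow : ℕ → Conf → ℕ → ℕ
finalRow n σ y = firstWith (λ k → col (σ y) k ≡ᵇ y) (fromTo (ex (σ y)) n)

finalConf : ℕ → Conf → ℕ → ℕ → ℕ → Conf
finalConf n σ x X y q =
  if q ≡ᵇ y then setCol (mkPipe (ex (σ (suc y))) (λ k → if X ≤ᵇ k then col (σ y) k else col (σ (suc y)) k)) x X y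
  else (if q ≡ᵇ suc y then mkPipe (ex (σ y)) (λ k → if X ≤ᵇ k then col (σ (suc y)) k else col (σ y) k)
        else droops n σ x X y y (suc y) q)

loop-move : ∀ {n r f x y₀ σ y p X} → rightEnd n σ n x y₀ ≡ y → headD 0 (occ n σ x (suc y)) ≡ p → p ≢ suc y → moveRow n σ x y p ≡ X →
  nablaLoop n r (suc f) x y₀ σ ≡ nablaLoop n r f X (suc y) (moveConf n σ x X y p)
loop-move {p = p} refl refl d refl rewrite ≡ᵇ-no d = refl

loop-final : ∀ {n r f x y₀ σ y X} → rightEnd n σ n x y₀ ≡ y → headD 0 (occ n σ x (suc y)) ≡ suc y → finalRow n σ y ≡ X →
  nablaLoop n r (suc f) x y₀ σ ≡ just ((y , r) , finalConf n σ x X y)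
loop-final {n} {σ = σ} refl h refl rewrite ≡ᵇ-yes h = refl

module MoveRep {n W σ} (B : BPD n W) (F : Saturated n W) (R : Rep n σ W) {x X y p : ℕ} (1≤y : 1 ≤ y) (y<n : y < n)
               (x<X : x < X) (X≤n : X ≤ n) (1≤p : 1 ≤ p) (p≤n : p ≤ n) (empty : W x y ≡ 0)
               (pipe : ∀ k → x ≤ k → k < X → W k (suc y) ≡ W n p) (below : W X y ≡ 0 ⊎ W X y ≡ W n p)
               {W′ : Rows} (out : ∀ k → k ≤ n → ¬ (x ≤ k × k < X) → ∀ c → W′ k c ≡ W k c)
               (ins : ∀ k → x ≤ k → k < X → ∀ c → W′ k c ≡ W k (swap y c)) where
  open Reading B F R
  open Labels B
  open Rep R

  private
    bot : ∀ q → W′ n q ≡ W n q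
    bot = out n ≤-refl λ (_ , s) → <⇒≱ s X≤n

    module D {q} (1≤q : 1 ≤ q) (q≤n : q ≤ n) (d : q ≢ p) where
      free′ : W X y ≢ W n q
      free′ h = case below of λ where
        (inj₁ z) → F q 1≤q q≤n (trans (sym h) z)
        (inj₂ z) → d (label-uniq ≤-refl (F q 1≤q q≤n) 1≤q q≤n 1≤p p≤n refl (trans (sym z) h))
      spec = Droop.droop-spec B F R {e₁ = p} {e₂ = p} 1≤q q≤n d d y<n x<X X≤n (λ h → F q 1≤q q≤n (trans (sym h) empty)) free′

    Good : ℕ → Pipe → Set
    Good q P = ex P ≡ W n q × (∀ k → W n q ≤ k → k ≤ n → (1 ≤ col P k × col P k ≤ n) × W′ k (col P k) ≡ W n q)

    goodAt : ∀ {P k c e} → col P k ≡ c → 1 ≤ c × c ≤ n → W′ k c ≡ e → (1 ≤ col P k × col P k ≤ n) × W′ k (col P k) ≡ e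
    goodAt refl a h = a , h

    good-p : Good p (setCol (σ p) x X y)
    good-p = ex≡ p 1≤p p≤n , go
      where
        go : ∀ k → W n p ≤ k → k ≤ n → (1 ≤ col (setCol (σ p) x X y) k × col (setCol (σ p) x X y) k ≤ n) × W′ k (col (setCol (σ p) x X y) k) ≡ W n p
        go k l m with x ≤? k | suc k ≤? X
        ... | yes a | yes b rewrite setCol-in (σ p) {v = y} a b = (1≤y , <⇒≤ y<n) , trans (ins k a b y) (trans (at-l (W k) y) (pipe k a b))
        ... | no a | _ rewrite setCol-out (σ p) {x} {X} {y} {k} (λ (s , _) → a s) = col-range p k 1≤p p≤n l m , trans (out k m (λ (s , _) → a s) _) (col≡ p k 1≤p p≤n l m)
        ... | yes _ | no a rewrite setCol-out (σ p) {x} {X} {y} {k} (λ (_ , s) → a s) = col-range p k 1≤p p≤n l m , trans (out k m (λ (_ , s) → a s) _) (col≡ p k 1≤p p≤n l m)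

    good-q : ∀ {q} → 1 ≤ q → q ≤ n → q ≢ p → Good q (droops n σ x X y p p q)
    good-q {q} 1≤q q≤n d = trans (proj₁ spec) (ex≡ q 1≤q q≤n) , go
      where
        open D 1≤q q≤n d
        Q′ = droops n σ x X y p p q
        keep : ∀ {k} → W n q ≤ k → k ≤ n → ¬ (x ≤ k × k < X × col (σ q) k ≡ y) → W′ k (col (σ q) k) ≡ W n q →
               (1 ≤ col Q′ k × col Q′ k ≤ n) × W′ k (col Q′ k) ≡ W n q
        keep {k} l m h e = goodAt {Q′} (proj₂ (proj₂ spec) k l m h) (col-range q k 1≤q q≤n l m) e
        go : ∀ k → W n q ≤ k → k ≤ n → (1 ≤ col Q′ k × col Q′ k ≤ n) × W′ k (col Q′ k) ≡ W n q
        go k l m with x ≤? k | suc k ≤? X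
        ... | no a | _ = keep l m (λ (s , _) → a s) (trans (out k m (λ (s , _) → a s) _) (col≡ q k 1≤q q≤n l m))
        ... | yes _ | no a = keep l m (λ (_ , s , _) → a s) (trans (out k m (λ (_ , s) → a s) _) (col≡ q k 1≤q q≤n l m))
        ... | yes a | yes b with col (σ q) k ≟ y
        ...   | yes h = goodAt {Q′} (proj₁ (proj₂ spec) k l a b h) (z<s , y<n) (trans (ins k a b (suc y)) (trans (at-r (W k) y) (trans (cong (W k) (sym h)) (col≡ q k 1≤q q≤n l m))))
        ...   | no h = keep l m (λ (_ , _ , s) → h s) (trans (ins k a b _) (trans (cong (W k) (swap-o h h′)) (col≡ q k 1≤q q≤n l m)))
          where h′ : col (σ q) k ≢ suc y
                h′ g = d (label-uniq ≤-refl (F q 1≤q q≤n) 1≤q q≤n 1≤p p≤n refl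
                         (trans (sym (pipe k a b)) (trans (cong (W k) (sym g)) (col≡ q k 1≤q q≤n l m))))

    good : ∀ q → 1 ≤ q → q ≤ n → Good q (moveConf n σ x X y p q)
    good q 1≤q q≤n with q ≟ p
    ... | yes refl = subst (Good q) (sym (if-yes (≡ᵇ-yes {q} refl))) good-p
    ... | no d = subst (Good q) (sym (if-no (≡ᵇ-no d))) (good-q 1≤q q≤n d)

  -- In the rows from `x` up to but excluding `X`, pipe `p` owns column `y + 1` and is undrooped to
  -- column `y`, while any other pipe found in column `y` is drooped to column `y + 1`. Together
  -- this is the exchange of the two columns.
  rep : Rep n (moveConf n σ x X y p) W′
  rep = record
    { ex≡ = λ q a b → trans (proj₁ (good q a b)) (sym (bot q))
    ; col≡ = λ q k a b l m → trans (proj₂ (proj₂ (good q a b) k (subst (_≤ k) (bot q) l) m)) (sym (bot q))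
    ; col-range = λ q k a b l m → proj₁ (proj₂ (good q a b) k (subst (_≤ k) (bot q) l) m) }

module FinalRep {n W σ} (B : BPD n W) (F : Saturated n W) (R : Rep n σ W) {x y : ℕ} (1≤y : 1 ≤ y) (y<n : y < n)
                (x≤n : x ≤ n) (empty : W x y ≡ 0) (pipe : ∀ k → x ≤ k → k ≤ n → W k (suc y) ≡ W n (suc y))
                {W′ : Rows} (out : ∀ k → k < x → ∀ c → W′ k c ≡ W k c)
                (ins : ∀ k → x ≤ k → k ≤ n → ∀ c → W′ k c ≡ W k (swap y c))
                {X : ℕ} (ey≤X : W n y ≤ X) (X≤n : X ≤ n) (colX : col (σ y) X ≡ y)
                (early : ∀ k → W n y ≤ k → k < X → col (σ y) k ≢ y) where
  open Reading B F R
  open Labels B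
  open Rep R

  private
    y≤n = <⇒≤ y<n
    ey = W n y
    late : ∀ k → X ≤ k → k ≤ n → W k y ≡ ey
    late k l m = trans (cong (W k) (sym c≡y)) (col≡ y k 1≤y y≤n (≤-trans ey≤X l) m)
      where c≡y : col (σ y) k ≡ y
            c≡y = ≤-antisym (subst (col (σ y) k ≤_) colX (col-mono k 1≤y y≤n ey≤X l m))
                            (subst (_≤ col (σ y) k) (col-bottom 1≤y y≤n) (col-mono n 1≤y y≤n (≤-trans ey≤X l) m ≤-refl))
    x<X : x < X
    x<X with suc x ≤? X
    ... | yes l = l
    ... | no l = ⊥-elim (F y 1≤y y≤n (trans (sym (late x (≤-pred (≰⇒> l)) x≤n)) empty))

    σ′ = finalConf n σ x X y

    Good : ℕ → ℕ → Pipe → Set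
    Good q e P = ex P ≡ e × (∀ k → e ≤ k → k ≤ n → (1 ≤ col P k × col P k ≤ n) × W′ k (col P k) ≡ e)

    goodAt : ∀ {P k c e} → col P k ≡ c → 1 ≤ c → c ≤ n → W′ k c ≡ e → (1 ≤ col P k × col P k ≤ n) × W′ k (col P k) ≡ e
    goodAt refl a b h = (a , b) , h

    bot : ∀ q → W′ n q ≡ W n (swap y q)
    bot = ins n x≤n ≤-refl

    A₀ = mkPipe (ex (σ (suc y))) (λ k → if X ≤ᵇ k then col (σ y) k else col (σ (suc y)) k)
    A = setCol A₀ x X y
    Bp = mkPipe (ex (σ y)) (λ k → if X ≤ᵇ k then col (σ (suc y)) k else col (σ y) k)

    good-A : Good y (W n (suc y)) A
    good-A = ex≡ (suc y) z<s y<n , go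
      where
        stay : ∀ k → x ≤ k → k ≤ n → W′ k y ≡ W n (suc y)
        stay k a m = trans (ins k a m y) (trans (at-l (W k) y) (pipe k a m))
        go : ∀ k → W n (suc y) ≤ k → k ≤ n → (1 ≤ col A k × col A k ≤ n) × W′ k (col A k) ≡ W n (suc y)
        go k l m with x ≤? k | suc k ≤? X
        ... | yes a | yes b = goodAt {A} (setCol-in A₀ a b) 1≤y y≤n (stay k a m)
        ... | yes a | no b = goodAt {A} (trans (setCol-out A₀ {x} {X} {y} (λ (_ , s) → b s)) (trans (if-yes (≤ᵇ-yes X≤k)) (col-uniq 1≤y y≤n m 1≤y y≤n (late k X≤k m)))) 1≤y y≤n (stay k a m)
          where X≤k = ≤-pred (≰⇒> b)
        ... | no a | _ = goodAt {A} (trans (setCol-out A₀ {x} {X} {y} (λ (s , _) → a s)) (if-no (≤ᵇ-no (<-trans (≰⇒> a) x<X)))) (proj₁ cr) (proj₂ cr)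
                           (trans (out k (≰⇒> a) _) (col≡ (suc y) k z<s y<n l m))
          where cr = col-range (suc y) k z<s y<n l m

    good-B : Good (suc y) ey Bp
    good-B = ex≡ y 1≤y y≤n , go
      where
        go : ∀ k → ey ≤ k → k ≤ n → (1 ≤ col Bp k × col Bp k ≤ n) × W′ k (col Bp k) ≡ ey
        go k l m with X ≤? k
        ... | yes a = goodAt {Bp} (trans (if-yes (≤ᵇ-yes a)) (col-uniq z<s y<n m z<s y<n (pipe k (≤-trans (<⇒≤ x<X) a) m))) z<s y<n
                        (trans (ins k (≤-trans (<⇒≤ x<X) a) m (suc y)) (trans (at-r (W k) y) (late k a m)))
        ... | no a = goodAt {Bp} (if-no (≤ᵇ-no (≰⇒> a))) (proj₁ cr) (proj₂ cr) val
          where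
            cr = col-range y k 1≤y y≤n l m
            val : W′ k (col (σ y) k) ≡ ey
            val with x ≤? k
            ... | no b = trans (out k (≰⇒> b) _) (col≡ y k 1≤y y≤n l m)
            ... | yes b = trans (ins k b m _) (trans (cong (W k) (swap-o (early k l (≰⇒> a)) ne)) (col≡ y k 1≤y y≤n l m))
              where ne : col (σ y) k ≢ suc y
                    ne h = 1+n≢n (label-uniq ≤-refl (F y 1≤y y≤n) z<s y<n 1≤y y≤n
                             (trans (sym (pipe k b m)) (trans (cong (W k) (sym h)) (col≡ y k 1≤y y≤n l m))) refl)

    good-q : ∀ {q} → 1 ≤ q → q ≤ n → q ≢ y → q ≢ suc y → Good q (W n q) (droops n σ x X y y (suc y) q)
    good-q {q} 1≤q q≤n d d′ = trans (proj₁ spec) (ex≡ q 1≤q q≤n) , go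
      where
        Q′ = droops n σ x X y y (suc y) q
        notY : ∀ k → X ≤ k → k ≤ n → W k y ≢ W n q
        notY k a m h = d (label-uniq ≤-refl (F q 1≤q q≤n) 1≤q q≤n 1≤y y≤n refl (trans (sym (late k a m)) h))
        spec = Droop.droop-spec B F R {e₁ = y} {e₂ = suc y} 1≤q q≤n d d′ y<n x<X X≤n (λ h → F q 1≤q q≤n (trans (sym h) empty)) (notY X ≤-refl X≤n)
        go : ∀ k → W n q ≤ k → k ≤ n → (1 ≤ col Q′ k × col Q′ k ≤ n) × W′ k (col Q′ k) ≡ W n q
        go k l m with x ≤? k
        ... | no a = goodAt {Q′} (proj₂ (proj₂ spec) k l m (λ (s , _) → a s)) (proj₁ cr) (proj₂ cr) (trans (out k (≰⇒> a) _) (col≡ q k 1≤q q≤n l m))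
          where cr = col-range q k 1≤q q≤n l m
        ... | yes a with col (σ q) k ≟ y
        ...   | no h = goodAt {Q′} (proj₂ (proj₂ spec) k l m (λ (_ , _ , s) → h s)) (proj₁ cr) (proj₂ cr)
                         (trans (ins k a m _) (trans (cong (W k) (swap-o h ne)) (col≡ q k 1≤q q≤n l m)))
          where cr = col-range q k 1≤q q≤n l m
                ne : col (σ q) k ≢ suc y
                ne g = d′ (label-uniq ≤-refl (F q 1≤q q≤n) 1≤q q≤n z<s y<n refl
                         (trans (sym (pipe k a m)) (trans (cong (W k) (sym g)) (col≡ q k 1≤q q≤n l m))))
        ...   | yes h = goodAt {Q′} (proj₁ (proj₂ spec) k l a k<X h) z<s y<n (trans (ins k a m (suc y)) (trans (at-r (W k) y) Wk))
          where Wk : W k y ≡ W n q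
                Wk = trans (cong (W k) (sym h)) (col≡ q k 1≤q q≤n l m)
                k<X : k < X
                k<X with suc k ≤? X
                ... | yes s = s
                ... | no s = ⊥-elim (notY k (≤-pred (≰⇒> s)) m Wk)

    good : ∀ q → 1 ≤ q → q ≤ n → Good q (W′ n q) (σ′ q)
    good q 1≤q q≤n with swapView y q
    ... | left = subst₂ (Good y) (sym (trans (bot y) (at-l (W n) y))) (sym (if-yes (≡ᵇ-yes {y} refl))) good-A
    ... | right = subst₂ (Good (suc y)) (sym (trans (bot (suc y)) (at-r (W n) y)))
                    (sym (trans (if-no (≡ᵇ-no {suc y} {y} 1+n≢n)) (if-yes (≡ᵇ-yes {y} refl)))) good-B
    ... | other d d′ = subst₂ (Good q) (sym (trans (bot q) (cong (W n) (swap-o d d′))))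
                         (sym (trans (if-no (≡ᵇ-no d)) (if-no (≡ᵇ-no d′)))) (good-q 1≤q q≤n d d′)

  -- Here the exchange reaches the bottom line, by which pipes are named. So each of the names `y`
  -- and `y + 1` keeps its part from row `X` down and takes over the upper part of the other pipe,
  -- which is the effect of the bump tile.
  rep : Rep n (finalConf n σ x X y) W′
  rep = record
    { ex≡ = λ q a b → proj₁ (good q a b)
    ; col≡ = λ q k a b l m → proj₂ (proj₂ (good q a b) k l m)
    ; col-range = λ q k a b l m → proj₁ (proj₂ (good q a b) k l m) }

final-row : ∀ {n W σ y} (B : BPD n W) (F : Saturated n W) (R : Rep n σ W) → 1 ≤ y → y ≤ n →
  ∃[ X ] finalRow n σ y ≡ X × W n y ≤ X × X ≤ n × col (σ y) X ≡ y × (∀ k → W n y ≤ k → k < X → col (σ y) k ≢ y)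
final-row {n} {W} {σ} {y} B F R p q
  with firstWith-spec (λ k → col (σ y) k ≡ᵇ y) (ex (σ y)) n n
         (subst (_≤ n) (sym (Rep.ex≡ R y p q)) (Labels.label-≤ B ≤-refl (F y p q) p q refl)) ≤-refl (≡ᵇ-yes (Reading.col-bottom B F R p q))
... | X , e , l , m , h , early = X , e , subst (_≤ X) (Rep.ex≡ R y p q) l , m , ≡ᵇ-true h
    , λ k a b c → true≢false (≡ᵇ-yes c) (early k (subst (_≤ k) (sym (Rep.ex≡ R y p q)) a) b)

cell-blank-E : ∀ {N E S W} → Cell blank N E S W → E ≡ 0
cell-blank-E cBlank = refl

leave-below : ∀ {t₁ a a′ b b′ g h f} → Cell t₁ a g a′ f → Cell jtile b h b′ g → Clear b a → a′ ≡ 0 ⊎ a′ ≡ b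
leave-below cHor cJ _ = inj₁ refl
leave-below cR cJ _ = inj₂ refl
leave-below (cCross l) cJ (inj₂ (s≤s m)) = ⊥-elim (<-asym l m)

row-leave-below : ∀ {n k u v y} → Row n k u v → 1 ≤ y → y < n → tile u v (suc y) ≡ jtile → Clear (u (suc y)) (u y) → v y ≡ 0 ⊎ v y ≡ u (suc y)
row-leave-below {y = suc b} R p q tj cl = leave-below (cellAt R (<⇒≤ q)) (retile tj (cellAt R q)) cl

step-cases : ∀ {u v u′ v′ y z} → Step u v u′ v′ y z → (z ≡ y × v (suc y) ≡ u (suc y)) ⊎
  (y < z × tile u v (suc y) ≡ jtile × (∀ c → suc y < c → c ≤ z → tile u v c ≡ blank) × tile u v (suc z) ≢ blank)
step-cases (pass _ e _ _) = inj₁ (refl , e)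
step-cases (move l tj i a _ _ _) = inj₂ (l , tj , i , a)

nabla-≡ : ∀ {n σ ρ y} → firstWith (λ k → any (blankAt n σ k) (fromTo 1 n)) (fromTo 1 n) ≡ suc ρ →
  lastD 0 (filterᵇ (blankAt n σ (suc ρ)) (fromTo 1 n)) ≡ y → nabla n σ ≡ nablaLoop n (suc ρ) (suc n) (suc ρ) y σ
nabla-≡ {n} {σ} h refl with filterᵇ (λ k → any (blankAt n σ k) (fromTo 1 n)) (fromTo 1 n)
... | [] with () ← h
... | _ ∷ _ with refl ← h = refl

module Loop {n V V′} (B : BPD n V) (F : Saturated n V) {ρ y} (t : Traj n V V′ ρ y) where
  open Traj t

  -- ∇ has already been carried out in the rows up to ξ.
  hyb : ℕ → Rows
  hyb ξ k c = if k ≤ᵇ ξ then V′ k c else V k c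

  private
    hyb≤ : ∀ {ξ k} → k ≤ ξ → ∀ c → hyb ξ k c ≡ V′ k c
    hyb≤ l c = if-yes (≤ᵇ-yes l)

    hyb> : ∀ {ξ k} → ξ < k → ∀ c → hyb ξ k c ≡ V k c
    hyb> l c = if-no (≤ᵇ-no l)

  -- The situation at the start of a round. Row `suc ξ` is the one row between a new and an old
  -- state; its blanks from `y₀` on are what `rightEnd` walks through, up to the column of the mark
  -- given by the trajectory.
  record Entry (ξ y₀ : ℕ) : Set where
    field
      ρ≤ξ   : ρ ≤ ξ
      ξ<n   : ξ < n
      rowξ  : Row n (suc ξ) (V′ ξ) (V (suc ξ))
      y₀≤   : y₀ ≤ y (suc ξ)
      run   : ∀ c → y₀ ≤ c → c ≤ y (suc ξ) → tile (V′ ξ) (V (suc ξ)) c ≡ blank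
      after : tile (V′ ξ) (V (suc ξ)) (suc (y (suc ξ))) ≢ blank

  Constant : ℕ → ℕ → Set
  Constant ξ k = y k ≡ y (suc ξ) × V k (suc (y (suc ξ))) ≡ V (suc ξ) (suc (y (suc ξ)))

  -- One round of the loop covers all rows in which the mark keeps its column. Either these reach
  -- the bottom, which is step (3), or they end at a row where the pipe to the right of the mark
  -- turns left, which is step (2).
  Run : ℕ → Set
  Run ξ = (∀ k → ξ < k → k ≤ n → Constant ξ k)
        ⊎ ∃[ X ] ξ < X × X < n × (∀ k → ξ < k → k ≤ X → Constant ξ k)
          × y X < y (suc X) × tileIn V X (suc (y X)) ≡ jtile × (∀ c → suc (y X) < c → c ≤ y (suc X) → tileIn V X c ≡ blank)
          × tileIn V X (suc (y (suc X))) ≢ blank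

  private
    single : ∀ {ξ k} (P : ℕ → Set) → ξ < k → k ≤ suc ξ → P (suc ξ) → P k
    single P l m p = subst P (≤-antisym l m) p

    extend : ∀ {ξ k} → y (suc (suc ξ)) ≡ y (suc ξ) → V (suc (suc ξ)) (suc (y (suc ξ))) ≡ V (suc ξ) (suc (y (suc ξ))) → ξ < k →
      (suc ξ < k → Constant (suc ξ) k) → Constant ξ k
    extend {ξ} {k} ey ev a h with suc ξ ≟ k
    ... | yes refl = refl , refl
    ... | no d with h (≤∧≢⇒< a d)
    ...   | p , q rewrite ey = p , trans q ev

    runs : ∀ j ξ → suc ξ + j ≡ n → ρ ≤ ξ → Run ξ
    runs zero ξ e l = inj₁ λ k a b → single (Constant ξ)
                                      a (subst (k ≤_) (trans (sym e) (+-identityʳ _)) b) (refl , refl)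
    runs (suc j) ξ e l with step-cases (steps (suc ξ) (s≤s l) (subst (suc ξ <_) e (m<m+n (suc ξ) z<s)))
    ... | inj₂ (p , tj , i , a) = inj₂ (suc ξ , ≤-refl , subst (suc ξ <_) e (m<m+n (suc ξ) z<s)
            , (λ k p q → single (Constant ξ) p q (refl , refl)) , p , tj , i , a)
    ... | inj₁ (ey , ev) with runs j (suc ξ) (trans (sym (+-suc (suc ξ) j)) e) (m≤n⇒m≤1+n l)
    ...   | inj₁ h = inj₁ λ k a b → extend ey ev a λ a′ → h k a′ b
    ...   | inj₂ (X , p , q , h , rest) = inj₂ (X , <⇒≤ p , q , (λ k a b → extend ey ev a λ a′ → h k a′ b) , rest)

  module At {ξ y₀ σ} (E : Entry ξ y₀) (R : Rep n σ (hyb ξ)) where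
    open Entry E
    private
      W = hyb ξ
      Y = y (suc ξ)
      rg = range (suc ξ) (s≤s ρ≤ξ) ξ<n
      1≤Y = proj₁ rg
      Y<n = proj₂ rg

    -- The mixed configuration is a reduced bumpless pipe dream as well: row `suc ξ` is valid by
    -- `rowξ`, the others are rows of `V′` or of `V`. This makes `Reading` and `Labels` applicable
    -- between two rounds.
    bpdW : BPD n W
    bpdW = record
      { top = λ c → trans (hyb≤ {ξ} z≤n c) (BPD.top bpd′ c)
      ; row = rows
      ; off = offs }
      where
        rows : ∀ k → k < n → Row n (suc k) (W k) (W (suc k))
        rows k l with <-cmp k ξ
        ... | tri< a _ _ = row-cong (agree (hyb≤ {ξ} (<⇒≤ a))) (agree (hyb≤ {ξ} a)) (BPD.row bpd′ k l)
        ... | tri≈ _ refl _ = row-cong (agree (hyb≤ {ξ} ≤-refl)) (agree (hyb> {ξ} ≤-refl)) rowξ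
        ... | tri> _ _ a = row-cong (agree (hyb> {ξ} a)) (agree (hyb> {ξ} (m<n⇒m<1+n a))) (BPD.row B k l)
        offs : ∀ k → k ≤ n → ∀ c → c ≡ 0 ⊎ n < c → W k c ≡ 0
        offs k l c o with k ≤? ξ
        ... | yes a = trans (hyb≤ {ξ} a c) (BPD.off bpd′ k l c o)
        ... | no a = trans (hyb> {ξ} (≰⇒> a) c) (BPD.off B k l c o)

    satW : Saturated n W
    satW q a b e = F q a b (trans (sym (hyb> {ξ} ξ<n q)) e)

    open Reading bpdW satW R public
    open Labels bpdW public

    tl : ∀ c → 1 ≤ c → c ≤ n → tileIn W ξ c ≡ tile (V′ ξ) (V (suc ξ)) c
    tl = tile-cong (agree (hyb≤ {ξ} ≤-refl)) (agree (hyb> {ξ} ≤-refl))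

    end : rightEnd n σ n (suc ξ) y₀ ≡ Y
    end = rightEnd-≡ n ξ<n y₀≤ Y<n (≤-trans (<⇒≤ Y<n) (m≤n+m n y₀))
      (λ c a b → trans (tl c (≤-trans z<s a) (≤-trans b (<⇒≤ Y<n))) (run c (<⇒≤ a) b))
      (λ e → after (trans (sym (tl _ z<s Y<n)) e))

    blankY : tileIn W ξ Y ≡ blank
    blankY = trans (tl Y 1≤Y (<⇒≤ Y<n)) (run Y y₀≤ ≤-refl)

    emptyY : W (suc ξ) Y ≡ 0
    emptyY = proj₂ (blank-NS (BPD.row bpdW ξ ξ<n) 1≤Y (<⇒≤ Y<n) blankY)

    carrierY : carrier (W ξ) (W (suc ξ)) Y ≡ 0
    carrierY = go Y 1≤Y (<⇒≤ Y<n) blankY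
      where go : ∀ c → 1 ≤ c → c ≤ n → tileIn W ξ c ≡ blank → carrier (W ξ) (W (suc ξ)) c ≡ 0
            go (suc c) _ l e = cell-blank-E (retile e (cellAt (BPD.row bpdW ξ ξ<n) l))

    head : ∀ {p} → 1 ≤ p → p ≤ n → W (suc ξ) (suc Y) ≡ W n p → headD 0 (occ n σ (suc ξ) (suc Y)) ≡ p
    head a b h = head-occ ξ<n Y<n a b h carrierY

    labelY : W (suc ξ) (suc Y) ≢ 0
    labelY e = proj₁ (active (suc ξ) (s≤s ρ≤ξ) ξ<n) (trans (sym (hyb> {ξ} ≤-refl _)) e)

    finish : (∀ k → ξ < k → k ≤ n → Constant ξ k) → ∀ r f →
      ∃[ σ′ ] nablaLoop n r (suc f) (suc ξ) y₀ σ ≡ just ((y n , r) , σ′) × Rep n σ′ V′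
    finish h r f with final-row bpdW satW R 1≤Y (<⇒≤ Y<n)
    ... | X , e , a , b , c , d = finalConf n σ (suc ξ) X Y , trans (loop-final {n} {r} {f} {suc ξ} {y₀} {σ} {Y} {X} end (head z<s Y<n (const (suc ξ) ≤-refl ξ<n)) e)
                                          (cong (λ z → just ((z , r) , finalConf n σ (suc ξ) X Y)) (sym (proj₁ (h n ξ<n ≤-refl))))
        , FinalRep.rep bpdW satW R 1≤Y Y<n ξ<n emptyY const
            (λ k l c → sym (hyb≤ {ξ} (≤-pred l) c))
            (λ k l m c → trans (swapped k (≤-trans (s≤s ρ≤ξ) l) m c)
                           (trans (cong (λ z → V k (swap z c)) (proj₁ (h k l m))) (sym (hyb> {ξ} l _)))) a b c d
      where
        const : ∀ k → ξ < k → k ≤ n → W k (suc Y) ≡ W n (suc Y)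
        const k l m = trans (hyb> {ξ} l _) (trans (proj₂ (h k l m)) (trans (sym (proj₂ (h n ξ<n ≤-refl))) (sym (hyb> {ξ} ξ<n _))))

    module Go {X} (ξ<X : ξ < X) (X<n : X < n) (h : ∀ k → ξ < k → k ≤ X → Constant ξ k)
              (y< : y X < y (suc X)) (tj : tileIn V X (suc (y X)) ≡ jtile)
              (inner : ∀ c → suc (y X) < c → c ≤ y (suc X) → tileIn V X c ≡ blank)
              (nb : tileIn V X (suc (y (suc X))) ≢ blank) where
      private
        yX : y X ≡ Y
        yX = proj₁ (h X ξ<X ≤-refl)
        actX : Clear (V X (suc Y)) (V X Y)
        actX = subst (λ z → Clear (V X (suc z)) (V X z)) yX (proj₂ (active X (≤-<-trans ρ≤ξ ξ<X) (<⇒≤ X<n)))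
        tjY : tileIn V X (suc Y) ≡ jtile
        tjY = subst (λ z → tileIn V X (suc z) ≡ jtile) yX tj
        lab = label-∃ ≤-refl labelY (≤-trans (label-≤ ξ<n labelY z<s Y<n refl) ξ<n)
        p = proj₁ lab
        1≤p = proj₁ (proj₂ lab)
        p≤n = proj₁ (proj₂ (proj₂ lab))
        Wp : W n p ≡ W (suc ξ) (suc Y)
        Wp = proj₂ (proj₂ (proj₂ lab))
        pipe : ∀ k → ξ < k → k ≤ X → W k (suc Y) ≡ W n p
        pipe k l m = trans (hyb> {ξ} l _) (trans (proj₂ (h k l m)) (trans (sym (hyb> {ξ} ≤-refl _)) (sym Wp)))
        colp : ∀ k → ξ < k → k ≤ X → col (σ p) k ≡ suc Y
        colp k l m = col-uniq 1≤p p≤n (≤-trans m (<⇒≤ X<n)) z<s Y<n (pipe k l m)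
        e≤ : W n p ≤ X
        e≤ = label-≤ (<⇒≤ X<n) (satW p 1≤p p≤n) z<s Y<n (pipe X ξ<X ≤-refl)
        gone : W (suc X) (suc Y) ≡ 0
        gone = trans (hyb> {ξ} (m<n⇒m<1+n ξ<X) _) (proj₂ (jtile-NS (BPD.row B X X<n) z<s Y<n tjY))
        col-next : col (σ p) (suc X) ≤ Y
        col-next = ≤-pred (≤∧≢⇒< (subst (col (σ p) (suc X) ≤_) (colp X ξ<X ≤-refl) (col-mono₁ 1≤p p≤n e≤ X<n))
          (λ e → satW p 1≤p p≤n (trans (sym (Rep.col≡ R p (suc X) 1≤p p≤n (m≤n⇒m≤1+n e≤) X<n)) (trans (cong (W (suc X)) e) gone))))
        -- Having turned left in row `suc X`, the pipe stays at or left of column `Y` down to the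
        -- bottom, so it cannot be named `suc Y`.
        p≢ : p ≢ suc Y
        p≢ e = <⇒≱ (s≤s col-next) (subst (_≤ col (σ p) (suc X)) (trans (col-bottom 1≤p p≤n) e) (col-mono n 1≤p p≤n (m≤n⇒m≤1+n e≤) X<n ≤-refl))
        rowX : moveRow n σ (suc ξ) Y p ≡ suc X
        rowX = firstWith-≡ _ (suc (suc ξ)) n (suc X) (s≤s ξ<X) X<n (∧-yes (≤ᵇ-yes col-next) (≡ᵇ-yes (colp X ξ<X ≤-refl)))
          λ j a b → ≢true⇒false λ c → <⇒≱ (≤-reflexive (sym (colp j (<⇒≤ a) (≤-pred b)))) (≤ᵇ-true (proj₁ (∧-true {col (σ p) j ≤ᵇ Y} c)))
        below : W (suc X) Y ≡ 0 ⊎ W (suc X) Y ≡ W n p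
        below with row-leave-below (BPD.row B X X<n) 1≤Y Y<n tjY actX
        ... | inj₁ z = inj₁ (trans (hyb> {ξ} (m<n⇒m<1+n ξ<X) _) z)
        ... | inj₂ z = inj₂ (trans (hyb> {ξ} (m<n⇒m<1+n ξ<X) _) (trans z (trans (sym (hyb> {ξ} ξ<X _)) (pipe X ξ<X ≤-refl))))

      σ′ : Conf
      σ′ = moveConf n σ (suc ξ) (suc X) Y p

      loop≡ : ∀ r f → nablaLoop n r (suc f) (suc ξ) y₀ σ ≡ nablaLoop n r f (suc X) (suc Y) σ′
      loop≡ r f = loop-move {n} {r} {f} {suc ξ} {y₀} {σ} {Y} {p} {suc X} end (head 1≤p p≤n (sym Wp)) p≢ rowX

      rep′ : Rep n σ′ (hyb X)
      rep′ = MoveRep.rep bpdW satW R 1≤Y Y<n (s≤s ξ<X) X<n 1≤p p≤n emptyY (λ k a b → pipe k a (≤-pred b)) below out ins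
        where
          out : ∀ k → k ≤ n → ¬ (suc ξ ≤ k × k < suc X) → ∀ c → hyb X k c ≡ W k c
          out k m q c with k ≤? ξ
          ... | yes a = trans (hyb≤ {X} (≤-trans a (<⇒≤ ξ<X)) c) (sym (hyb≤ {ξ} a c))
          ... | no a = trans (hyb> {X} (≰⇒> λ b → q (≰⇒> a , s≤s b)) c) (sym (hyb> {ξ} (≰⇒> a) c))
          ins : ∀ k → suc ξ ≤ k → k < suc X → ∀ c → hyb X k c ≡ W k (swap Y c)
          ins k a b c = trans (hyb≤ {X} (≤-pred b) c) (trans (swapped k (≤-trans (s≤s ρ≤ξ) a) (≤-trans (≤-pred b) (<⇒≤ X<n)) c)
            (trans (cong (λ z → V k (swap z c)) (proj₁ (h k a (≤-pred b)))) (sym (hyb> {ξ} a _))))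

      entry′ : Entry X (suc Y)
      entry′ = record
        { ρ≤ξ = ≤-trans ρ≤ξ (<⇒≤ ξ<X) ; ξ<n = X<n
        ; rowξ = row-cong (agree eq) (agree λ _ → refl) (Changed.row (proj₁ lv))
        ; y₀≤ = Y<
        ; run = λ c a b → trans (tl′ c (≤-trans z<s a) (≤-trans b (<⇒≤ rX))) (blanks′ c a b)
        ; after = λ e → nb (trans (sym (Changed.others (proj₁ lv) _ (>⇒≢ (m<n⇒m<1+n Y<)) (>⇒≢ (s≤s Y<)))) (trans (sym (tl′ _ z<s rX)) e)) }
        where
          Y< : Y < y (suc X)
          Y< = subst (_< y (suc X)) yX y<
          rX = proj₂ (range (suc X) (s≤s (≤-trans ρ≤ξ (<⇒≤ ξ<X))) X<n)
          lv = leave-row (BPD.row B X X<n) 1≤Y Y<n tjY actX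
          eq : ∀ c → V′ X c ≡ V X (swap Y c)
          eq c = trans (swapped X (≤-<-trans ρ≤ξ ξ<X) (<⇒≤ X<n) c) (cong (λ z → V X (swap z c)) yX)
          tl′ : ∀ c → 1 ≤ c → c ≤ n → tile (V′ X) (V (suc X)) c ≡ tile (V X ∘ swap Y) (V (suc X)) c
          tl′ = tile-cong (agree eq) (agree λ _ → refl)
          blanks′ : ∀ c → suc Y ≤ c → c ≤ y (suc X) → tile (V X ∘ swap Y) (V (suc X)) c ≡ blank
          blanks′ c a b with suc Y ≟ c
          ... | yes refl = proj₁ (proj₂ lv)
          ... | no d = trans (Changed.others (proj₁ lv) c (>⇒≢ a) (≢-sym d)) (inner c (subst (λ z → suc z < c) (sym yX) (≤∧≢⇒< a d)) b)

  -- Each round that does not finish increases `ξ`, so the fuel needed is bounded by the number of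
  -- rows left.
  loop : ∀ r f ξ y₀ σ → n ≤ ξ + f → Entry ξ y₀ → Rep n σ (hyb ξ) →
    ∃[ σ′ ] nablaLoop n r f (suc ξ) y₀ σ ≡ just ((y n , r) , σ′) × Rep n σ′ V′
  loop r zero ξ y₀ σ l E R = ⊥-elim (<⇒≱ (Entry.ξ<n E) (subst (n ≤_) (+-identityʳ ξ) l))
  loop r (suc f) ξ y₀ σ l E R with runs (n ∸ suc ξ) ξ (m+[n∸m]≡n (Entry.ξ<n E)) (Entry.ρ≤ξ E)
  ... | inj₁ h = At.finish E R h r f
  ... | inj₂ (X , a , b , h , c , d , e , g) with loop r f X (suc (y (suc ξ))) (At.Go.σ′ E R a b h c d e g)
            (≤-trans (subst (n ≤_) (+-suc ξ f) l) (+-monoˡ-≤ f a)) (At.Go.entry′ E R a b h c d e g) (At.Go.rep′ E R a b h c d e g)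
  ...   | σ′ , q , R′ = σ′ , trans (At.Go.loop≡ E R a b h c d e g r f) q , R′

  nabla-correct : ∀ {σ} → Rep n σ V → ∃[ σ′ ] nabla n σ ≡ just ((y n , suc ρ) , σ′) × Rep n σ′ V′
  nabla-correct {σ} R with loop (suc ρ) (suc n) ρ (y (suc ρ)) σ (≤-trans (n≤1+n n) (m≤n+m (suc n) ρ)) entry₀ R₀
    where
      rg = range (suc ρ) ≤-refl ρ<n
      tl : ∀ c → 1 ≤ c → c ≤ n → tile (V′ ρ) (V (suc ρ)) c ≡ tileIn V ρ c
      tl = tile-cong (agree (same ρ ≤-refl)) (agree λ _ → refl)
      entry₀ : Entry ρ (y (suc ρ))
      entry₀ = record
        { ρ≤ξ = ≤-refl ; ξ<n = ρ<n ; rowξ = row-cong (agree (same ρ ≤-refl)) (agree λ _ → refl) (BPD.row B ρ ρ<n)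
        ; y₀≤ = ≤-refl
        ; run = λ c a b → trans (tl c (≤-trans (proj₁ rg) a) (≤-trans b (<⇒≤ (proj₂ rg)))) (subst (λ c → tileIn V ρ c ≡ blank) (≤-antisym a b) start)
        ; after = λ e → startʳ _ ≤-refl (proj₂ rg) (trans (sym (tl _ z<s (proj₂ rg))) e) }
      h≡ : ∀ k c → hyb ρ k c ≡ V k c
      h≡ k c with k ≤? ρ
      ... | yes a = trans (hyb≤ {ρ} a c) (same k a c)
      ... | no a = hyb> {ρ} (≰⇒> a) c
      R₀ : Rep n σ (hyb ρ)
      R₀ = record
        { ex≡ = λ q a b → trans (Rep.ex≡ R q a b) (sym (h≡ n q))
        ; col≡ = λ q k a b l m → trans (h≡ k _) (trans (Rep.col≡ R q k a b (subst (_≤ k) (h≡ n q) l) m) (sym (h≡ n q)))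
        ; col-range = λ q k a b l m → Rep.col-range R q k a b (subst (_≤ k) (h≡ n q) l) m }
  ... | σ′ , q , R′ = σ′ , trans (nabla-≡ {n} {σ} {ρ} {y (suc ρ)} first last) q , R′
    where
      open Reading B F R
      rg = range (suc ρ) ≤-refl ρ<n
      bt : ∀ {k} c → k < n → 1 ≤ c → c ≤ n → tileIn V k c ≡ blank → blankAt n σ (suc k) c ≡ true
      bt (suc c) l _ m = blankAt-true l m
      bf : ∀ {k} c → k < n → 1 ≤ c → c ≤ n → tileIn V k c ≢ blank → blankAt n σ (suc k) c ≡ false
      bf (suc c) l _ m = blankAt-false l m
      first : firstWith (λ k → any (blankAt n σ k) (fromTo 1 n)) (fromTo 1 n) ≡ suc ρ
      first = firstWith-≡ _ 1 n (suc ρ) z<s ρ<n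
        (any-true _ 1 n (y (suc ρ)) (proj₁ rg) (<⇒≤ (proj₂ rg)) (bt (y (suc ρ)) ρ<n (proj₁ rg) (<⇒≤ (proj₂ rg)) start))
        λ { (suc j) _ (s≤s l) → any-false (blankAt n σ (suc j)) 1 n λ c a b → bf c (<-trans l ρ<n) a b (full j l c a b) }
      last : lastD 0 (filterᵇ (blankAt n σ (suc ρ)) (fromTo 1 n)) ≡ y (suc ρ)
      last = lastD-≡ _ 1 n (y (suc ρ)) (proj₁ rg) (<⇒≤ (proj₂ rg)) (bt (y (suc ρ)) ρ<n (proj₁ rg) (<⇒≤ (proj₂ rg)) start)
        λ c a b → bf c ρ<n (≤-trans z<s a) b (startʳ c a b)

-- Tracing the pipes of a tiling

Realizes : ∀ {n} → Grid n → Rows → Set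
Realizes {n} D V = ∀ k c → k < n → c < n → tileAt D (suc k) (suc c) ≡ tileIn V k (suc c)

cell-dirS : ∀ {_≺_ t N E S W} → LCell _≺_ t N E S W → S ≢ 0 → (exitsNorth t fromS ≡ true × N ≡ S) ⊎ (exitsNorth t fromS ≡ false × E ≡ S)
cell-dirS cBlank z = ⊥-elim (z refl)
cell-dirS (cCross _) _ = inj₁ (refl , refl)
cell-dirS cHor z = ⊥-elim (z refl)
cell-dirS cVer _ = inj₁ (refl , refl)
cell-dirS cR _ = inj₂ (refl , refl)
cell-dirS cJ z = ⊥-elim (z refl)

cell-dirW : ∀ {_≺_ t N E S W} → LCell _≺_ t N E S W → W ≢ 0 → (exitsNorth t fromW ≡ true × N ≡ W) ⊎ (exitsNorth t fromW ≡ false × E ≡ W)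
cell-dirW cBlank z = ⊥-elim (z refl)
cell-dirW (cCross _) _ = inj₂ (refl , refl)
cell-dirW cHor _ = inj₂ (refl , refl)
cell-dirW cVer z = ⊥-elim (z refl)
cell-dirW cR z = ⊥-elim (z refl)
cell-dirW cJ _ = inj₁ (refl , refl)

trace-north : ∀ {n} (D : Grid n) f k c d → exitsNorth (tileAt D k c) d ≡ true →
  trace D (suc f) k c d ≡ ((k , c) ∷ proj₁ (trace D f (pred k) c fromS) , proj₂ (trace D f (pred k) c fromS))
trace-north D f k c d e rewrite e = refl

trace-exit : ∀ {n} (D : Grid n) f k c d → exitsNorth (tileAt D k c) d ≡ false → n ≤ c → trace D (suc f) k c d ≡ ((k , c) ∷ [] , k)
trace-exit D f k c d e l rewrite e | ≤ᵇ-yes l = refl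

trace-east : ∀ {n} (D : Grid n) f k c d → exitsNorth (tileAt D k c) d ≡ false → c < n →
  trace D (suc f) k c d ≡ ((k , c) ∷ proj₁ (trace D f k (suc c) fromW) , proj₂ (trace D f k (suc c) fromW))
trace-east D f k c d e l rewrite e | ≤ᵇ-no l = refl

firstCol-skip : ∀ {j k c cs} → j ≢ k → firstCol j ((k , c) ∷ cs) ≡ firstCol j cs
firstCol-skip d = if-no (≡ᵇ-no d)

firstCol-here : ∀ {k c cs} → firstCol k ((k , c) ∷ cs) ≡ c
firstCol-here {k} = if-yes (≡ᵇ-yes {k} refl)

Later : ℕ → ℕ → ℕ → ℕ → Set
Later k c j c′ = j < k ⊎ (j ≡ k × c ≤ c′)

-- The facts needed about a traced pipe: `firsts` for the initial configuration, `sound`, `complete`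
-- and `unique` for counting common cells. `Later` orders the cells along the path, which makes
-- repetitions impossible.
record Good (n : ℕ) (V : Rows) (e k c : ℕ) (res : List (ℕ × ℕ) × ℕ) : Set where
  field
    exit     : proj₂ res ≡ e
    starts   : ∃[ cs ] proj₁ res ≡ (suc k , suc c) ∷ cs
    firsts   : ∀ j → e ≤ j → j ≤ k → (1 ≤ firstCol j (proj₁ res) × firstCol j (proj₁ res) ≤ n) × V j (firstCol j (proj₁ res)) ≡ e
    sound    : ∀ {p} → p ∈ proj₁ res → ∃[ j ] ∃[ c′ ] p ≡ (suc j , suc c′) × j < n × c′ < n × On V j c′ e × Later k c j c′
    complete : ∀ j c′ → c′ < n → On V j c′ e → Later k c j c′ → (suc j , suc c′) ∈ proj₁ res
    unique   : AllPairs _≢_ (proj₁ res)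

module Trace {_≺_ : ℕ → ℕ → Set} {n V} {D : Grid n} (B : LBPD _≺_ n V) (real : Realizes D V) where
  open Labels B

  entry : Dir → ℕ → ℕ → ℕ
  entry fromS k c = V (suc k) (suc c)
  entry fromW k c = carrier (V k) (V (suc k)) c

  entry-on : ∀ d {k c e} → entry d k c ≡ e → On V k c e
  entry-on fromS h = inj₁ h
  entry-on fromW h = inj₂ h

  on-≤ : ∀ {k c e} → k < n → c < n → e ≢ 0 → On V k c e → e ≤ suc k
  on-≤ l m nz (inj₁ h) = label-≤ l nz z<s m h
  on-≤ l m nz (inj₂ h) with carrier-from l nz (<⇒≤ m) h
  ... | (c , p , q , w) , _ = label-≤ l nz p (≤-trans q (<⇒≤ m)) w

  private
    direction : ∀ d {k c e} → k < n → c < n → e ≢ 0 → entry d k c ≡ e →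
      (exitsNorth (tileAt D (suc k) (suc c)) d ≡ true × V k (suc c) ≡ e) ⊎
      (exitsNorth (tileAt D (suc k) (suc c)) d ≡ false × carrier (V k) (V (suc k)) (suc c) ≡ e)
    direction fromS {k} {c} l m nz refl rewrite real k c l m = cell-dirS (LRow.cell (LBPD.row B k l) c m) nz
    direction fromW {k} {c} l m nz refl rewrite real k c l m = cell-dirW (LRow.cell (LBPD.row B k l) c m) nz

    pair-≢ : ∀ {k c j c′} → j < k ⊎ (j ≡ k × suc c ≤ c′) → _≢_ {A = ℕ × ℕ} (suc k , suc c) (suc j , suc c′)
    pair-≢ (inj₁ l) refl = <-irrefl refl l
    pair-≢ (inj₂ (_ , l)) refl = <-irrefl refl l

  -- Induction along the pipe, with fuel for the rows above and the columns to the right. Nothing is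
  -- assumed about crossings, because the strict labelling of a given tiling is itself derived from
  -- its traces.
  good : ∀ f k c d {e} → k < n → c < n → e ≢ 0 → entry d k c ≡ e → suc k + (n ∸ suc c) ≤ f → Good n V e k c (trace D f (suc k) (suc c) d)
  good (suc f) k c d {e} k<n c<n nz h (s≤s fuel) with direction d k<n c<n nz h
  good (suc f) zero c d {e} k<n c<n nz h (s≤s fuel) | inj₁ (x , h′) = ⊥-elim (nz (trans (sym h′) (LBPD.top B _)))
  good (suc f) (suc k) c d {e} k<n c<n nz h (s≤s fuel) | inj₁ (x , h′)
    rewrite trace-north D f (suc (suc k)) (suc c) d x = record
      { exit = G.exit
      ; starts = _ , refl
      ; firsts = firsts
      ; sound = sound
      ; complete = complete
      ; unique = All.tabulate (λ m → case G.sound m of λ where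
          (j , c′ , refl , _ , _ , _ , inj₁ l) → pair-≢ (inj₁ (m<n⇒m<1+n l))
          (j , c′ , refl , _ , _ , _ , inj₂ (refl , l)) → pair-≢ (inj₁ ≤-refl)) ∷ G.unique }
    where
      cs = proj₁ (trace D f (suc k) (suc c) fromS)
      module G = Good (good f k c fromS (<⇒≤ k<n) c<n nz h′ fuel)
      firsts : ∀ j → e ≤ j → j ≤ suc k → (1 ≤ firstCol j ((suc (suc k) , suc c) ∷ cs) × firstCol j ((suc (suc k) , suc c) ∷ cs) ≤ n)
                 × V j (firstCol j ((suc (suc k) , suc c) ∷ cs)) ≡ e
      firsts j a b rewrite firstCol-skip {j} {suc (suc k)} {suc c} {cs} (<⇒≢ (s≤s b)) with j ≟ suc k
      ... | no ne = G.firsts j a (≤-pred (≤∧≢⇒< b ne))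
      ... | yes refl rewrite proj₂ G.starts | firstCol-here {suc k} {suc c} {proj₁ G.starts} = (z<s , c<n) , h′
      sound : ∀ {p} → p ∈ (suc (suc k) , suc c) ∷ cs → ∃[ j ] ∃[ c′ ] p ≡ (suc j , suc c′) × j < n × c′ < n × On V j c′ e × Later (suc k) c j c′
      sound (here refl) = _ , _ , refl , k<n , c<n , entry-on d h , inj₂ (refl , ≤-refl)
      sound (there m) with G.sound m
      ... | j , c′ , q , a , b , o , inj₁ l = j , c′ , q , a , b , o , inj₁ (m<n⇒m<1+n l)
      ... | j , c′ , q , a , b , o , inj₂ (refl , _) = j , c′ , q , a , b , o , inj₁ ≤-refl
      same-row : ∀ {c′} → c′ < n → On V k c′ e → c ≤ c′
      same-row m (inj₁ w) = ≤-reflexive (suc-injective (label-uniq (<⇒≤ k<n) nz z<s c<n z<s m h′ w))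
      same-row m (inj₂ w) with carrier-from (<⇒≤ k<n) nz (<⇒≤ m) w
      ... | (c″ , p , q , w′) , _ = <⇒≤ (subst (_≤ _) (label-uniq (<⇒≤ k<n) nz p (≤-trans q (<⇒≤ m)) z<s c<n w′ h′) q)
      this-row : ∀ {c′} → c′ < n → On V (suc k) c′ e → c′ ≤ c
      this-row m (inj₁ w) = ≤-pred (label-mono k<n nz z<s c<n z<s m h′ w)
      this-row m (inj₂ w) = ≤-pred (proj₂ (carrier-from k<n nz (<⇒≤ m) w) (suc c) z<s c<n h′)
      complete : ∀ j c′ → c′ < n → On V j c′ e → Later (suc k) c j c′ → (suc j , suc c′) ∈ (suc (suc k) , suc c) ∷ cs
      complete j c′ m o (inj₁ l) with j ≟ k
      ... | yes refl = there (G.complete j c′ m o (inj₂ (refl , same-row m o)))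
      ... | no ne = there (G.complete j c′ m o (inj₁ (≤∧≢⇒< (≤-pred l) ne)))
      complete j c′ m o (inj₂ (refl , l)) = here (cong (λ z → suc (suc k) , suc z) (≤-antisym (this-row m o) l))
  good (suc f) k c d {e} k<n c<n nz h (s≤s fuel) | inj₂ (x , h′) with suc c ≟ n
  ... | yes eq rewrite trace-exit D f (suc k) (suc c) d x (≤-reflexive (sym eq)) = record
      { exit = sym e≡
      ; starts = _ , refl
      ; firsts = λ j a b → ⊥-elim (1+n≰n (≤-trans (subst (_≤ j) e≡ a) b))
      ; sound = λ { (here refl) → _ , _ , refl , k<n , c<n , entry-on d h , inj₂ (refl , ≤-refl) }
      ; complete = complete
      ; unique = [] ∷ [] }
    where
      e≡ : e ≡ suc k
      e≡ = trans (sym h′) (trans (cong (carrier (V k) (V (suc k))) eq) (LRow.exit (LBPD.row B k k<n)))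
      complete : ∀ j c′ → c′ < n → On V j c′ e → Later k c j c′ → (suc j , suc c′) ∈ (suc k , suc c) ∷ []
      complete j c′ m o (inj₁ l) = ⊥-elim (<⇒≱ (s≤s l) (subst (_≤ suc j) e≡ (on-≤ (<-trans l k<n) m nz o)))
      complete j c′ m o (inj₂ (refl , l)) = here (cong (λ z → suc k , suc z) (≤-antisym (≤-pred (subst (suc c′ ≤_) (sym eq) m)) l))
  ... | no ne rewrite trace-east D f (suc k) (suc c) d x (≤∧≢⇒< c<n ne) = record
      { exit = G.exit
      ; starts = _ , refl
      ; firsts = firsts
      ; sound = sound
      ; complete = complete
      ; unique = All.tabulate (λ m → case G.sound m of λ where
          (j , c′ , refl , _ , _ , _ , l) → pair-≢ l) ∷ G.unique }
    where
      sc<n : suc c < n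
      sc<n = ≤∧≢⇒< c<n ne
      cs = proj₁ (trace D f (suc k) (suc (suc c)) fromW)
      fuel′ : suc k + (n ∸ suc (suc c)) ≤ f
      fuel′ = subst (_≤ f) (trans (cong (k +_) (+-∸-assoc 1 sc<n)) (+-suc k _)) fuel
      module G = Good (good f k (suc c) fromW k<n sc<n nz h′ fuel′)
      firsts : ∀ j → e ≤ j → j ≤ k → (1 ≤ firstCol j ((suc k , suc c) ∷ cs) × firstCol j ((suc k , suc c) ∷ cs) ≤ n)
                 × V j (firstCol j ((suc k , suc c) ∷ cs)) ≡ e
      firsts j a b rewrite firstCol-skip {j} {suc k} {suc c} {cs} (<⇒≢ (s≤s b)) = G.firsts j a b
      sound : ∀ {p} → p ∈ (suc k , suc c) ∷ cs → ∃[ j ] ∃[ c′ ] p ≡ (suc j , suc c′) × j < n × c′ < n × On V j c′ e × Later k c j c′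
      sound (here refl) = _ , _ , refl , k<n , c<n , entry-on d h , inj₂ (refl , ≤-refl)
      sound (there m) with G.sound m
      ... | j , c′ , q , a , b , o , inj₁ l = j , c′ , q , a , b , o , inj₁ l
      ... | j , c′ , q , a , b , o , inj₂ (r , l) = j , c′ , q , a , b , o , inj₂ (r , <⇒≤ l)
      complete : ∀ j c′ → c′ < n → On V j c′ e → Later k c j c′ → (suc j , suc c′) ∈ (suc k , suc c) ∷ cs
      complete j c′ m o (inj₁ l) = there (G.complete j c′ m o (inj₁ l))
      complete j c′ m o (inj₂ (refl , l)) with c ≟ c′
      ... | yes refl = here refl
      ... | no ne = there (G.complete j c′ m o (inj₂ (refl , ≤∧≢⇒< l ne)))

  pipe-good : ∀ {k c} → suc k ≡ n → c < n → V n (suc c) ≢ 0 → Good n V (V n (suc c)) k c (pipeTrace D (suc c))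
  pipe-good {k} {c} e l nz = subst (λ m → Good n V (V n (suc c)) k c (trace D (2 * n) m (suc c) fromS)) e
    (good (2 * n) k c fromS (≤-reflexive e) l nz (cong (λ m → V m (suc c)) e) fuel)
    where
      fuel : suc k + (n ∸ suc c) ≤ 2 * n
      fuel = +-mono-≤ (≤-reflexive e) (≤-trans (m∸n≤m n (suc c)) (≤-reflexive (sym (+-identityʳ n))))

  last-row : ∀ {q} → 1 ≤ q → q ≤ n → suc (pred n) ≡ n
  last-row p l = suc-pred n ⦃ >-nonZero (≤-trans p l) ⦄

  pipe : Saturated n V → ∀ {q} → 1 ≤ q → q ≤ n → Good n V (V n q) (pred n) (pred q) (pipeTrace D q)
  pipe F {suc c} p l = pipe-good (last-row p l) l (F (suc c) p l)

  exitRow-≡ : Saturated n V → ∀ q → 1 ≤ q → q ≤ n → exitRow D q ≡ V n q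
  exitRow-≡ F q p l = Good.exit (pipe F p l)

  initConf-rep : Saturated n V → Rep n (initConf D) V
  initConf-rep F = record
    { ex≡ = exitRow-≡ F
    ; col≡ = λ q k p l a b → proj₂ (cols q k p l a b)
    ; col-range = λ q k p l a b → proj₁ (cols q k p l a b) }
    where
      cols : ∀ q k → 1 ≤ q → q ≤ n → V n q ≤ k → k ≤ n → (1 ≤ firstCol k (pipeCells D q) × firstCol k (pipeCells D q) ≤ n)
               × V k (firstCol k (pipeCells D q)) ≡ V n q
      cols (suc c) k p l a b with k ≟ n
      ... | no ne = Good.firsts (pipe F p l) k a (≤-pred (≤-trans (≤∧≢⇒< b ne) (≤-reflexive (sym (last-row p l)))))
      ... | yes refl = (subst (1 ≤_) (sym first) p , subst (_≤ n) (sym first) l) , cong (V n) first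
        where first : firstCol k (pipeCells D (suc c)) ≡ suc c
              first = trans (cong (firstCol k) (proj₂ (Good.starts (pipe F p l))))
                        (trans (cong (λ m → firstCol k ((m , suc c) ∷ proj₁ (Good.starts (pipe F p l)))) (last-row p l)) (firstCol-here {k} {suc c} {proj₁ (Good.starts (pipe F p l))}))

-- Common cells and reducedness

sameCell-≡ : ∀ {p q} → sameCell p q ≡ true → p ≡ q
sameCell-≡ {a , b} {c , d} h with ∧-true {a ≡ᵇ c} h
... | x , y = cong₂ _,_ (≡ᵇ-true {a} x) (≡ᵇ-true {b} y)

sameCell-refl : ∀ p → sameCell p p ≡ true
sameCell-refl (a , b) = ∧-yes (≡ᵇ-yes {a} refl) (≡ᵇ-yes {b} refl)

any-∈ : ∀ {p} ys → any (sameCell p) ys ≡ true → p ∈ ys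
any-∈ {p} (y ∷ ys) h with sameCell p y in eq
... | true = here (sameCell-≡ eq)
... | false = there (any-∈ ys h)

∈-any : ∀ {p ys} → p ∈ ys → any (sameCell p) ys ≡ true
∈-any {p} (here refl) rewrite sameCell-refl p = refl
∈-any {p} {y ∷ ys} (there m) with sameCell p y
... | true = refl
... | false = ∈-any m

filter-≤1 : ∀ {A : Set} (P : A → Bool) {xs} → AllPairs _≢_ xs → (∀ {x x′} → x ∈ xs → x′ ∈ xs → P x ≡ true → P x′ ≡ true → x ≡ x′) → length (filterᵇ P xs) ≤ 1
filter-≤1 P [] h = z≤n
filter-≤1 P {x ∷ xs} (a ∷ as) h with P x in eq
... | false = filter-≤1 P as (λ p q → h (there p) (there q))
... | true = s≤s (≤-reflexive (none-left xs a (λ m → h (here refl) (there m) eq)))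
  where
    none-left : ∀ ys → All (x ≢_) ys → (∀ {y} → y ∈ ys → P y ≡ true → x ≡ y) → length (filterᵇ P ys) ≡ 0
    none-left [] _ _ = refl
    none-left (y ∷ ys) (d ∷ ds) g with P y in e
    ... | true = ⊥-elim (d (g (here refl) e))
    ... | false = none-left ys ds (λ m → g (there m))

filter-≥1 : ∀ {A : Set} (P : A → Bool) {x xs} → x ∈ xs → P x ≡ true → 1 ≤ length (filterᵇ P xs)
filter-≥1 P (here refl) e rewrite e = z<s
filter-≥1 P {xs = y ∷ _} (there m) e with P y
... | true = z<s
... | false = filter-≥1 P m e

filter-≥2 : ∀ {A : Set} (P : A → Bool) {x x′ xs} → x ≢ x′ → x ∈ xs → x′ ∈ xs → P x ≡ true → P x′ ≡ true → 2 ≤ length (filterᵇ P xs)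
filter-≥2 P d (here refl) (here refl) e e′ = ⊥-elim (d refl)
filter-≥2 P d (here refl) (there m) e e′ rewrite e = s≤s (filter-≥1 P m e′)
filter-≥2 P d (there m) (here refl) e e′ rewrite e′ = s≤s (filter-≥1 P m e)
filter-≥2 P {xs = y ∷ _} d (there m) (there m′) e e′ with P y
... | true = m≤n⇒m≤1+n (filter-≥2 P d m m′ e e′)
... | false = filter-≥2 P d m m′ e e′

positive : ℕ → Bool
positive zero    = false
positive (suc _) = true

positive-yes : ∀ {m} → m ≢ 0 → positive m ≡ true
positive-yes {zero} z = ⊥-elim (z refl)
positive-yes {suc _} _ = refl

cell-has : ∀ {_≺_ t N E S W} → LCell _≺_ t N E S W → hasN t ≡ positive N × hasE t ≡ positive E × hasS t ≡ positive S × hasW t ≡ positive W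
cell-has cBlank = refl , refl , refl , refl
cell-has (cCross _) = refl , refl , refl , refl
cell-has cHor = refl , refl , refl , refl
cell-has cVer = refl , refl , refl , refl
cell-has cR = refl , refl , refl , refl
cell-has cJ = refl , refl , refl , refl

cell-cross : ∀ {_≺_ t N E S W} → LCell _≺_ t N E S W → S ≢ 0 → W ≢ 0 → N ≡ S × E ≡ W
cell-cross cBlank z _ = ⊥-elim (z refl)
cell-cross (cCross _) _ _ = refl , refl
cell-cross cHor z _ = ⊥-elim (z refl)
cell-cross cVer _ z = ⊥-elim (z refl)
cell-cross cR _ z = ⊥-elim (z refl)
cell-cross cJ z _ = ⊥-elim (z refl)

cell-cross-< : ∀ {t N E S W} → Cell t N E S W → S ≢ 0 → W ≢ 0 → S < W
cell-cross-< cBlank z _ = ⊥-elim (z refl)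
cell-cross-< (cCross l) _ _ = s≤s l
cell-cross-< cHor z _ = ⊥-elim (z refl)
cell-cross-< cVer _ z = ⊥-elim (z refl)
cell-cross-< cR _ z = ⊥-elim (z refl)
cell-cross-< cJ z _ = ⊥-elim (z refl)

cell-strict : ∀ {_≺_ t N E S W} → LCell _≺_ t N E S W → (S ≢ 0 → W ≢ 0 → S < W) → Cell t N E S W
cell-strict cBlank _ = cBlank
cell-strict (cCross _) h = cCross (≤-pred (h (λ ()) (λ ())))
cell-strict cHor _ = cHor
cell-strict cVer _ = cVer
cell-strict cR _ = cR
cell-strict cJ _ = cJ

module _ {_≺_ : ℕ → ℕ → Set} {n V} {D : Grid n} (B : LBPD _≺_ n V) (F : Saturated n V) (real : Realizes D V) where

  private
    has : ∀ k c → k < n → c < n → let t = tileAt D (suc k) (suc c) in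
      hasN t ≡ positive (V k (suc c)) × hasE t ≡ positive (carrier (V k) (V (suc k)) (suc c))
      × hasS t ≡ positive (V (suc k) (suc c)) × hasW t ≡ positive (carrier (V k) (V (suc k)) c)
    has k c l m rewrite real k c l m = cell-has (LRow.cell (LBPD.row B k l) c m)

    east : ∀ k c → suc c ≡ n → k < n → hasE (tileAt D (suc k) (suc c)) ≡ true
    east k c e l = trans (proj₁ (proj₂ (has k c l (≤-reflexive e)))) (cong positive (trans (cong (carrier (V k) (V (suc k))) e) (LRow.exit (LBPD.row B k l))))

    south : ∀ k c → suc k ≡ n → c < n → hasS (tileAt D (suc k) (suc c)) ≡ true
    south k c e l = trans (proj₁ (proj₂ (proj₂ (has k c (≤-reflexive e) l))))
      (positive-yes (λ z → F (suc c) z<s l (trans (cong (λ m → V m (suc c)) (sym e)) z)))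

    n≡ : ∀ {k} → 1 ≤ k → k ≤ n → suc (pred n) ≡ n
    n≡ = Trace.last-row {D = D} B real

  validTiling : ValidTiling n D
  validTiling = record
    { westBoundary = λ { (suc k) _ l → proj₂ (proj₂ (proj₂ (has k 0 l (≤-trans z<s l)))) }
    ; northBoundary = λ { (suc c) _ l → trans (proj₁ (has 0 c (≤-trans z<s l) l)) (cong positive (LBPD.top B (suc c))) }
    ; eastBoundary = λ { (suc k) p l → subst (λ m → hasE (tileAt D (suc k) m) ≡ true) (n≡ p l) (east k (pred n) (n≡ p l) l) }
    ; southBoundary = λ { (suc c) p l → subst (λ m → hasS (tileAt D m (suc c)) ≡ true) (n≡ p l) (south (pred n) c (n≡ p l) l) }
    ; horizontalMatch = λ { (suc k) (suc c) _ l _ m → trans (proj₁ (proj₂ (has k c l (<⇒≤ m)))) (sym (proj₂ (proj₂ (proj₂ (has k (suc c) l m))))) }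
    ; verticalMatch = λ { (suc k) (suc c) _ l _ m → trans (proj₁ (proj₂ (proj₂ (has k c (<⇒≤ l) m)))) (sym (proj₁ (has (suc k) c l m))) } }

module Crossings {n V} (B : BPD n V) where
  open Labels B

  Crossed : ℕ → ℕ → ℕ → Set
  Crossed u w k = ∃[ a ] ∃[ b ] 1 ≤ a × a < b × b ≤ n × V k a ≡ w × V k b ≡ u

  -- To get back to the right of `u` further down, pipe `w` would have to be the vertical one at a
  -- crossing with `u`, against `u < w`. So crossed pipes stay crossed in all lower rows.
  persist₁ : ∀ {u w k} → u ≢ 0 → u < w → k < n → Crossed u w k → Crossed u w (suc k)
  persist₁ {u} {w} {k} nz l m (a , b , p , q , r , ha , hb)
    with label-down {k} {a} m (λ z → n≮0 (subst (u <_) z l)) p (≤-trans (<⇒≤ q) r) ha | label-down {k} {b} m nz (≤-trans z<s q) r hb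
  ... | a′ , p′ , q′ , ha′ | b′ , s′ , t′ , hb′ with <-cmp a′ b′
  ...   | tri< x _ _ = a′ , b′ , p′ , x , ≤-trans t′ r , ha′ , hb′
  ...   | tri≈ _ refl _ = ⊥-elim (<⇒≢ l (trans (sym hb′) ha′))
  persist₁ {u} {w} {k} nz l m (a , b , p , q , r , ha , hb) | suc d , p′ , q′ , ha′ | b′ , s′ , t′ , hb′ | tri> _ _ x =
    ⊥-elim (<-asym l (subst₂ _<_ ha′ car (cell-cross-< (Row.cell (BPD.row B k m) d d<n)
      (λ z → n≮0 (subst (u <_) (trans (sym ha′) z) l)) (λ z → nz (trans (sym car) z)))))
    where
      d<n : d < n
      d<n = ≤-trans q′ (≤-trans (<⇒≤ q) r)
      car : carrier (V k) (V (suc k)) d ≡ u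
      car = carrier-at m nz s′ (≤-pred x) (<⇒≤ d<n) hb′
        (λ c c₁ c₂ h → subst (d <_) (label-uniq (<⇒≤ m) nz (≤-trans z<s q) r c₁ c₂ hb h) (<-≤-trans q′ (<⇒≤ q)))

  persist : ∀ {u w k} → u ≢ 0 → u < w → ∀ j → k ≤ j → j ≤ n → Crossed u w k → Crossed u w j
  persist {k = zero} nz l zero p q x = x
  persist {k = k} nz l (suc j) p q x with k ≟ suc j
  ... | yes refl = x
  ... | no d = persist₁ nz l q (persist nz l j (≤-pred (≤∧≢⇒< p d)) (<⇒≤ q) x)

  common : ∀ {u w k c} → u ≢ 0 → u < w → k < n → c < n → On V k c u → On V k c w →
    V (suc k) (suc c) ≡ u × carrier (V k) (V (suc k)) c ≡ w × V k (suc c) ≡ u × carrier (V k) (V (suc k)) (suc c) ≡ w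
  common {u} {w} {k} {c} nz l p q (inj₁ a) (inj₁ b) = ⊥-elim (<⇒≢ l (trans (sym a) b))
  common {u} {w} {k} {c} nz l p q (inj₂ a) (inj₂ b) = ⊥-elim (<⇒≢ l (trans (sym a) b))
  common {u} {w} {k} {c} nz l p q (inj₂ a) (inj₁ b) = ⊥-elim (<-asym l (subst₂ _<_ b a
    (cell-cross-< (Row.cell (BPD.row B k p) c q) (λ z → n≮0 (subst (u <_) (trans (sym b) z) l)) (λ z → nz (trans (sym a) z)))))
  common {u} {w} {k} {c} nz l p q (inj₁ a) (inj₂ b)
    with cell-cross (Row.cell (BPD.row B k p) c q) (λ z → nz (trans (sym a) z)) (λ z → n≮0 (subst (u <_) (trans (sym b) z) l))
  ... | x , y = a , b , trans x a , trans y b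

  after : ∀ {u w k c} → u ≢ 0 → u < w → k < n → c < n → On V k c u → On V k c w → Crossed u w (suc k)
  after {u} {w} {k} {c} nz l p q a b with common nz l p q a b
  ... | s , e , _ with carrier-from p (λ z → n≮0 (subst (u <_) z l)) (<⇒≤ q) e
  ...   | (a′ , x , y , h) , _ = a′ , suc c , x , s≤s y , q , h , s

  -- Just above a crossing the larger label lies to the right, but by `persist` it lies to the left
  -- everywhere below an earlier one.
  once : ∀ {u w k c k′ c′} → u ≢ 0 → u < w → k < n → c < n → k′ < n → c′ < n →
    On V k c u → On V k c w → On V k′ c′ u → On V k′ c′ w → ¬ (k < k′)
  once {u} {w} nz l p q p′ q′ a b a′ b′ m with persist nz l _ m (<⇒≤ p′) (after nz l p q a b) | common nz l p′ q′ a′ b′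
  ... | x , y , r , s , t , hx , hy | _ , _ , h , e =
    <⇒≱ (subst (x <_) (label-uniq (<⇒≤ p′) nz (≤-trans z<s s) t z<s q′ hy h) s)
        (<⇒≤ (proj₂ (carrier-from p′ (λ z → n≮0 (subst (u <_) z l)) q′ e) x r (≤-trans (<⇒≤ s) t) hx))

  unique-crossing : ∀ {u w k c k′ c′} → u ≢ 0 → u < w → k < n → c < n → k′ < n → c′ < n →
    On V k c u → On V k c w → On V k′ c′ u → On V k′ c′ w → k ≡ k′ × c ≡ c′
  unique-crossing {k = k} {k′ = k′} nz l p q p′ q′ a b a′ b′ with <-cmp k k′
  ... | tri< m _ _ = ⊥-elim (once nz l p q p′ q′ a b a′ b′ m)
  ... | tri> _ _ m = ⊥-elim (once nz l p′ q′ p q a′ b′ a b m)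
  ... | tri≈ _ refl _ = refl , suc-injective (label-uniq p nz z<s q z<s q′ (proj₁ (common nz l p q a b)) (proj₁ (common nz l p′ q′ a′ b′)))

module _ {n V} {D : Grid n} (B : BPD n V) (F : Saturated n V) (real : Realizes D V) where
  open Crossings B
  private module Tr = Trace {D = D} B real

  reducedness : ∀ i j → 1 ≤ i → i < j → j ≤ n → commonCells (pipeCells D i) (pipeCells D j) ≤ 1
  reducedness i j p q r = filter-≤1 _ (Good.unique Gi) same
    where
      Gi = Tr.pipe F p (≤-trans (<⇒≤ q) r)
      Gj = Tr.pipe F (≤-trans p (<⇒≤ q)) r
      nzi = F i p (≤-trans (<⇒≤ q) r)
      nzj = F j (≤-trans p (<⇒≤ q)) r
      meet : ∀ {k c k′ c′} → k < n → c < n → k′ < n → c′ < n → On V k c (V n i) → On V k c (V n j) →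
             On V k′ c′ (V n i) → On V k′ c′ (V n j) → k ≡ k′ × c ≡ c′
      meet a b a′ b′ o s o′ s′ with <-cmp (V n i) (V n j)
      ... | tri< l _ _ = unique-crossing nzi l a b a′ b′ o s o′ s′
      ... | tri> _ _ l = unique-crossing nzj l a b a′ b′ s o s′ o′
      ... | tri≈ _ e _ = ⊥-elim (<⇒≢ q (Labels.label-uniq B ≤-refl nzi p (≤-trans (<⇒≤ q) r) (≤-trans p (<⇒≤ q)) r refl (sym e)))
      same : ∀ {x x′} → x ∈ pipeCells D i → x′ ∈ pipeCells D i → any (sameCell x) (pipeCells D j) ≡ true →
             any (sameCell x′) (pipeCells D j) ≡ true → x ≡ x′
      same {x} {x′} m m′ h h′ with Good.sound Gi m | Good.sound Gi m′ | Good.sound Gj (any-∈ {x} _ h) | Good.sound Gj (any-∈ {x′} _ h′)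
      ... | k , c , refl , a , b , o , _ | k′ , c′ , refl , a′ , b′ , o′ , _ | _ , _ , refl , _ , _ , s , _ | _ , _ , refl , _ , _ , s′ , _
        with meet a b a′ b′ o s o′ s′
      ...   | refl , refl = refl

-- If e < f are the horizontal and the vertical label of a crossing, then the two pipes
-- have met before: e starts out to the left of f, but is to its right above the crossing.
module Strict {_≺_ : ℕ → ℕ → Set} {n V} {D : Grid n} (B : LBPD _≺_ n V) (F : Saturated n V) (real : Realizes D V)
              (red : ∀ i j → 1 ≤ i → i < j → j ≤ n → commonCells (pipeCells D i) (pipeCells D j) ≤ 1) where
  open Labels B
  private module Tr = Trace {D = D} B real

  private
    Met : ℕ → ℕ → ℕ → Set
    Met e f k = ∃[ j ] ∃[ c ] j < k × c < n × On V j c e × On V j c f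

    Before : ℕ → ℕ → ℕ → Set
    Before e f k = ∃[ a ] ∃[ b ] 1 ≤ a × a < b × b ≤ n × V k a ≡ e × V k b ≡ f

    meet : ∀ {e f k a b} → k < n → f ≢ 0 → 1 ≤ b → b < a → a ≤ n → V (suc k) a ≡ e → V (suc k) b ≡ f →
      (∀ c → 1 ≤ c → c ≤ n → V k c ≡ f → a ≤ c) → Met e f (suc k)
    meet {a = suc d} l nz p q r ha hb away = _ , d , ≤-refl , r , inj₁ ha , inj₂ (carrier-at l nz p (≤-pred q) (<⇒≤ r) hb away)

    Met-up : ∀ {e f k} → Met e f k → Met e f (suc k)
    Met-up (j , c , l , r) = j , c , m<n⇒m<1+n l , r

    history : ∀ {e f} → e ≢ 0 → e < f → ∀ k → f ≤ k → k ≤ n → Met e f k ⊎ Before e f k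
    history {e} {f} nz l zero p q = ⊥-elim (n≮0 (<-≤-trans l p))
    history {e} {f} nz l (suc k) p q with f ≟ suc k
    ... | yes refl with label-∃ q nz (<⇒≤ l) | label-∃ {e = suc k} q (λ ()) ≤-refl
    ...   | a , a₁ , a₂ , ha | b , b₁ , b₂ , hb with <-cmp a b
    ...     | tri< x _ _ = inj₂ (a , b , a₁ , x , b₂ , ha , hb)
    ...     | tri≈ _ refl _ = ⊥-elim (<⇒≢ l (trans (sym ha) hb))
    -- Pipe `f` comes in from the east border in this very row and is left of `e` below it, so it
    -- has passed horizontally through the cell that `e` enters from below.
    ...     | tri> _ _ x = inj₁ (meet q (λ ()) b₁ x a₂ ha hb (λ c c₁ c₂ h → ⊥-elim (1+n≰n (label-≤ (<⇒≤ q) (λ ()) c₁ c₂ h))))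
    history {e} {f} nz l (suc k) p q | no d with history nz l k (≤-pred (≤∧≢⇒< p d)) (<⇒≤ q)
    ... | inj₁ m = inj₁ (Met-up m)
    ... | inj₂ (a , b , a₁ , x , b₂ , ha , hb)
      with label-down q nz a₁ (≤-trans (<⇒≤ x) b₂) ha | label-down {k} {b} q (λ z → n≮0 (subst (e <_) z l)) (≤-trans z<s x) b₂ hb
    ...   | a′ , p′ , q′ , ha′ | b′ , s′ , t′ , hb′ with <-cmp a′ b′
    ...     | tri< y _ _ = inj₂ (a′ , b′ , p′ , y , ≤-trans t′ b₂ , ha′ , hb′)
    ...     | tri≈ _ refl _ = ⊥-elim (<⇒≢ l (trans (sym ha′) hb′))
    ...     | tri> _ _ y = inj₁ (meet q (λ z → n≮0 (subst (e <_) z l)) s′ y (≤-trans q′ (≤-trans (<⇒≤ x) b₂)) ha′ hb′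
                (λ c c₁ c₂ h → ≤-trans q′ (≤-trans (<⇒≤ x) (≤-reflexive
                   (label-uniq (<⇒≤ q) (λ z → n≮0 (subst (e <_) z l)) (≤-trans z<s x) b₂ c₁ c₂ hb h)))))

    member : ∀ {i k c} → (p : 1 ≤ i) (l : i ≤ n) → k < n → c < n → On V k c (V n i) → (suc k , suc c) ∈ pipeCells D i
    member {suc i} {k} {c} p l k<n c<n o = Good.complete (Tr.pipe F p l) k c c<n o later
      where
        k≤ : k ≤ pred n
        k≤ = ≤-pred (≤-trans k<n (≤-reflexive (sym (Tr.last-row p l))))
        later : Later (pred n) i k c
        later with k ≟ pred n
        ... | no d = inj₁ (≤∧≢⇒< k≤ d)
        ... | yes e = inj₂ (e , low o)
          where
            sk≡n : suc k ≡ n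
            sk≡n = trans (cong suc e) (Tr.last-row p l)
            low : On V k c (V n (suc i)) → i ≤ c
            low (inj₁ h) = ≤-pred (≤-reflexive (label-uniq ≤-refl (F _ p l) p l z<s c<n refl (trans (cong (λ m → V m (suc c)) (sym sk≡n)) h)))
            low (inj₂ h) with carrier-from k<n (F _ p l) (<⇒≤ c<n) h
            ... | (c′ , x , y , w) , _ = ≤-trans (n≤1+n i) (subst (_≤ c) (sym (label-uniq ≤-refl (F _ p l) p l x (≤-trans y (<⇒≤ c<n)) refl
                       (trans (cong (λ m → V m c′) (sym sk≡n)) w))) y)

    twice : ∀ {e f k c k′ c′} → e ≢ f → e ≢ 0 → f ≢ 0 → k < n → c < n → k′ < n → c′ < n → k′ < k →
      On V k c e → On V k c f → On V k′ c′ e → On V k′ c′ f → ⊥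
    twice {e} {f} {k} {c} {k′} {c′} d nze nzf a b a′ b′ l o s o′ s′
      with label-∃ ≤-refl nze (≤-trans (Tr.on-≤ a b nze o) a) | label-∃ ≤-refl nzf (≤-trans (Tr.on-≤ a b nzf s) a)
    ... | i , i₁ , i₂ , refl | j , j₁ , j₂ , refl with <-cmp i j
    ...   | tri≈ _ refl _ = d refl
    ...   | tri< x _ _ = 1+n≰n (≤-trans (filter-≥2 (λ p → any (sameCell p) (pipeCells D j)) cells≢ (member i₁ i₂ a b o) (member i₁ i₂ a′ b′ o′)
                            (∈-any (member j₁ j₂ a b s)) (∈-any (member j₁ j₂ a′ b′ s′))) (red i j i₁ x j₂))
      where cells≢ : _≢_ {A = ℕ × ℕ} (suc k , suc c) (suc k′ , suc c′)
            cells≢ refl = <-irrefl refl l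
    ...   | tri> _ _ x = 1+n≰n (≤-trans (filter-≥2 (λ p → any (sameCell p) (pipeCells D i)) cells≢ (member j₁ j₂ a b s) (member j₁ j₂ a′ b′ s′)
                            (∈-any (member i₁ i₂ a b o)) (∈-any (member i₁ i₂ a′ b′ o′))) (red j i j₁ x i₂))
      where cells≢ : _≢_ {A = ℕ × ℕ} (suc k , suc c) (suc k′ , suc c′)
            cells≢ refl = <-irrefl refl l

    first-crossing : ∀ k c → k < n → c < n → V (suc k) (suc c) ≢ 0 → carrier (V k) (V (suc k)) c ≢ 0 →
      V (suc k) (suc c) < carrier (V k) (V (suc k)) c
    first-crossing k c a b nzf nze with cell-cross (LRow.cell (LBPD.row B k a) c b) nzf nze
    ... | N≡S , E≡W with <-cmp (V (suc k) (suc c)) (carrier (V k) (V (suc k)) c)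
    ...   | tri< l _ _ = l
    ...   | tri≈ _ q _ with carrier-from a nze (<⇒≤ b) refl
    ...     | (c′ , x , y , h) , _ = ⊥-elim (1+n≰n (subst (_≤ c) (label-uniq a nzf x (≤-trans y (<⇒≤ b)) z<s b (trans h (sym q)) refl) y))
    first-crossing k c a b nzf nze | N≡S , E≡W | tri> _ _ l with history nze l k (label-≤ (<⇒≤ a) nzf z<s b N≡S) (<⇒≤ a)
    ... | inj₁ (j , c′ , m , r , o , s) = ⊥-elim (twice (<⇒≢ l) nze nzf a b (<-trans m a) r m (inj₂ refl) (inj₁ refl) o s)
    ... | inj₂ (x , y , p , q , r , hx , hy) =
      ⊥-elim (<⇒≱ (proj₂ (carrier-from a nze b E≡W) x p (≤-trans (<⇒≤ q) r) hx)
        (subst (x ≤_) (label-uniq (<⇒≤ a) nzf (≤-trans z<s q) r z<s b hy N≡S) (<⇒≤ q)))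

  strict : BPD n V
  strict = record
    { top = LBPD.top B
    ; row = λ k l → record
        { cell = λ c m → cell-strict (LRow.cell (LBPD.row B k l) c m) (first-crossing k c l m)
        ; exit = LRow.exit (LBPD.row B k l) }
    ; off = LBPD.off B }

-- Tilings and their labels

fromFun : ∀ {A : Set} m → (ℕ → A) → Vec A m
fromFun zero    f = []
fromFun (suc m) f = f 0 ∷ fromFun m (f ∘ suc)

nth-fromFun : ∀ {A : Set} (d : A) m f k → k < m → nth d (toList (fromFun m f)) k ≡ f k
nth-fromFun d (suc m) f zero    _       = refl
nth-fromFun d (suc m) f (suc k) (s≤s l) = nth-fromFun d m (f ∘ suc) k l

nth-rows : ∀ {A : Set} {n} m (f : ℕ → Vec A n) k → k < m → nth [] (map toList (toList (fromFun m f))) k ≡ toList (f k)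
nth-rows (suc m) f zero    _       = refl
nth-rows (suc m) f (suc k) (s≤s l) = nth-rows m (f ∘ suc) k l

toGrid : ∀ n → Rows → Grid n
toGrid n V = fromFun n (λ k → fromFun n (λ c → tileIn V k (suc c)))

toGrid-realizes : ∀ n V → Realizes (toGrid n V) V
toGrid-realizes n V k c l m
  rewrite nth-rows n (λ k → fromFun n (λ c → tileIn V k (suc c))) k l = nth-fromFun blank n (λ c → tileIn V k (suc c)) c m

vec-ext : ∀ {A : Set} {d : A} {m} (xs ys : Vec A m) → (∀ k → k < m → nth d (toList xs) k ≡ nth d (toList ys) k) → xs ≡ ys
vec-ext [] [] _ = refl
vec-ext (x ∷ xs) (y ∷ ys) h = cong₂ _∷_ (h 0 z<s) (vec-ext xs ys (λ k l → h (suc k) (s≤s l)))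

rows-ext : ∀ {A : Set} {d : A} {n m} (D E : Vec (Vec A n) m) →
  (∀ k c → k < m → c < n → nth d (nth [] (map toList (toList D)) k) c ≡ nth d (nth [] (map toList (toList E)) k) c) → D ≡ E
rows-ext [] [] _ = refl
rows-ext (x ∷ D) (y ∷ E) h = cong₂ _∷_ (vec-ext x y (λ c l → h 0 c z<s l)) (rows-ext D E (λ k c l m → h (suc k) c (s≤s l) m))

grid-ext : ∀ {n V W} {D E : Grid n} → Realizes D V → Realizes E W → V ≈[ n ] W → D ≡ E
grid-ext {n} {V} {W} {D} {E} r s e = rows-ext {d = blank} D E λ k c l m → trans (r k c l m)
  (trans (sym (tile-cong (agree (e k (<⇒≤ l))) (agree (e (suc k) l)) (suc c) z<s m)) (sym (s k c l m)))

nth-long : ∀ {A : Set} {d : A} {n} (v : Vec A n) c → n ≤ c → nth d (toList v) c ≡ d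
nth-long [] c _ = refl
nth-long (x ∷ v) (suc c) (s≤s l) = nth-long v c l

rows-long : ∀ {A : Set} {d : A} {n m} (D : Vec (Vec A n) m) k c → n ≤ c → nth d (nth [] (map toList (toList D)) k) c ≡ d
rows-long [] k c l = refl
rows-long (v ∷ D) zero c l = nth-long v c l
rows-long (v ∷ D) (suc k) c l = rows-long D k c l

tileAt-off : ∀ {n} (D : Grid n) k c → c ≡ 0 ⊎ n < c → tileAt D k c ≡ blank
tileAt-off D zero c _ = refl
tileAt-off D (suc k) .0 (inj₁ refl) = refl
tileAt-off D (suc k) (suc c) (inj₂ (s≤s l)) = rows-long D k c l

-- The labels read off an arbitrary valid tiling satisfy no condition at crossings; `Strict` adds it
-- from the bound on common cells.
All≺ : ℕ → ℕ → Set
All≺ _ _ = ⊤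

-- `A` and `B` are the exit rows of the pipes going on to the north and to the east; the labels on
-- the south and west edges are obtained by following the tile to one of these.
mk-cell : ∀ t {A B} → (hasN t ≡ true → A ≢ 0) → (hasE t ≡ true → B ≢ 0) →
  LCell All≺ t (if hasN t then A else 0) (if hasE t then B else 0)
    (if hasS t then (if exitsNorth t fromS then A else B) else 0) (if hasW t then (if exitsNorth t fromW then A else B) else 0)
mk-cell blank a b = cBlank
mk-cell cross {zero} a b = ⊥-elim (a refl refl)
mk-cell cross {suc A} {zero} a b = ⊥-elim (b refl refl)
mk-cell cross {suc A} {suc B} a b = cCross tt
mk-cell hor {B = zero} a b = ⊥-elim (b refl refl)
mk-cell hor {B = suc B} a b = cHor
mk-cell ver {zero} a b = ⊥-elim (a refl refl)
mk-cell ver {suc A} a b = cVer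
mk-cell rtile {B = zero} a b = ⊥-elim (b refl refl)
mk-cell rtile {B = suc B} a b = cR
mk-cell jtile {zero} a b = ⊥-elim (a refl refl)
mk-cell jtile {suc A} a b = cJ

enters : Dir → Tile → Bool
enters fromS = hasS
enters fromW = hasW

leaves : ∀ d t → enters d t ≡ true → (exitsNorth t d ≡ true × hasN t ≡ true) ⊎ (exitsNorth t d ≡ false × hasE t ≡ true)
leaves fromS blank ()
leaves fromS cross _ = inj₁ (refl , refl)
leaves fromS hor ()
leaves fromS ver _ = inj₁ (refl , refl)
leaves fromS rtile _ = inj₂ (refl , refl)
leaves fromS jtile ()
leaves fromW blank ()
leaves fromW cross _ = inj₂ (refl , refl)
leaves fromW hor _ = inj₂ (refl , refl)
leaves fromW ver ()
leaves fromW rtile ()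
leaves fromW jtile _ = inj₁ (refl , refl)

if-cong : ∀ {A : Set} {b b′} {x x′ y : A} → b ≡ b′ → (b ≡ true → x ≡ x′) → (if b then x else y) ≡ (if b′ then x′ else y)
if-cong {b = true} refl h = h refl
if-cong {b = false} refl h = refl

bool-cases : ∀ b → b ≡ true ⊎ b ≡ false
bool-cases true  = inj₁ refl
bool-cases false = inj₂ refl

module FromGrid {n} (D : Grid n) (valid : ValidTiling n D) where
  open ValidTiling valid

  -- The fuel `k + (n ∸ c)` bounds the number of cells still to be visited and drops by one at each
  -- move, so `unfold` meets exactly the fuel of the next cell.
  exitFrom : Dir → ℕ → ℕ → ℕ
  exitFrom d k c = proj₂ (trace D (k + (n ∸ c)) k c d)

  eastExit : ℕ → ℕ → ℕ
  eastExit k c = if n ≤ᵇ c then k else exitFrom fromW k (suc c)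

  V : Rows
  V k c = if hasS (tileAt D k c) then exitFrom fromS k c else 0

  private
    H : Rows
    H k c = if hasE (tileAt D k c) then eastExit k c else 0

    unfold : ∀ d k c → c < n → exitFrom d (suc k) (suc c) ≡ (if exitsNorth (tileAt D (suc k) (suc c)) d then exitFrom fromS k (suc c) else eastExit (suc k) (suc c))
    unfold d k c l with bool-cases (exitsNorth (tileAt D (suc k) (suc c)) d)
    ... | inj₁ eq = trans (cong proj₂ (trace-north D (k + (n ∸ suc c)) (suc k) (suc c) d eq)) (sym (if-yes eq))
    ... | inj₂ eq with suc c ≟ n
    ...   | yes e = trans (cong proj₂ (trace-exit D (k + (n ∸ suc c)) (suc k) (suc c) d eq (≤-reflexive (sym e))))
                      (sym (trans (if-no eq) (if-yes (≤ᵇ-yes (≤-reflexive (sym e))))))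
    ...   | no ne = trans (cong proj₂ (trace-east D (k + (n ∸ suc c)) (suc k) (suc c) d eq (≤∧≢⇒< l ne)))
                      (trans (cong (λ f → proj₂ (trace D f (suc k) (suc (suc c)) fromW)) (trans (cong (k +_) (+-∸-assoc 1 (≤∧≢⇒< l ne))) (+-suc k _)))
                        (sym (trans (if-no eq) (if-no (≤ᵇ-no (≤∧≢⇒< l ne))))))

    north : ∀ k c → c < n → hasN (tileAt D (suc k) (suc c)) ≡ true → ∃[ k′ ] k ≡ suc k′
    north zero c l h = ⊥-elim (true≢false h (northBoundary (suc c) z<s l))
    north (suc k) c l h = k , refl

    -- The boundary and matching conditions lead every trace to the east border, so the label 0 is
    -- never given to an edge with a pipe.
    exit-≢0 : ∀ f d k c → suc k + (n ∸ suc c) ≤ f → k < n → c < n → enters d (tileAt D (suc k) (suc c)) ≡ true → exitFrom d (suc k) (suc c) ≢ 0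
    exit-≢0 (suc f) d k c (s≤s fuel) k<n c<n h z with leaves d (tileAt D (suc k) (suc c)) h
    ... | inj₁ (x , y) with north k c c<n y
    ...   | k′ , refl = exit-≢0 f fromS k′ c fuel (<⇒≤ k<n) c<n (trans (verticalMatch (suc k′) (suc c) z<s k<n z<s c<n) y)
                          (trans (sym (trans (unfold d (suc k′) c c<n) (if-yes x))) z)
    exit-≢0 (suc f) d k c (s≤s fuel) k<n c<n h z | inj₂ (x , y) with suc c ≟ n
    ...   | yes e with () ← trans (sym (trans (unfold d k c c<n) (trans (if-no x) (if-yes (≤ᵇ-yes (≤-reflexive (sym e))))))) z
    ...   | no ne = exit-≢0 f fromW k (suc c) (subst (_≤ f) (trans (cong (k +_) (+-∸-assoc 1 sc<n)) (+-suc k _)) fuel) k<n sc<n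
                      (trans (sym (horizontalMatch (suc k) (suc c) z<s k<n z<s sc<n)) y)
                      (trans (sym (trans (unfold d k c c<n) (trans (if-no x) (if-no (≤ᵇ-no sc<n))))) z)
      where sc<n = ≤∧≢⇒< c<n ne

    exit-≢0′ : ∀ d k c → k < n → c < n → enters d (tileAt D (suc k) (suc c)) ≡ true → exitFrom d (suc k) (suc c) ≢ 0
    exit-≢0′ d k c = exit-≢0 _ d k c ≤-refl

    V-north : ∀ k c → k < n → c < n → V k (suc c) ≡ (if hasN (tileAt D (suc k) (suc c)) then exitFrom fromS k (suc c) else 0)
    V-north zero c l m rewrite northBoundary (suc c) z<s m = refl
    V-north (suc k) c l m = if-cong (verticalMatch (suc k) (suc c) z<s l z<s m) (λ _ → refl)

    H-west : ∀ k c → k < n → c < n → H (suc k) c ≡ (if hasW (tileAt D (suc k) (suc c)) then exitFrom fromW (suc k) (suc c) else 0)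
    H-west k zero l m rewrite westBoundary (suc k) z<s l = refl
    H-west k (suc c) l m = if-cong (horizontalMatch (suc k) (suc c) z<s l z<s m) (λ _ → if-no (≤ᵇ-no m))

    cells : ∀ k c → k < n → c < n → LCell All≺ (tileAt D (suc k) (suc c)) (V k (suc c)) (H (suc k) (suc c)) (V (suc k) (suc c)) (H (suc k) c)
    cells k c l m = cell-subst refl (V-north k c l m) refl
      (if-cong {b = hasS (tileAt D (suc k) (suc c))} refl (λ _ → unfold fromS k c m))
      (trans (H-west k c l m) (if-cong {b = hasW (tileAt D (suc k) (suc c))} refl (λ _ → unfold fromW k c m)))
      (mk-cell (tileAt D (suc k) (suc c)) (up k l) right-≢0)
      where
        up : ∀ k → k < n → hasN (tileAt D (suc k) (suc c)) ≡ true → exitFrom fromS k (suc c) ≢ 0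
        up k l h with north k c m h
        ... | k′ , refl = exit-≢0′ fromS k′ c (<⇒≤ l) m (trans (verticalMatch (suc k′) (suc c) z<s l z<s m) h)
        right-≢0 : hasE (tileAt D (suc k) (suc c)) ≡ true → eastExit (suc k) (suc c) ≢ 0
        right-≢0 h with suc c ≟ n
        ... | yes e rewrite ≤ᵇ-yes (≤-reflexive (sym e)) = λ ()
        ... | no ne rewrite ≤ᵇ-no (≤∧≢⇒< m ne) = exit-≢0′ fromW k (suc c) l (≤∧≢⇒< m ne)
              (trans (sym (horizontalMatch (suc k) (suc c) z<s l z<s (≤∧≢⇒< m ne))) h)

    rows : ∀ k → k < n → _
    rows k l = row-intro {_≺_ = All≺} {n} {suc k} {V k} {V (suc k)} (H (suc k)) (tileAt D (suc k)) refl
      (trans (if-yes (eastBoundary (suc k) z<s l)) (if-yes (≤ᵇ-yes {n} ≤-refl))) (λ c → cells k c l)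

  realizes : Realizes D V
  realizes k c l m = sym (proj₁ (proj₂ (rows k l)) c m)

  weak : LBPD All≺ n V
  weak = record
    { top = λ c → refl
    ; row = λ k l → proj₁ (rows k l)
    ; off = λ k _ c o → if-no (cong hasS (tileAt-off D k c o)) }

  saturated : Saturated n V
  saturated (suc c) p l z = go n refl z
    where
      go : ∀ m → m ≡ n → V m (suc c) ≢ 0
      go zero refl _ = n≮0 l
      go (suc m) e z = exit-≢0′ fromS m c (≤-reflexive e) l south (trans (sym (if-yes south)) z)
        where south : hasS (tileAt D (suc m) (suc c)) ≡ true
              south = trans (cong (λ k → hasS (tileAt D k (suc c))) e) (southBoundary (suc c) p l)

-- Inversions

lt : ℕ → ℕ → ℕ
lt x y = if x <ᵇ y then 1 else 0

less : (ℕ → ℕ) → ℕ → ℕ → ℕ → ℕ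
less f x a zero    = 0
less f x a (suc m) = lt (f a) x + less f x (suc a) m

-- counted in the interval a, …, a + m − 1
inv : (ℕ → ℕ) → ℕ → ℕ → ℕ
inv f a zero    = 0
inv f a (suc m) = less f (f a) (suc a) m + inv f (suc a) m

less-cong : ∀ {f g x} a m → (∀ j → a ≤ j → j < a + m → f j ≡ g j) → less f x a m ≡ less g x a m
less-cong a zero h = refl
less-cong {x = x} a (suc m) h = cong₂ _+_ (cong (λ z → lt z x) (h a ≤-refl (m<m+n a z<s)))
  (less-cong (suc a) m (λ j l q → let (p , r) = seg-tail l q in h j p r))

inv-cong : ∀ {f g} a m → (∀ j → a ≤ j → j < a + m → f j ≡ g j) → inv f a m ≡ inv g a m
inv-cong a zero h = refl
inv-cong {f} {g} a (suc m) h = cong₂ _+_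
  (trans (cong (λ x → less f x (suc a) m) (h a ≤-refl (m<m+n a z<s))) (less-cong (suc a) m tail))
  (inv-cong (suc a) m tail)
  where tail : ∀ j → suc a ≤ j → j < suc a + m → f j ≡ g j
        tail j l q = let (p , r) = seg-tail l q in h j p r

less-none : ∀ {f x} a m → (∀ j → a ≤ j → j < a + m → x ≤ f j) → less f x a m ≡ 0
less-none a zero h = refl
less-none {f} {x} a (suc m) h = cong₂ _+_ (if-no (<ᵇ-no (h a ≤-refl (m<m+n a z<s))))
  (less-none (suc a) m (λ j l q → let (p , r) = seg-tail l q in h j p r))

inv-id : ∀ {f} a m → (∀ j → a ≤ j → j < a + m → f j ≡ j) → inv f a m ≡ 0
inv-id a zero h = refl
inv-id {f} a (suc m) h = cong₂ _+_
  (less-none (suc a) m (λ j l q → let (p , r) = seg-tail l q in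
    subst₂ _≤_ (sym (h a ≤-refl (m<m+n a z<s))) (sym (h j p r)) p))
  (inv-id (suc a) m (λ j l q → let (p , r) = seg-tail l q in h j p r))

private
  two : ∀ {s m} → suc s < s + m → ∃[ m′ ] m ≡ suc (suc m′)
  two {s} {zero} l = ⊥-elim (<⇒≱ l (≤-trans (≤-reflexive (+-identityʳ s)) (n≤1+n s)))
  two {s} {suc zero} l = ⊥-elim (<⇒≱ l (≤-reflexive (+-comm s 1)))
  two {s} {suc (suc m)} l = m , refl

  beyond : ∀ (f : ℕ → ℕ) s j → suc (suc s) ≤ j → f (swap s j) ≡ f j
  beyond f s j l = cong f (swap-o (>⇒≢ (<⇒≤ l)) (>⇒≢ l))

less-swap : ∀ (f : ℕ → ℕ) x {s} a m → a ≤ s → suc s < a + m → less (f ∘ swap s) x a m ≡ less f x a m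
less-swap f x {s} a m l q with a ≟ s
... | yes refl with two q
...   | m , refl rewrite swap-l s | swap-r s = trans (sym (+-assoc (lt (f (suc s)) x) _ _)) (trans
        (cong₂ _+_ (+-comm (lt (f (suc s)) x) (lt (f s) x)) (less-cong (suc (suc s)) m (λ j p _ → beyond f s j p)))
        (+-assoc (lt (f s) x) _ _))
less-swap f x {s} a zero l q | no d = ⊥-elim (<⇒≱ q (≤-trans (≤-reflexive (+-identityʳ a)) (≤-trans l (n≤1+n s))))
less-swap f x {s} a (suc m) l q | no d = cong₂ _+_ (cong (λ z → lt (f z) x) (swap-o d (<⇒≢ (s≤s l))))
  (less-swap f x (suc a) m (≤∧≢⇒< l d) (subst (suc s <_) (+-suc a m) q))

-- Only the exchanged pair changes its status; every other comparison with one of the two entries is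
-- merely moved to the neighbouring position.
inv-ascent : ∀ f {s} a m → a ≤ s → suc s < a + m → f s < f (suc s) → inv (f ∘ swap s) a m ≡ suc (inv f a m)
inv-ascent f {s} a m l q h with a ≟ s
... | yes refl with two q
...   | m , refl rewrite swap-l s | swap-r s | <ᵇ-yes h | <ᵇ-no (<⇒≤ h) = cong suc (begin
    less (f ∘ swap s) (f (suc s)) A m + (less (f ∘ swap s) (f s) A m + inv (f ∘ swap s) A m)
      ≡⟨ cong₂ _+_ (tail-less (f (suc s))) (cong₂ _+_ (tail-less (f s)) (inv-cong A m (λ j p _ → beyond f s j p))) ⟩
    less f (f (suc s)) A m + (less f (f s) A m + inv f A m)
      ≡⟨ sym (+-assoc (less f (f (suc s)) A m) _ _) ⟩
    less f (f (suc s)) A m + less f (f s) A m + inv f A m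
      ≡⟨ cong (_+ inv f A m) (+-comm (less f (f (suc s)) A m) _) ⟩
    less f (f s) A m + less f (f (suc s)) A m + inv f A m
      ≡⟨ +-assoc (less f (f s) A m) _ _ ⟩
    less f (f s) A m + (less f (f (suc s)) A m + inv f A m) ∎)
  where
    open ≡-Reasoning
    A = suc (suc s)
    tail-less : ∀ x → less (f ∘ swap s) x A m ≡ less f x A m
    tail-less x = less-cong A m (λ j p _ → beyond f s j p)
inv-ascent f {s} a zero l q h | no d = ⊥-elim (<⇒≱ q (≤-trans (≤-reflexive (+-identityʳ a)) (≤-trans l (n≤1+n s))))
inv-ascent f {s} a (suc m) l q h | no d = trans (cong₂ _+_
    (trans (cong (λ z → less (f ∘ swap s) (f z) (suc a) m) (swap-o d (<⇒≢ (s≤s l))))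
      (less-swap f (f a) (suc a) m (≤∧≢⇒< l d) q′))
    (inv-ascent f (suc a) m (≤∧≢⇒< l d) q′ h)) (+-suc _ _)
  where q′ = subst (suc s <_) (+-suc a m) q

inv-descent : ∀ f {s} a m → a ≤ s → suc s < a + m → f (suc s) < f s → inv f a m ≡ suc (inv (f ∘ swap s) a m)
inv-descent f {s} a m l q h = trans (inv-cong a m (λ j _ _ → cong f (sym (swap-invol s j))))
  (inv-ascent (f ∘ swap s) a m l q (subst₂ _<_ (sym (at-l f s)) (sym (at-r f s)) h))

private
  pairs-less : ∀ (f : ℕ → ℕ) i a m → length (filterᵇ (λ ij → f (proj₂ ij) <ᵇ f (proj₁ ij)) (map (λ j → i , j) (seg a m))) ≡ less f (f i) a m
  pairs-less f i a zero = refl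
  pairs-less f i a (suc m) with f a <ᵇ f i
  ... | true = cong suc (pairs-less f i (suc a) m)
  ... | false = pairs-less f i (suc a) m

  inversions : ∀ (f : ℕ → ℕ) n a m → a + m ≡ suc n →
    length (filterᵇ (λ ij → f (proj₂ ij) <ᵇ f (proj₁ ij)) (concatMap (λ i → map (λ j → i , j) (fromTo (suc i) n)) (seg a m))) ≡ inv f a m
  inversions f n a zero e = refl
  inversions f n a (suc m) e = begin
    length (filterᵇ P (map (λ j → a , j) (fromTo (suc a) n) ++ rest))
      ≡⟨ cong length (filter-++ (T? ∘ P) (map (λ j → a , j) (fromTo (suc a) n)) rest) ⟩
    length (filterᵇ P (map (λ j → a , j) (fromTo (suc a) n)) ++ filterᵇ P rest)
      ≡⟨ length-++ (filterᵇ P (map (λ j → a , j) (fromTo (suc a) n))) ⟩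
    length (filterᵇ P (map (λ j → a , j) (fromTo (suc a) n))) + length (filterᵇ P rest)
      ≡⟨ cong₂ _+_ (trans (cong (λ l → length (filterᵇ P (map (λ j → a , j) l))) seg≡) (pairs-less f a (suc a) m))
                   (inversions f n (suc a) m (trans (sym (+-suc a m)) e)) ⟩
    less f (f a) (suc a) m + inv f (suc a) m ∎
    where
      open ≡-Reasoning
      P : ℕ × ℕ → Bool
      P ij = f (proj₂ ij) <ᵇ f (proj₁ ij)
      rest = concatMap (λ i → map (λ j → i , j) (fromTo (suc i) n)) (seg (suc a) m)
      seg≡ : fromTo (suc a) n ≡ seg (suc a) m
      seg≡ = trans (fromTo-seg (suc a) n) (cong (seg (suc a)) (trans (cong (_∸ suc a) (sym (trans (sym (+-suc a m)) e))) (m+n∸m≡n a m)))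

coxeterLength-inv : ∀ n (π : Permutation′ n) → coxeterLength n π ≡ inv (act π) 1 n
coxeterLength-inv n π rewrite fromTo-seg 1 n = inversions (act π) n 1 n refl

-- Reduced words

wordAct-inj : ∀ w {i j} → wordAct w i ≡ wordAct w j → i ≡ j
wordAct-inj [] h = h
wordAct-inj (s ∷ w) {i} {j} h = trans (sym (swap-invol s i)) (trans (cong (swap s) (wordAct-inj w h)) (swap-invol s j))

word-bound : ∀ w N → All (1 ≤_) w → All (_< N) w → inv (wordAct w) 1 N ≤ length w
word-bound [] N _ _ = ≤-reflexive (inv-id 1 N (λ _ _ _ → refl))
word-bound (s ∷ w) N (p ∷ ps) (q ∷ qs) with <-cmp (wordAct w s) (wordAct w (suc s))
... | tri< h _ _ = ≤-trans (≤-reflexive (inv-ascent (wordAct w) 1 N p (s≤s q) h)) (s≤s (word-bound w N ps qs))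
... | tri≈ _ h _ = ⊥-elim (1+n≢n (sym (wordAct-inj w h)))
... | tri> _ _ h = ≤-trans (n≤1+n _) (≤-trans (≤-reflexive (sym (inv-descent (wordAct w) 1 N p (s≤s q) h))) (m≤n⇒m≤1+n (word-bound w N ps qs)))

-- A word competing in the definition of reducedness may use letters beyond `n`. This bounds them,
-- and by `inv-extend` counting over the longer interval gives no further inversions.
bound : List ℕ → ℕ
bound []      = 0
bound (s ∷ w) = suc s + bound w

bound-< : ∀ n w → All (_< n + bound w) w
bound-< n [] = []
bound-< n (s ∷ w) = ≤-trans (m≤m+n (suc s) (bound w)) (m≤n+m _ n) ∷ weaken w (bound-< n w)
  where
    weaken : ∀ v → All (_< n + bound w) v → All (_< n + (suc s + bound w)) v
    weaken [] [] = []
    weaken (x ∷ v) (h ∷ hs) = ≤-trans h (+-monoʳ-≤ n (m≤n+m (bound w) (suc s))) ∷ weaken v hs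

record PermOn (n : ℕ) (f : ℕ → ℕ) : Set where
  field
    out : ∀ i → i ≡ 0 ⊎ n < i → f i ≡ i
    ins : ∀ i → 1 ≤ i → i ≤ n → 1 ≤ f i × f i ≤ n
    inj : ∀ i j → f i ≡ f j → i ≡ j

swap-in : ∀ {n s} → 1 ≤ s → s < n → ∀ i → 1 ≤ i → i ≤ n → 1 ≤ swap s i × swap s i ≤ n
swap-in {n} {s} p q i a b with swapView s i
... | left rewrite swap-l s = z<s , q
... | right rewrite swap-r s = p , <⇒≤ q
... | other d d′ rewrite swap-o d d′ = a , b

perm-swap : ∀ {n f s} → PermOn n f → 1 ≤ s → s < n → PermOn n (f ∘ swap s)
perm-swap {n} {f} {s} P p q = record
  { out = λ i o → trans (cong f (swap-off p q i o)) (PermOn.out P i o)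
  ; ins = λ i a b → let (a′ , b′) = swap-in p q i a b in PermOn.ins P (swap s i) a′ b′
  ; inj = λ i j h → trans (sym (swap-invol s i)) (trans (cong (swap s) (PermOn.inj P _ _ h)) (swap-invol s j)) }

less-extend : ∀ {n f x} → PermOn n f → x ≤ n → ∀ d a m → a + m ≡ suc n → less f x a (m + d) ≡ less f x a m
less-extend {n} {f} {x} P l d a zero e = less-none a d (λ j p _ → subst (x ≤_) (sym (PermOn.out P j (inj₂ (n<j j p)))) (≤-trans l (<⇒≤ (n<j j p))))
  where n<j : ∀ j → a ≤ j → n < j
        n<j j p = ≤-trans (≤-reflexive (trans (sym e) (+-identityʳ a))) p
less-extend {n} {f} {x} P l d a (suc m) e = cong (lt (f a) x +_) (less-extend P l d (suc a) m (trans (sym (+-suc a m)) e))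

inv-extend : ∀ {n f} → PermOn n f → ∀ d a m → 1 ≤ a → a + m ≡ suc n → inv f a (m + d) ≡ inv f a m
inv-extend {n} {f} P d a zero p e = inv-id a d (λ j q _ → PermOn.out P j (inj₂ (≤-trans (≤-reflexive (trans (sym e) (+-identityʳ a))) q)))
inv-extend {n} {f} P d a (suc m) p e = cong₂ _+_
  (less-extend P (proj₂ (PermOn.ins P a p (≤-pred (≤-trans (m<m+n a z<s) (≤-reflexive e))))) d (suc a) m (trans (sym (+-suc a m)) e))
  (inv-extend P d (suc a) m z<s (trans (sym (+-suc a m)) e))

inv-word-≤ : ∀ {n f} w → PermOn n f → All (1 ≤_) w → (∀ i → wordAct w i ≡ f i) → inv f 1 n ≤ length w
inv-word-≤ {n} {f} w P ps h = ≤-trans (≤-reflexive (trans (sym (inv-extend P (bound w) 1 n ≤-refl refl)) (inv-cong 1 (n + bound w) (λ j _ _ → sym (h j)))))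
  (word-bound w (n + bound w) ps (bound-< n w))

private
  ascents? : ∀ (f : ℕ → ℕ) (t : ℕ) → (∀ i j → f i ≡ f j → i ≡ j) → (∀ s → 1 ≤ s → s < t → f s < f (suc s)) ⊎ ∃[ s ] 1 ≤ s × s < t × f (suc s) < f s
  ascents? f zero inj = inj₁ λ s _ l → ⊥-elim (n≮0 l)
  ascents? f (suc t) inj with ascents? f t inj
  ... | inj₂ (s , p , q , h) = inj₂ (s , p , m<n⇒m<1+n q , h)
  ... | inj₁ h with 1 ≤? t | <-cmp (f t) (f (suc t))
  ...   | no z | _ = inj₁ λ s p l → ⊥-elim (z (≤-trans p (≤-pred l)))
  ...   | yes p | tri> _ _ x = inj₂ (t , p , ≤-refl , x)
  ...   | yes p | tri≈ _ x _ = ⊥-elim (1+n≢n (sym (inj _ _ x)))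
  ...   | yes p | tri< x _ _ = inj₁ go
    where go : ∀ s → 1 ≤ s → s < suc t → f s < f (suc s)
          go s a b with s ≟ t
          ... | yes refl = x
          ... | no d = h s a (≤∧≢⇒< (≤-pred b) d)

  increasing-id : ∀ {n f} → PermOn n f → (∀ s → 1 ≤ s → s < n → f s < f (suc s)) → ∀ i → 1 ≤ i → i ≤ n → f i ≡ i
  increasing-id {n} {f} P h i p q = ≤-antisym upper (lower i p q)
    where
      lower : ∀ i → 1 ≤ i → i ≤ n → i ≤ f i
      lower (suc zero) p q = proj₁ (PermOn.ins P 1 p q)
      lower (suc (suc i)) p q = ≤-trans (s≤s (lower (suc i) z<s (<⇒≤ q))) (h (suc i) z<s q)
      climb : ∀ j → j + i ≤ n → j + f i ≤ f (j + i)
      climb zero l = ≤-refl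
      climb (suc j) l = ≤-trans (s≤s (climb j (<⇒≤ l))) (h (j + i) (≤-trans p (m≤n+m i j)) l)
      upper : f i ≤ i
      upper = +-cancelˡ-≤ (n ∸ i) (f i) i (≤-trans (climb (n ∸ i) (≤-reflexive (m∸n+n≡m q)))
        (≤-trans (subst (λ m → f m ≤ n) (sym (m∸n+n≡m q)) (proj₂ (PermOn.ins P n (≤-trans p q) ≤-refl))) (≤-reflexive (sym (m∸n+n≡m q)))))

-- Sorting by descents; a permutation without descents is the identity. The word obtained turns
-- reducedness, defined as minimal length among all words, into the bound `length a ≤ inv f 1 n`.
reduced-word : ∀ {n} m f → PermOn n f → inv f 1 n ≡ m → ∃[ w ] All (1 ≤_) w × (∀ i → wordAct w i ≡ f i) × length w ≡ m
reduced-word {n} m f P e with ascents? f n (PermOn.inj P)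
... | inj₁ h = [] , [] , fixed , trans (sym (inv-id 1 n (λ j p q → increasing-id P h j p (≤-pred q)))) e
  where
    fixed : ∀ i → i ≡ f i
    fixed i with 1 ≤? i | i ≤? n
    ... | yes p | yes q = sym (increasing-id P h i p q)
    ... | no p | _ = sym (PermOn.out P i (inj₁ (n≤0⇒n≡0 (≤-pred (≰⇒> p)))))
    ... | yes _ | no q = sym (PermOn.out P i (inj₂ (≰⇒> q)))
reduced-word {n} zero f P e | inj₂ (s , p , q , h) with () ← trans (sym e) (inv-descent f 1 n p (s≤s q) h)
reduced-word {n} (suc m) f P e | inj₂ (s , p , q , h)
  with reduced-word m (f ∘ swap s) (perm-swap P p q) (suc-injective (trans (sym (inv-descent f 1 n p (s≤s q) h)) e))
... | w , ps , g , l = s ∷ w , p ∷ ps , (λ i → trans (g (swap s i)) (cong f (swap-invol s i))) , cong suc l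

-- If `s` were an ascent, the remaining word would represent a permutation with one inversion more
-- than `f`, although it has fewer letters than `f` has inversions. A descent lies inside the
-- square, as `f` fixes all points outside.
reduced-head : ∀ {n f s w} → PermOn n f → All (1 ≤_) (s ∷ w) → (∀ i → wordAct (s ∷ w) i ≡ f i) → length (s ∷ w) ≤ inv f 1 n →
  s < n × f (suc s) < f s × (∀ i → wordAct w i ≡ f (swap s i)) × length w ≤ inv (f ∘ swap s) 1 n
reduced-head {n} {f} {s} {w} P (p ∷ ps) h l = s<n , desc , tail , ≤-pred (≤-trans l (≤-reflexive (inv-descent f 1 n p (s≤s s<n) desc)))
  where
    tail : ∀ i → wordAct w i ≡ f (swap s i)
    tail i = trans (cong (wordAct w) (sym (swap-invol s i))) (h (swap s i))
    N = n + bound (s ∷ w)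
    desc : f (suc s) < f s
    desc with <-cmp (f s) (f (suc s)) | bound-< n (s ∷ w)
    ... | tri> _ _ x | _ = x
    ... | tri≈ _ x _ | _ = ⊥-elim (1+n≢n (sym (PermOn.inj P _ _ x)))
    ... | tri< x _ _ | q ∷ qs = ⊥-elim (1+n≰n (≤-trans (≤-trans (n≤1+n _) (≤-trans (s≤s l) (≤-reflexive big))) (word-bound w N ps qs)))
      where
        big : suc (inv f 1 n) ≡ inv (wordAct w) 1 N
        big = trans (cong suc (sym (inv-extend P (bound (s ∷ w)) 1 n ≤-refl refl)))
                (trans (sym (inv-ascent f 1 N p (s≤s q) x)) (inv-cong 1 N (λ j _ _ → sym (tail j))))
    s<n : s < n
    s<n with <-cmp s n
    ... | tri< x _ _ = x
    ... | tri≈ _ refl _ = ⊥-elim (<-asym desc (≤-trans (s≤s (proj₂ (PermOn.ins P s p ≤-refl))) (≤-reflexive (sym (PermOn.out P (suc s) (inj₂ ≤-refl))))))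
    ... | tri> _ _ x = ⊥-elim (<-asym desc (subst₂ _<_ (sym (PermOn.out P s (inj₂ x))) (sym (PermOn.out P (suc s) (inj₂ (m<n⇒m<1+n x)))) ≤-refl))

-- The action of a finite permutation on all positions

toFin-in : ∀ n i → i < n → ∃[ j ] toFin n i ≡ just j × toℕ j ≡ i
toFin-in (suc n) zero l = Fin.zero , refl , refl
toFin-in (suc n) (suc i) (s≤s l) with toFin-in n i l
... | j , e , q rewrite e = Fin.suc j , refl , cong suc q

toFin-out : ∀ n i → n ≤ i → toFin n i ≡ nothing
toFin-out zero i l = refl
toFin-out (suc n) (suc i) (s≤s l) rewrite toFin-out n i l = refl

act-in : ∀ {n} (π : Permutation′ n) i → i < n → ∃[ j ] act π (suc i) ≡ suc (toℕ (π ⟨$⟩ʳ j)) × toℕ j ≡ i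
act-in {n} π i l with toFin-in n i l
... | j , e , q rewrite e = j , refl , q

act-out : ∀ {n} (π : Permutation′ n) i → i ≡ 0 ⊎ n < i → act π i ≡ i
act-out π zero _ = refl
act-out {n} π (suc i) (inj₂ (s≤s l)) rewrite toFin-out n i l = refl

position : ∀ n i → (i ≡ 0 ⊎ n < i) ⊎ (1 ≤ i × i ≤ n)
position n zero = inj₁ (inj₁ refl)
position n (suc i) with suc i ≤? n
... | yes l = inj₂ (z<s , l)
... | no l = inj₁ (inj₂ (≰⇒> l))

act-perm : ∀ {n} (π : Permutation′ n) → PermOn n (act π)
act-perm {n} π = record { out = act-out π ; ins = ins ; inj = inj }
  where
    ins : ∀ i → 1 ≤ i → i ≤ n → 1 ≤ act π i × act π i ≤ n
    ins (suc i) _ l with act-in π i l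
    ... | j , e , _ rewrite e = z<s , toℕ<n (π ⟨$⟩ʳ j)
    clash : ∀ {i j} → i ≡ 0 ⊎ n < i → 1 ≤ j → j ≤ n → act π i ≢ act π j
    clash {i} {j} o p q h with ins j p q | trans (sym (act-out π i o)) h
    ... | a , b | refl = case o of λ where
      (inj₁ z) → <⇒≢ a (sym z)
      (inj₂ l) → <⇒≱ l b
    inj : ∀ i j → act π i ≡ act π j → i ≡ j
    inj i j h with position n i | position n j
    ... | inj₁ o | inj₁ o′ = trans (sym (act-out π i o)) (trans h (act-out π j o′))
    ... | inj₁ o | inj₂ (p , q) = ⊥-elim (clash o p q h)
    ... | inj₂ (p , q) | inj₁ o = ⊥-elim (clash o p q (sym h))
    inj (suc i) (suc j) h | inj₂ (p , q) | inj₂ (p′ , q′) with act-in π i q | act-in π j q′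
    ... | a , e , x | b , e′ , x′ = cong suc (trans (sym x) (trans (cong toℕ a≡b) x′))
      where a≡b : a ≡ b
            a≡b = trans (sym (inverseˡ π)) (trans (cong (π ⟨$⟩ˡ_) (toℕ-injective (suc-injective (trans (sym e) (trans h e′))))) (inverseˡ π))

-- Weights

rowBlanks : ℕ → Rows → ℕ → ℕ
rowBlanks n V k = blanks (V (pred k)) (V k) n

weights : (ℕ → ℕ) → ℕ → ℕ → List ℕ
weights w a zero    = []
weights w a (suc m) = replicate (w a) a ++ weights w (suc a) m

weights-cong : ∀ {w w′} a m → (∀ k → a ≤ k → k < a + m → w k ≡ w′ k) → weights w a m ≡ weights w′ a m
weights-cong a zero h = refl
weights-cong a (suc m) h = cong₂ _++_ (cong (λ x → replicate x a) (h a ≤-refl (m<m+n a z<s)))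
  (weights-cong (suc a) m (λ k l q → let (p , r) = seg-tail l q in h k p r))

weights-none : ∀ {w} a m → (∀ k → a ≤ k → k < a + m → w k ≡ 0) → weights w a m ≡ []
weights-none a zero h = refl
weights-none a (suc m) h rewrite h a ≤-refl (m<m+n a z<s) = weights-none (suc a) m (λ k l q → let (p , r) = seg-tail l q in h k p r)

-- The weight of a single ∇: the row `r` of the first mark loses one blank, and every other row
-- keeps its number.
weights-remove : ∀ {w w′ r} a m → a ≤ r → r < a + m → w r ≡ suc (w′ r) → (∀ k → a ≤ k → k < a + m → k ≢ r → w k ≡ w′ k) →
  weights w a m ↭ r ∷ weights w′ a m
weights-remove {r = r} a zero l q e h = ⊥-elim (<⇒≱ q (≤-trans (≤-reflexive (+-identityʳ a)) l))
weights-remove {w} {w′} {r} a (suc m) l q e h with a ≟ r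
... | yes refl rewrite e = ↭-prep a (↭-reflexive (cong (replicate (w′ a) a ++_)
        (weights-cong (suc a) m (λ k p s → let (p′ , s′) = seg-tail p s in h k p′ s′ (>⇒≢ p)))))
... | no d rewrite h a ≤-refl (m<m+n a z<s) d = ↭-trans (++⁺ˡ (replicate (w′ a) a)
        (weights-remove (suc a) m (proj₁ (seg-drop d l q)) (proj₂ (seg-drop d l q)) e (λ k p s → let (p′ , s′) = seg-tail p s in h k p′ s′)))
        (shift r (replicate (w′ a) a) (weights w′ (suc a) m))

private
  count-snoc : ∀ p a m → length (filterᵇ p (seg a (suc m))) ≡ (if p (a + m) then 1 else 0) + length (filterᵇ p (seg a m))
  count-snoc p a zero rewrite +-identityʳ a with p a
  ... | true = refl
  ... | false = refl
  count-snoc p a (suc m) rewrite +-suc a m with p a | count-snoc p (suc a) m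
  ... | true | ih = trans (cong suc ih) (sym (+-suc _ _))
  ... | false | ih = ih

  count-blanks : ∀ n {u v} (p : ℕ → Bool) → (∀ c → c < n → p (suc c) ≡ isBlank (tile u v (suc c))) → ∀ m → m ≤ n →
    length (filterᵇ p (seg 1 m)) ≡ blanks u v m
  count-blanks n p h zero l = refl
  count-blanks n p h (suc m) l = trans (count-snoc p 1 m) (cong₂ _+_ (cong (λ b → if b then 1 else 0) (h m l)) (count-blanks n p h m (<⇒≤ l)))

  map-const : ∀ {A : Set} (k : ℕ) (xs : List A) → map (λ _ → k) xs ≡ replicate (length xs) k
  map-const k [] = refl
  map-const k (_ ∷ xs) = cong (k ∷_) (map-const k xs)

  blankRows-seg : ∀ {n V} {D : Grid n} → Realizes D V → ∀ a m → 1 ≤ a → a + m ≡ suc n →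
    concatMap (λ k → map (λ _ → k) (filterᵇ (λ c → isBlank (tileAt D k c)) (fromTo 1 n))) (seg a m) ≡ weights (rowBlanks n V) a m
  blankRows-seg real a zero p e = refl
  blankRows-seg {n} {V} {D} real (suc a) (suc m) p e = cong₂ _++_
    (trans (map-const (suc a) (filterᵇ (λ c → isBlank (tileAt D (suc a) c)) (fromTo 1 n)))
      (cong (λ x → replicate x (suc a)) (trans (cong (λ l → length (filterᵇ (λ c → isBlank (tileAt D (suc a) c)) l)) (fromTo-seg 1 n))
        (count-blanks n (λ c → isBlank (tileAt D (suc a) c)) (λ c l → cong isBlank (real a c a<n l)) n ≤-refl))))
    (blankRows-seg real (suc (suc a)) m z<s (trans (sym (+-suc (suc a) m)) e))
    where
      a<n : a < n
      a<n = ≤-pred (≤-trans (m<m+n (suc a) z<s) (≤-reflexive e))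

blankRows-≡ : ∀ {n V} {D : Grid n} → Realizes D V → blankRows n D ≡ weights (rowBlanks n V) 1 n
blankRows-≡ {n} {V} {D} real =
  trans (cong (concatMap (λ k → map (λ _ → k) (filterᵇ (λ c → isBlank (tileAt D k c)) (fromTo 1 n)))) (fromTo-seg 1 n))
        (blankRows-seg {D = D} real 1 n ≤-refl refl)

-- Iterating ∇

last-blank : ∀ (t : ℕ → Tile) (m : ℕ) → (∀ c → 1 ≤ c → c ≤ m → t c ≢ blank) ⊎ ∃[ y ] 1 ≤ y × y ≤ m × t y ≡ blank × (∀ c → y < c → c ≤ m → t c ≢ blank)
last-blank t zero = inj₁ λ c p q → ⊥-elim (<⇒≱ p q)
last-blank t (suc m) with blank? (t (suc m))
... | yes e = inj₂ (suc m , z<s , ≤-refl , e , λ c p q → ⊥-elim (<⇒≱ p q))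
... | no ne with last-blank t m
...   | inj₁ h = inj₁ go
  where go : ∀ c → 1 ≤ c → c ≤ suc m → t c ≢ blank
        go c p q with c ≟ suc m
        ... | yes refl = ne
        ... | no d = h c p (≤-pred (≤∧≢⇒< q d))
...   | inj₂ (y , p , q , e , h) = inj₂ (y , p , m≤n⇒m≤1+n q , e , go)
  where go : ∀ c → y < c → c ≤ suc m → t c ≢ blank
        go c p q with c ≟ suc m
        ... | yes refl = ne
        ... | no d = h c p (≤-pred (≤∧≢⇒< q d))

first-blank : ∀ n V m → (∀ k → k < m → NoBlank n V k) ⊎
  ∃[ ρ ] ρ < m × (∀ k → k < ρ → NoBlank n V k) × ∃[ y ] 1 ≤ y × y ≤ n × tileIn V ρ y ≡ blank × (∀ c → y < c → c ≤ n → tileIn V ρ c ≢ blank)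
first-blank n V zero = inj₁ λ k l → ⊥-elim (n≮0 l)
first-blank n V (suc m) with first-blank n V m
... | inj₂ (ρ , l , rest) = inj₂ (ρ , m<n⇒m<1+n l , rest)
... | inj₁ h with last-blank (tileIn V m) n
...   | inj₂ r = inj₂ (m , ≤-refl , h , r)
...   | inj₁ g = inj₁ go
  where go : ∀ k → k < suc m → NoBlank n V k
        go k l with k ≟ m
        ... | yes refl = g
        ... | no d = h k (≤∧≢⇒< (≤-pred l) d)

∇-exists : ∀ {n V} → BPD n V → (∀ k → k < n → NoBlank n V k) ⊎
  ∃[ V′ ] ∃[ ρ ] ∃[ y ] Traj n V V′ ρ y × weights (rowBlanks n V) 1 n ↭ suc ρ ∷ weights (rowBlanks n V′) 1 n
∇-exists {n} {V} B with first-blank n V n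
... | inj₁ h = inj₁ h
... | inj₂ (ρ , l , full , y , p , q , b , bʳ) = inj₂ (F.V′ , ρ , F.y , F.traj
    , weights-remove 1 n z<s (s≤s l) (sym F.blanks-start) λ { (suc k) _ (s≤s m) d → sym (F.blanks-else k m (λ e → d (cong suc e))) })
  where module F = Forward B l full p q b bʳ

traj-bottom : ∀ {n V V′ ρ y} → Traj n V V′ ρ y → ∀ c → V n c ≡ V′ n (swap (y n) c)
traj-bottom {n} {V} {y = y} t c = trans (cong (V n) (sym (swap-invol (y n) c))) (sym (Traj.swapped t n (Traj.ρ<n t) ≤-refl _))

traj-range : ∀ {n V V′ ρ y} → Traj n V V′ ρ y → 1 ≤ y n × y n < n
traj-range t = Traj.range t _ (Traj.ρ<n t) ≤-refl

traj-saturated : ∀ {n V V′ ρ y} → Traj n V V′ ρ y → Saturated n V → Saturated n V′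
traj-saturated {n} {y = y} t F q a b e = F (swap (y n) q) (proj₁ s) (proj₂ s) (trans (sym (Traj.swapped t n (Traj.ρ<n t) ≤-refl q)) e)
  where s = swap-in (proj₁ (traj-range t)) (proj₂ (traj-range t)) q a b

-- On the bottom line every column is occupied, so `Clear` leaves only its second alternative.
traj-descent : ∀ {n V V′ ρ y} → Traj n V V′ ρ y → Saturated n V → V n (suc (y n)) < V n (y n)
traj-descent {n} {y = y} t F with proj₂ (Traj.active t n (Traj.ρ<n t) ≤-refl)
... | inj₁ e = ⊥-elim (F (y n) (proj₁ (traj-range t)) (<⇒≤ (proj₂ (traj-range t))) e)
... | inj₂ l = l

traj-inv : ∀ {n V V′ ρ y} → Traj n V V′ ρ y → Saturated n V → inv (V n) 1 n ≡ suc (inv (V′ n) 1 n)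
traj-inv {n} {V} t F = trans (inv-descent (V n) 1 n (proj₁ (traj-range t)) (s≤s (proj₂ (traj-range t))) (traj-descent t F))
  (cong suc (inv-cong 1 n (λ j _ _ → sym (Traj.swapped t n (Traj.ρ<n t) ≤-refl j))))

no-blank-id : ∀ {n V} → BPD n V → (∀ k → k < n → NoBlank n V k) → ∀ i → 1 ≤ i → i ≤ n → V n i ≡ i
no-blank-id {n} B nb = proj₁ (full-top B n ≤-refl nb)

no-blank-blanks : ∀ {n V} → (∀ k → k < n → NoBlank n V k) → weights (rowBlanks n V) 1 n ≡ []
no-blank-blanks {n} {V} nb = weights-none 1 n λ { (suc k) _ (s≤s l) → zeros k l n ≤-refl }
  where zeros : ∀ k → k < n → ∀ c → c ≤ n → blanks (V k) (V (suc k)) c ≡ 0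
        zeros k l zero _ = refl
        zeros k l (suc c) m = cong₂ _+_ (bit-nb (nb k l (suc c) z<s m)) (zeros k l c (<⇒≤ m))

pops-just : ∀ {n m σ a r σ′} → nabla n σ ≡ just ((a , r) , σ′) → pops n (suc m) σ ≡ (a ∷ proj₁ (pops n m σ′) , r ∷ proj₂ (pops n m σ′))
pops-just e rewrite e = refl

-- φ applies ∇ a fixed number of times. Each ∇ removes one inversion of the bottom state, and a pipe
-- dream without blanks has none, so the blanks are used up exactly when the count is.
pops-out : ∀ {n} m {V σ} → BPD n V → Saturated n V → Rep n σ V → inv (V n) 1 n ≡ m →
  Out n V (proj₁ (pops n m σ)) (proj₂ (pops n m σ)) × weights (rowBlanks n V) 1 n ↭ proj₂ (pops n m σ)
pops-out m {V} {σ} B F R e with ∇-exists B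
pops-out zero B F R e | inj₁ nb = nil nb , ↭-reflexive (no-blank-blanks nb)
pops-out {n} (suc m) B F R e | inj₁ nb with () ← trans (sym e) (inv-id 1 n (λ j p q → no-blank-id B nb j p (≤-pred q)))
pops-out zero B F R e | inj₂ (V′ , ρ , y , t , w) with () ← trans (sym e) (traj-inv t F)
pops-out {n} (suc m) {V} {σ} B F R e | inj₂ (V′ , ρ , y , t , w) with Loop.nabla-correct B F t R
... | σ′ , q , R′ with pops-out m (Traj.bpd′ t) (traj-saturated t F) R′ (suc-injective (trans (sym (traj-inv t F)) e))
...   | o , w′ = subst (λ s → Out n V (proj₁ s) (proj₂ s) × weights (rowBlanks n V) 1 n ↭ proj₂ s) (sym (pops-just {n} {m} {σ} q))
                   (cons t refl o , ↭-trans w (↭-prep (suc ρ) w′))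

-- Compatible sequences

out-letters : ∀ {n V as rs} → Out n V as rs → All (λ a → 1 ≤ a × a < n) as
out-letters (nil _) = []
out-letters (cons t refl o) = traj-range t ∷ out-letters o

out-word : ∀ {n V as rs} → BPD n V → Out n V as rs → ∀ i → 1 ≤ i → i ≤ n → wordAct as i ≡ V n i
out-word B (nil nb) i p q = sym (no-blank-id B nb i p q)
out-word B (cons {y = y} t refl o) i p q = trans (out-word (Traj.bpd′ t) o _ (proj₁ s) (proj₂ s)) (sym (traj-bottom t i))
  where s = swap-in (proj₁ (traj-range t)) (proj₂ (traj-range t)) i p q

wordAct-off : ∀ {n as} → All (λ a → 1 ≤ a × a < n) as → ∀ i → i ≡ 0 ⊎ n < i → wordAct as i ≡ i
wordAct-off [] i o = refl
wordAct-off {n} {a ∷ as} ((p , q) ∷ ls) i o = trans (cong (wordAct as) (swap-off p q i o)) (wordAct-off ls i o)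

out-length : ∀ {n V as rs} → BPD n V → Saturated n V → Out n V as rs → length as ≡ inv (V n) 1 n
out-length {n} B F (nil nb) = sym (inv-id 1 n (λ j p q → no-blank-id B nb j p (≤-pred q)))
out-length B F (cons t refl o) = trans (cong suc (out-length (Traj.bpd′ t) (traj-saturated t F) o)) (sym (traj-inv t F))

out-rows : ∀ {n V as rs} → BPD n V → Out n V as rs → Pointwise _≤_ rs as × All (1 ≤_) rs
out-rows B (nil _) = [] , []
out-rows B (cons t refl o) with out-rows (Traj.bpd′ t) o
... | p , q = traj-low B t _ (Traj.ρ<n t) ≤-refl ∷ p , z<s ∷ q

out-linked : ∀ {n V as rs} → Out n V as rs → Linked CompatStep (zip as rs)
out-linked (nil _) = []
out-linked (cons t refl (nil _)) = [-]
out-linked {n} (cons {ρ = ρ} {y = y} t refl (cons {ρ = ρ′} {y = y′} t′ refl o)) = (s≤s (traj-start t t′) , strictly) ∷ out-linked (cons t′ refl o)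
  where
    strictly : y n < y′ n → suc ρ < suc ρ′
    strictly l with ρ ≟ ρ′
    ... | yes refl = ⊥-elim (<-asym l (traj-order t t′ n (Traj.ρ<n t) ≤-refl))
    ... | no d = s≤s (≤∧≢⇒< (traj-start t t′) d)

out-compatible : ∀ {n} (π : Permutation′ n) {V as rs} → BPD n V → Saturated n V → (∀ i → 1 ≤ i → i ≤ n → V n i ≡ act π i) →
  Out n V as rs → IsCompatible π (as , rs)
out-compatible {n} π {V} {as} B F e o =
  ((All.map proj₁ (out-letters o) , word) , λ b (ps , h) → ≤-trans (≤-reflexive len) (inv-word-≤ b (act-perm π) ps h))
  , proj₁ (out-rows B o) , proj₂ (out-rows B o) , out-linked o
  where
    word : ∀ i → wordAct as i ≡ act π i
    word i with position n i
    ... | inj₁ off = trans (wordAct-off (out-letters o) i off) (sym (act-out π i off))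
    ... | inj₂ (p , q) = trans (out-word B o i p q) (e i p q)
    len : length as ≡ inv (act π) 1 n
    len = trans (out-length B F o) (inv-cong 1 n (λ j p q → e j p (≤-pred q)))

-- From compatible sequences to bumpless pipe dreams

-- The labels of the blank-free pipe dream, in which pipe `k` has a single turn, at `(k , k)`. It is
-- the base of the construction in `realize`.
idRows : Rows
idRows k c = if (1 ≤ᵇ c) ∧ (c ≤ᵇ k) then c else 0

private
  id-in : ∀ {k c} → 1 ≤ c → c ≤ k → idRows k c ≡ c
  id-in p q = if-yes (∧-yes (≤ᵇ-yes p) (≤ᵇ-yes q))

  id-out : ∀ {k c} → k < c → idRows k c ≡ 0
  id-out {k} {c} l = if-no (∧-noʳ {1 ≤ᵇ c} (≤ᵇ-no l))

  idTile : ℕ → ℕ → Tile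
  idTile k c = if c ≤ᵇ k then ver else (if c ≡ᵇ suc k then rtile else hor)

  idCarrier : ℕ → ℕ → ℕ
  idCarrier k c = if c ≤ᵇ k then 0 else suc k

  id-cell : ∀ k c → Cell (idTile k (suc c)) (idRows k (suc c)) (idCarrier k (suc c)) (idRows (suc k) (suc c)) (idCarrier k c)
  id-cell k c with <-cmp c k
  ... | tri< l _ _ = cell-subst (if-yes (≤ᵇ-yes l)) (id-in {k} z<s l) (if-yes (≤ᵇ-yes l)) (id-in {suc k} z<s (m≤n⇒m≤1+n l)) (if-yes (≤ᵇ-yes (<⇒≤ l))) cVer
  ... | tri≈ _ refl _ = cell-subst (trans (if-no (≤ᵇ-no {suc c} ≤-refl)) (if-yes (≡ᵇ-yes {c} refl))) (id-out {c} ≤-refl) (if-no (≤ᵇ-no {suc c} ≤-refl))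
                          (id-in {suc c} z<s ≤-refl) (if-yes (≤ᵇ-yes {c} ≤-refl)) cR
  ... | tri> _ _ l = cell-subst (trans (if-no (≤ᵇ-no (m<n⇒m<1+n l))) (if-no (≡ᵇ-no (>⇒≢ l)))) (id-out {k} (m<n⇒m<1+n l)) (if-no (≤ᵇ-no (m<n⇒m<1+n l)))
                       (id-out {suc k} (s≤s l)) (if-no (≤ᵇ-no l)) cHor

  id-row : ∀ {n} k → k < n → _
  id-row {n} k l = row-intro {n = n} {k = suc k} {u = idRows k} {v = idRows (suc k)} (idCarrier k) (idTile k) refl (if-no (≤ᵇ-no l)) (λ c _ → id-cell k c)

  idTile-nb : ∀ k c → idTile k c ≢ blank
  idTile-nb k c e with c ≤ᵇ k | c ≡ᵇ suc k
  ... | true | _ with () ← e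
  ... | false | true with () ← e
  ... | false | false with () ← e

id-bpd : ∀ n → BPD n idRows
id-bpd n = record
  { top = λ { zero → refl ; (suc c) → refl }
  ; row = λ k l → proj₁ (id-row {n} k l)
  ; off = λ { k l c (inj₁ refl) → refl ; k l c (inj₂ m) → id-out {k} (≤-<-trans l m) } }

id-noBlank : ∀ n k → k < n → NoBlank n idRows k
id-noBlank n k l (suc c) p m e = idTile-nb k (suc c) (trans (sym (proj₁ (proj₂ (id-row {n} k l)) c m)) e)

Starts : ∀ (n : ℕ) → Rows → ℕ → ℕ → Set
Starts n V′ ρ a = (∀ k → k < ρ → NoBlank n V′ k) × ∃[ b ] Barrier n V′ ρ a b

-- The next entry of the sequence decides between the two barriers. If it is missing or belongs to a
-- later row, the column of pipe `suc ρ` serves. If it belongs to the same row, compatibility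
-- excludes `a < y′ n`, and equality fails because `a` is an ascent of the bottom state and `y′ n` a
-- descent.
starts : ∀ {n V′ ρ a as rs} → BPD n V′ → Saturated n V′ → Out n V′ as rs → ρ < a → a < n → V′ n a < V′ n (suc a) →
  Linked CompatStep (zip (a ∷ as) (suc ρ ∷ rs)) → Starts n V′ ρ a
starts B F (nil nb) l m asc _ = (λ k p → nb k (<-trans p (<-trans l m))) , _ , barrier-full B (<-trans l m) (λ k p → nb k (≤-<-trans p (<-trans l m))) l
starts {n} {V′} {ρ} {a} B F (cons {ρ = ρ′} {y = y′} t refl o) l m asc ((p , q) ∷ _)
  = (λ k r → Traj.full t k (<-≤-trans r (≤-pred p))) , bar
  where
    bar : ∃[ b ] Barrier n V′ ρ a b
    bar with ρ ≟ ρ′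
    ... | no d = _ , barrier-full B (<-trans l m) (λ k r → Traj.full t k (≤-<-trans r (≤∧≢⇒< (≤-pred p) d))) l
    ... | yes refl with <-cmp a (y′ n)
    ...   | tri< x _ _ = ⊥-elim (<-irrefl refl (q x))
    ...   | tri≈ _ refl _ = ⊥-elim (<-asym asc (traj-descent t F))
    ...   | tri> _ _ x = _ , barrier-traj B t x

-- The remaining sequence is realized for `f ∘ swap a`, and a backward run from column `a` prepends
-- the first pair. Reducedness enters as a bound on the length, which the tail inherits by
-- `reduced-head`.
realize : ∀ {n} as rs {f} → PermOn n f → All (1 ≤_) as → (∀ i → wordAct as i ≡ f i) → length as ≤ inv f 1 n →
  Pointwise _≤_ rs as → All (1 ≤_) rs → Linked CompatStep (zip as rs) →
  ∃[ V ] BPD n V × (∀ i → 1 ≤ i → i ≤ n → V n i ≡ f i) × Out n V as rs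
realize {n} [] [] P _ h _ _ _ _ = idRows , id-bpd n , (λ i p q → trans (id-in {n} p q) (h i)) , nil (id-noBlank n)
realize {n} (a ∷ as) (suc ρ ∷ rs) {f} P (1≤a ∷ ps) h l (r≤a ∷ rw) (1≤r ∷ rp) ln with reduced-head P (1≤a ∷ ps) h l
... | a<n , desc , h′ , l′ with realize as rs (perm-swap P 1≤a a<n) ps h′ l′ rw rp (tail ln)
  where
    tail : ∀ {x as rs} → Linked CompatStep (x ∷ zip as rs) → Linked CompatStep (zip as rs)
    tail {as = []} [-] = []
    tail {as = _ ∷ _} {[]} [-] = []
    tail {as = _ ∷ _} {_ ∷ _} (_ ∷ x) = x
...   | V′ , B , e , o = Bw.V , Bw.bpd , bottom , cons Bw.traj Bw.y-end o
  where
    F : Saturated n V′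
    F q x y z = <⇒≢ (proj₁ (PermOn.ins (perm-swap P 1≤a a<n) q x y)) (sym (trans (sym (e q x y)) z))
    asc : V′ n a < V′ n (suc a)
    asc = subst₂ _<_ (sym (trans (e a 1≤a (<⇒≤ a<n)) (at-l f a))) (sym (trans (e (suc a) z<s a<n) (at-r f a))) desc
    st = starts B F o r≤a a<n asc ln
    module Bw = Backward B (<-trans r≤a a<n) (proj₁ st) a<n (F a 1≤a (<⇒≤ a<n) , inj₂ asc) (proj₂ (proj₂ st))
    bottom : ∀ i → 1 ≤ i → i ≤ n → Bw.V n i ≡ f i
    bottom i p q = trans (traj-bottom Bw.traj i) (trans (cong (λ z → V′ n (swap z i)) Bw.y-end)
      (trans (e (swap a i) (proj₁ s) (proj₂ s)) (cong f (swap-invol a i))))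
      where s = swap-in 1≤a a<n i p q

-- The bijection

record Model {n} (π : Permutation′ n) (D : Grid n) : Set where
  field
    V         : Rows
    bpd       : BPD n V
    saturated : Saturated n V
    realizes  : Realizes D V
    bottom    : ∀ i → 1 ≤ i → i ≤ n → V n i ≡ act π i

  out : Out n V (proj₁ (φ n π D)) (proj₂ (φ n π D)) × weights (rowBlanks n V) 1 n ↭ proj₂ (φ n π D)
  out = pops-out (coxeterLength n π) bpd saturated (Trace.initConf-rep {D = D} bpd realizes saturated)
    (trans (inv-cong 1 n (λ j p q → bottom j p (≤-pred q))) (sym (coxeterLength-inv n π)))

model : ∀ {n} {π : Permutation′ n} {D} → IsBPD n π D → Model π D
model {n} {π} {D} isBPD = record
  { V = G.V ; bpd = Strict.strict {D = D} G.weak G.saturated G.realizes reduced ; saturated = G.saturated ; realizes = G.realizes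
  ; bottom = λ i p q → trans (sym (Trace.exitRow-≡ {D = D} G.weak G.realizes G.saturated i p q)) (exits i p q) }
  where
    open IsBPD isBPD
    module G = FromGrid D valid

isBPD-toGrid : ∀ {n} {π : Permutation′ n} {V} → BPD n V → Saturated n V → (∀ i → 1 ≤ i → i ≤ n → V n i ≡ act π i) → IsBPD n π (toGrid n V)
isBPD-toGrid {n} {π} {V} B F e = record
  { valid = validTiling {D = toGrid n V} B F (toGrid-realizes n V)
  ; exits = λ i p q → trans (Trace.exitRow-≡ {D = toGrid n V} B (toGrid-realizes n V) F i p q) (e i p q)
  ; reduced = reducedness {D = toGrid n V} B F (toGrid-realizes n V) }

theorem3p6 : (n : ℕ) (π : Permutation′ n) →
    -- φ maps BPD(π) into the compatible sequences of π (≅ PD(π))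
    (∀ D → IsBPD n π D → IsCompatible π (φ n π D))
    -- φ is injective on BPD(π)
    × (∀ D D′ → IsBPD n π D → IsBPD n π D′ → φ n π D ≡ φ n π D′ → D ≡ D′)
    -- φ is surjective onto the compatible sequences of π
    × (∀ s → IsCompatible π s → Σ[ D ∈ Grid n ] (IsBPD n π D × φ n π D ≡ s))
    -- weight preservation: ∏_{(i,j) blank} x_i = ∏_k x_{r_k}
    × (∀ D → IsBPD n π D → blankRows n D ↭ proj₂ (φ n π D))
theorem3p6 n π = compatible , injective , surjective , weight
  where
    compatible : ∀ D → IsBPD n π D → IsCompatible π (φ n π D)
    compatible D b = out-compatible π bpd saturated bottom (proj₁ out)
      where open Model (model b)

    injective : ∀ D D′ → IsBPD n π D → IsBPD n π D′ → φ n π D ≡ φ n π D′ → D ≡ D′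
    injective D D′ b b′ e = grid-ext {D = D} {D′} M.realizes M′.realizes
      (out-inj M.bpd M′.bpd (subst (λ s → Out n M.V (proj₁ s) (proj₂ s)) e (proj₁ M.out)) (proj₁ M′.out))
      where module M = Model (model b)
            module M′ = Model (model b′)

    surjective : ∀ s → IsCompatible π s → Σ[ D ∈ Grid n ] (IsBPD n π D × φ n π D ≡ s)
    surjective (as , rs) (((ps , h) , minimal) , rw , rp , ln)
      with reduced-word (inv (act π) 1 n) (act π) (act-perm π) refl
    ... | w , qs , g , len with realize as rs (act-perm π) ps h (≤-trans (minimal w (qs , g)) (≤-reflexive len)) rw rp ln
    ...   | V , B , e , o = toGrid n V , isBPD-toGrid B F e , cong₂ _,_ (proj₁ same) (proj₂ same)
      where
        F : Saturated n V
        F q x y z = <⇒≢ (proj₁ (PermOn.ins (act-perm π) q x y)) (sym (trans (sym (e q x y)) z))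
        M : Model π (toGrid n V)
        M = record { V = V ; bpd = B ; saturated = F ; realizes = toGrid-realizes n V ; bottom = e }
        -- φ of the constructed tiling and the given sequence are both outputs of the same `V`.
        same = out-det B (proj₁ (Model.out M)) o

    weight : ∀ D → IsBPD n π D → blankRows n D ↭ proj₂ (φ n π D)
    weight D b = ↭-trans (↭-reflexive (blankRows-≡ {D = D} realizes)) (proj₂ out)
      where open Model (model b)
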